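{- Let $\lambda$ be a nonzero integer partition, let $n = h_\lambda(1,1) + 1$, and let $c \in \mathfrak{S}_n$ be a Coxeter element. The map $\operatorname{RSK}_{\lambda,c}$ is a one-to-one correspondence from fillings of shape $\lambda$ to reverse plane partitions of shape $\lambda$.
   Context: An integer partition $\lambda$ is a weakly decreasing sequence of nonnegative integers with finitely many nonzero terms. Its Ferrers diagram $\operatorname{Fer}(\lambda)$ is the set of boxes $(i,j)$ (row $i$, column $j$) with $1 \le j \le \lambda_i$, partially ordered by the componentwise (Cartesian product) order $\unlhd$. A filling of shape $\lambda$ is a map $f:\operatorname{Fer}(\lambda)\to\mathbb{N}$; it is a reverse plane partition if it is weakly increasing with respect to $\unlhd$. The hook length of the box $(1,1)$ is $h_\lambda(1,1) = \#\{(i,j) \in \operatorname{Fer}(\lambda) : i=1 \text{ or } j=1\}$. For $m\in\mathbb{Z}$ the $m$th diagonal is $D_m(\lambda)=\{(i,j)\in\operatorname{Fer}(\lambda) : i-j+\lambda_1=m\}$; it is nonempty for $1\le m\le h_\lambda(1,1)$, and $(u_m,v_m)$ denotes its maximal element for $\unlhd$. Greene--Kleitman invariant: for a finite acyclic directed graph $G$ and a filling $f:G_0\to\mathbb{N}$ of its vertices, let $M_0(f)=0$ and for $\ell\ge1$ let $M_\ell(f)$ be the maximum, over all $\ell$-tuples of directed paths in $G$, of the sum of $f(v)$ over all vertices $v$ lying on at least one of the paths. Then $\operatorname{GK}_G(f) = (M_\ell(f)-M_{\ell-1}(f))_{\ell\ge1}$, which is an integer partition. An interval bipartition $(\mathbf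 B,\mathbf E)$ is a pair of subsets of $\mathbb{N}^*$ forming a set partition of an interval $\{i,\dots,j\}$; it is elementary if $1\in\mathbf B$ and $\max(\mathbf B\cup\mathbf E)\in\mathbf E$. Writing $\mathbf B=\{b_1<\dots<b_p\}$, $\mathbf E=\{e_1<\dots<e_q\}$, the partition $\lambda(\mathbf B,\mathbf E)$ has $(i,j)$ in its Ferrers diagram iff $b_i<e_{q-j+1}$. Every nonzero $\lambda$ equals $\lambda(\mathbf B,\mathbf E)$ for a unique elementary interval bipartition; fix this one (it partitions $\{1,\dots,n\}$). Each box $(i,j)\in\operatorname{Fer}(\lambda)$ is labelled by the transposition $(b_i,e_{q-j+1})\in\mathfrak{S}_n$. A Coxeter element $c\in\mathfrak{S}_n$ is a product of all adjacent transpositions $s_i=(i,i+1)$, $1\le i<n$, each appearing exactly once, in some order. Its Auslander--Reiten quiver $\operatorname{AR}(c)$ is the directed graph whose vertices are the transpositions $(i,j)$ with $i<j$, with arrows $(i,j)\to(i,c(j))$ whenever $i<c(j)$ and $(i,j)\to(c(i),j)$ whenever $c(i)<j$. For $m\in\{1,\dots,n-1\}$, $\operatorname{AR}_m(c)$ is the subgraph of $\operatorname{AR}(c)$ on the vertices $(i,j)$ with $i\le m<j$. Given a filling $f$ of shape $\lambda$, let $\overline f$ be the filling of the vertices of $\operatorname{AR}(c)$ with $\overline f(b_i,e_{q-j+1})=f(i,j)$ for $(i,j)\in\operatorname{Fer}(\lambda)$ and $\overline f=0$ on all other vertices. Then $g=\operatorname{RSK}_{\lambda,c}(f)$ is the filling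 of shape $\lambda$ defined, for each $m\in\{1,\dots,n-1\}$ and each $(i,j)\in D_m(\lambda)$, by $g(i,j)=\operatorname{GK}_{\operatorname{AR}_m(c)}(\overline f)_{u_m-i+1}$. -}

module Defs where

open import Data.Nat using (ℕ; zero; suc; _+_; _∸_; _≤_; _<_; _⊔_; _≤ᵇ_; _<ᵇ_; _≡ᵇ_)
open import Data.Bool using (Bool; true; false; if_then_else_; _∧_; _∨_)
open import Data.List using (List; []; _∷_; length; map; concatMap; foldr; applyUpTo; filterᵇ; drop)
open import Data.Nat.ListAction using (sum)
open import Data.Bool.ListAction using (any)
open import Data.Maybe using (Maybe; just; nothing)
import Data.Maybe as Maybe
open import Data.Product using (_×_; _,_; Σ; ∃)
open import Data.Sum using (_⊎_)
open import Data.Empty using (⊥)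
open import Data.List.Membership.Propositional using (_∈_)
open import Data.List.Relation.Unary.AllPairs using (AllPairs)
open import Data.List.Relation.Binary.Permutation.Propositional using (_↭_)

-- Integer partitions
-- A partition is given by a finite list (λ₁, λ₂, …, λ_k); all later
-- terms are 0.  Indices are 1-based as in the paper.

at : List ℕ → ℕ → ℕ
at [] _ = 0
at (x ∷ _) zero = x
at (_ ∷ xs) (suc k) = at xs k

-- λ_i (meaningful for i ≥ 1)
row : List ℕ → ℕ → ℕ
row la i = at la (i ∸ 1)

IsPartition : List ℕ → Set
IsPartition la = ∀ i → 1 ≤ i → row la (suc i) ≤ row la i

NonzeroPartition : List ℕ → Set
NonzeroPartition la = Σ ℕ (λ i → 1 ≤ i × 1 ≤ row la i)

Fer : List ℕ → ℕ → ℕ → Set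
Fer la i j = 1 ≤ i × 1 ≤ j × j ≤ row la i

ferᵇ : List ℕ → ℕ → ℕ → Bool
ferᵇ la i j = (1 ≤ᵇ i) ∧ ((1 ≤ᵇ j) ∧ (j ≤ᵇ row la i))

-- Fillings of shape λ are maps ℕ → ℕ → ℕ, of which only the values on
-- Fer(λ) matter; two fillings are identified iff they agree on Fer(λ).
Filling : Set
Filling = ℕ → ℕ → ℕ

SameOn : List ℕ → Filling → Filling → Set
SameOn la f g = ∀ i j → Fer la i j → f i j ≡ g i j
  where open import Relation.Binary.PropositionalEquality using (_≡_)

IsRPP : List ℕ → Filling → Set
IsRPP la f = ∀ i j i' j' → Fer la i j → Fer la i' j' → i ≤ i' → j ≤ j' → f i j ≤ f i' j'

-- h_λ(1,1) = #{(i,j) ∈ Fer(λ) : i = 1 or j = 1}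
--          = λ₁ (boxes of row 1) + #{i ≥ 2 : λ_i ≥ 1} (other boxes of column 1)
hook11 : List ℕ → ℕ
hook11 la = row la 1 + sum (map (λ x → if 1 ≤ᵇ x then 1 else 0) (drop 1 la))

range : ℕ → ℕ → List ℕ
range a b = applyUpTo (a +_) (suc b ∸ a)

-- u_m : the row index of the maximal box of the diagonal
-- D_m(λ) = {(i,j) ∈ Fer(λ) : i - j + λ₁ = m}, i.e. j = i + λ₁ - m
uDiag : List ℕ → ℕ → ℕ
uDiag la m = foldr (λ i acc → if onDiag i then i ⊔ acc else acc) 0 (range 1 (length la))
  where
  onDiag : ℕ → Bool
  onDiag i = (m <ᵇ i + row la 1) ∧ ferᵇ la i (i + row la 1 ∸ m)

-- Interval bipartitions.  B = {b₁ < … < b_p} and E = {e₁ < … < e_q}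
-- are given as strictly increasing lists.

record ElementaryBip (B E : List ℕ) : Set where
  field
    lo hi   : ℕ
    B-inc   : AllPairs _<_ B
    E-inc   : AllPairs _<_ E
    lo-pos  : 1 ≤ lo
    cover   : ∀ k → (k ∈ B ⊎ k ∈ E) → lo ≤ k × k ≤ hi
    covered : ∀ k → lo ≤ k → k ≤ hi → k ∈ B ⊎ k ∈ E
    disj    : ∀ k → k ∈ B → k ∈ E → ⊥
    one∈B   : 1 ∈ B
    max∈E   : hi ∈ E

-- (i , j) ∈ Fer(λ(B,E))  iff  b_i < e_{q-j+1}
FerBE : List ℕ → List ℕ → ℕ → ℕ → Set
FerBE B E i j = 1 ≤ i × i ≤ length B × 1 ≤ j × j ≤ length E × at B (i ∸ 1) < at E (length E ∸ j)

ShapeIs : List ℕ → List ℕ → List ℕ → Set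
ShapeIs la B E = ∀ i j → (Fer la i j → FerBE B E i j) × (FerBE B E i j → Fer la i j)

-- Coxeter elements of 𝔖_n, given by a word: an ordering (a₁,…,a_{n-1})
-- of {1,…,n-1}; c = s_{a₁} s_{a₂} ⋯ s_{a_{n-1}}.

IsCoxeterWord : ℕ → List ℕ → Set
IsCoxeterWord n w = w ↭ applyUpTo suc (n ∸ 1)

sAdj : ℕ → ℕ → ℕ
sAdj a x = if x ≡ᵇ a then suc a else (if x ≡ᵇ suc a then a else x)

cox : List ℕ → ℕ → ℕ
cox w x = foldr sAdj x w

Vertex : Set
Vertex = ℕ × ℕ

eqV : Vertex → Vertex → Bool
eqV (a , b) (a' , b') = (a ≡ᵇ a') ∧ (b ≡ᵇ b')

arrowᵇ : (ℕ → ℕ) → Vertex → Vertex → Bool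
arrowᵇ c (i , j) (i' , j') =
  ((i' ≡ᵇ i) ∧ ((j' ≡ᵇ c j) ∧ (i <ᵇ c j))) ∨ ((i' ≡ᵇ c i) ∧ ((j' ≡ᵇ j) ∧ (c i <ᵇ j)))

vertsAR : ℕ → ℕ → List Vertex
vertsAR n m = concatMap (λ i → map (λ j → (i , j)) (range (suc m) n)) (range 1 m)

isPathᵇ : (ℕ → ℕ) → List Vertex → Bool
isPathᵇ c [] = false
isPathᵇ c (v ∷ []) = true
isPathᵇ c (u ∷ v ∷ r) = arrowᵇ c u v ∧ isPathᵇ c (v ∷ r)

allLists : {A : Set} → ℕ → List A → List (List A)
allLists zero V = [] ∷ []
allLists (suc k) V = concatMap (λ v → map (v ∷_) (allLists k V)) V

-- all directed paths of the (acyclic) graph with vertex set V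
-- (a path in an acyclic graph has at most |V| vertices)
paths : (ℕ → ℕ) → List Vertex → List (List Vertex)
paths c V = concatMap (λ k → filterᵇ (isPathᵇ c) (allLists k V)) (range 1 (length V))

tupleWeight : (Vertex → ℕ) → List Vertex → List (List Vertex) → ℕ
tupleWeight F V tup = sum (map (λ v → if any (λ p → any (eqV v) p) tup then F v else 0) V)

Mℓ : (ℕ → ℕ) → List Vertex → (Vertex → ℕ) → ℕ → ℕ
Mℓ c V F ℓ = foldr _⊔_ 0 (map (tupleWeight F V) (allLists ℓ (paths c V)))

-- GK(F)_ℓ for ℓ ≥ 1 (1-indexed parts)
GK : (ℕ → ℕ) → List Vertex → (Vertex → ℕ) → ℕ → ℕ
GK c V F zero = 0
GK c V F (suc ℓ) = Mℓ c V F (suc ℓ) ∸ Mℓ c V F ℓ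

indexOf : ℕ → List ℕ → Maybe ℕ
indexOf a [] = nothing
indexOf a (x ∷ xs) = if a ≡ᵇ x then just 0 else Maybe.map suc (indexOf a xs)

-- f̄ : f̄(b_i , e_{q-j+1}) = f(i,j) for (i,j) ∈ Fer(λ), 0 elsewhere
fbar : List ℕ → List ℕ → List ℕ → Filling → Vertex → ℕ
fbar la B E f (a , b) with indexOf a B | indexOf b E
... | just i0 | just k0 =
  if ferᵇ la (suc i0) (length E ∸ k0) then f (suc i0) (length E ∸ k0) else 0
... | _ | _ = 0

-- g(i,j) = GK_{AR_m(c)}(f̄)_{u_m - i + 1}  for (i,j) ∈ D_m(λ), m = i - j + λ₁
-- (set to 0 outside Fer(λ), where it is irrelevant)
RSK : List ℕ → List ℕ → List ℕ → List ℕ → Filling → Filling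
RSK la B E w f i j =
  if ferᵇ la i j
  then GK (cox w) (vertsAR n m) (fbar la B E f) (uDiag la m ∸ i + 1)
  else 0
  where
  n = hook11 la + 1
  m = i + row la 1 ∸ j

record OneToOneFillingsToRPP (la : List ℕ) (Φ : Filling → Filling) : Set where
  field
    well-defined : ∀ f f' → SameOn la f f' → SameOn la (Φ f) (Φ f')
    into-RPP     : ∀ f → IsRPP la (Φ f)
    injective    : ∀ f f' → SameOn la (Φ f) (Φ f') → SameOn la f f'
    surjective   : ∀ g → IsRPP la g → Σ Filling (λ f → SameOn la (Φ f) g)

{-# OPTIONS --safe #-}

-- The cycle c runs through {1, …, m} and then through {m + 1, …, n}, so AR_m(c) is a grid with rows
-- b ≤ m and columns e > m in the order of the cycle, and the passage from m to m + 1 moves m + 1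
-- from one end of the columns to one end of the rows.  Let s(b, e) be the Greene-Kleitman shape of
-- the filling on the rows 1, …, b and the columns e, …, n.  The shapes s(b - 1, e + 1), s(b - 1, e),
-- s(b, e + 1), s(b, e) and the entry at (b, e) are related by a local rule, that of RSK or that of
-- Burge, according to the ends at which b and e are added.  Both rules preserve interlacing and can
-- be inverted: the last three shapes determine the first one and the entry, and can be prescribed
-- freely up to interlacing.  As a label is not both a row and a column, all shapes and all entries
-- can be recovered from the s(m, m + 1), which are the diagonals of the reverse plane partition.
--
-- The local rules follow from the invariance of all path maxima under sorting two adjacent columns
-- of the grid.  A completely sorted grid displays its shape, and the two rules describe how a new
-- last or a new first column is sorted into it.

module Submission where

open import Defs
open import Data.Nat
open import Data.Nat.Properties
open import Data.Nat.ListAction using (sum)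
open import Data.Nat.ListAction.Properties using (sum-↭; sum-++)
open import Data.Nat.Tactic.RingSolver using (solve)
open import Data.Bool as Bool using (Bool; true; false; if_then_else_; _∧_; _∨_)
open import Data.Bool.ListAction using (any)
open import Data.Empty using (⊥; ⊥-elim)
open import Data.List using (List; []; _∷_; _∷ʳ_; _++_; map; length; reverse; upTo; applyUpTo; concatMap; foldr; filterᵇ; drop)
open import Data.List.Properties
  using (length-map; length-upTo; length-reverse; length-++; length-applyUpTo; map-∘; map-cong; map-++; foldr-++; ++-assoc;
         ++-identityʳ; applyUpTo-∷ʳ; unfold-reverse; reverse-++; reverse-involutive; ∷-injectiveˡ)
open import Data.List.Membership.Propositional using (_∈_; find; lose)
open import Data.List.Membership.Propositional.Properties
  using (∈-map⁺; ∈-map⁻; ∈-upTo⁺; ∈-applyUpTo⁺; ∈-applyUpTo⁻; ∈-∃++; ∈-++⁺ˡ; ∈-++⁺ʳ; ∈-concatMap⁺; ∈-concatMap⁻; ∈-filter⁺; ∈-filter⁻)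
open import Data.List.Relation.Unary.All as All using (All)
open import Data.List.Relation.Unary.AllPairs as AllPairs using ()
open import Data.List.Relation.Unary.Any as Any using (here; there)
open import Data.List.Relation.Unary.Linked as Linked using (Linked; [-])
open import Data.List.Relation.Unary.Unique.Propositional using (Unique)
import Data.List.Relation.Unary.Unique.Propositional.Properties as UniqueProps
open import Data.List.Relation.Binary.Permutation.Propositional using (_↭_; ↭-refl; ↭-sym; ↭-trans; ↭-reflexive; ↭⇒↭ₛ)
open import Data.List.Relation.Binary.Permutation.Propositional.Properties as Perm using (↭-reverse; ∷↭∷ʳ; ↭-length)
import Data.List.Relation.Binary.Permutation.Setoid.Properties as PermSetoid
open import Data.Maybe using (just; nothing)
open import Data.Product using (_×_; _,_; Σ; ∃; proj₁; proj₂)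
open import Data.Sum as Sum using (_⊎_; inj₁; inj₂)
open import Data.Unit using (⊤; tt)
open import Relation.Binary.Definitions using (tri<; tri≈; tri>)
open import Relation.Binary.PropositionalEquality
open import Relation.Nullary using (¬_; yes; no)
open import Relation.Nullary.Decidable using (T?)
open import Algebra.Properties.CommutativeSemigroup +-commutativeSemigroup using (interchange)

-- The diagonals of the image come from a different graph for each m. What ties them together is
-- that a label is always added at an end: the relative order of the rows 1, ..., b and of the
-- columns e, ..., n is the same in every AR_m(c) with b ≤ m < e, so all these graphs share one
-- family of shapes s(b, e). Path maxima are not handled on paths. An ℓ-tuple becomes a sequence of
-- height functions on the lattice points, with values at most ℓ. Crossing or overlapping paths then
-- need no untangling, and the height functions on both sides of two adjacent columns can be kept
-- fixed, which makes sorting these two columns a local question. Sorting is itself split into moves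
-- of an amount within a single row, and for each move it suffices to reroute one path. The carry in
-- the Burge rule is the reason for stating the rules as relations: forwards it is found from the
-- last part to the first, backwards from the first to the last, and one relation serves both
-- directions.

infix 5 _≤≡_ _≡≤_

_≤≡_ : ∀ {x y z : ℕ} → x ≤ y → y ≡ z → x ≤ z
h ≤≡ e = ≤-trans h (≤-reflexive e)

_≡≤_ : ∀ {x y z : ℕ} → x ≡ y → y ≤ z → x ≤ z
e ≡≤ h = ≤-trans (≤-reflexive e) h

-- The ring solver proves equations only. A linear inequality is reduced to one: `p ≤ q` collects
-- the known inequalities, and the solver checks that they add up to the goal.
by-≤ : ∀ {x y p q} → p ≤ q → x + q ≡ y + p → x ≤ y
by-≤ {x} {y} {p} {q} h e = +-cancelʳ-≤ q x y (e ≡≤ +-monoʳ-≤ y h)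

by-≡ : ∀ {x y p q} → p ≡ q → x + q ≡ y + p → x ≡ y
by-≡ {x} {y} {p} refl e = +-cancelʳ-≡ p x y e

true≢false : {A : Set} {b : Bool} → b ≡ true → b ≡ false → A
true≢false refl ()

-- Local rules of the growth diagrams

Seq : Set
Seq = ℕ → ℕ

infix 4 _≺_
record _≺_ (l m : Seq) : Set where
  constructor interlace
  field
    upper : ∀ i → l i ≤ m i
    lower : ∀ i → m (suc i) ≤ l i
open _≺_ public

≺-resp : ∀ {l l' m m'} → l ≗ l' → m ≗ m' → l ≺ m → l' ≺ m'
≺-resp p q (interlace u d) =
  interlace (λ i → subst₂ _≤_ (p i) (q i) (u i)) (λ i → subst₂ _≤_ (q (suc i)) (p i) (d i))

≺-zero : ∀ {l m} → (∀ i → l i ≡ 0) → (∀ i → m i ≡ 0) → l ≺ m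
≺-zero p q = interlace (λ i → p i ≡≤ z≤n)
                       (λ i → q (suc i) ≡≤ z≤n)

-- r is the shape of a rectangle, m and n are the shapes that remain without the last added row and
-- without the last added column, l remains without both, and x is the entry where these two meet.

data Rule : Set where
  rsk burge : Rule

record RSKRule (l m n : Seq) (x : ℕ) (r : Seq) : Set where
  constructor rskRule
  field
    first : r 0 ≡ x + (m 0 ⊔ n 0)
    later : ∀ i → r (suc i) + l i ≡ (m (suc i) ⊔ n (suc i)) + (m i ⊓ n i)

-- c i is what overflows from part i into part i ∸ 1; the entry x enters as the overflow of the
-- parts that vanish.
record BurgeRule (l m n : Seq) (x : ℕ) (r : Seq) : Set where
  field
    c      : Seq
    c0     : c 0 ≡ 0
    mass   : ∀ i → r i + l i + c i ≡ m i + n i + c (suc i)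
    cap    : ∀ i → r (suc i) ≤ l i
    tight  : ∀ i → c (suc i) ≡ 0 ⊎ r (suc i) ≡ l i
    N      : ℕ
    entry  : ∀ i → N ≤ i → c i ≡ x

Local : Rule → Seq → Seq → Seq → ℕ → Seq → Set
Local rsk   = RSKRule
Local burge = BurgeRule

Local-resp : ∀ k {l m n x r l' m' n' x' r'} → l ≗ l' → m ≗ m' → n ≗ n' → x ≡ x' → r ≗ r' →
  Local k l m n x r → Local k l' m' n' x' r'
Local-resp rsk pl pm pn refl pr (rskRule f g) = rskRule
  (trans (sym (pr 0)) (trans f (cong (_ +_) (cong₂ _⊔_ (pm 0) (pn 0)))))
  (λ i → trans (cong₂ _+_ (sym (pr (suc i))) (sym (pl i)))
    (trans (g i) (cong₂ _+_ (cong₂ _⊔_ (pm (suc i)) (pn (suc i))) (cong₂ _⊓_ (pm i) (pn i)))))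
Local-resp burge {r = r} {l'} {m'} {n'} pl pm pn refl pr R = record
  { c = c ; c0 = c0
  ; mass = λ i → trans (cong (_+ c i) (cong₂ _+_ (sym (pr i)) (sym (pl i))))
      (trans (mass i) (cong (_+ c (suc i)) (cong₂ _+_ (pm i) (pn i))))
  ; cap = λ i → subst₂ _≤_ (pr (suc i)) (pl i) (cap i)
  ; tight = λ i → subst₂ (λ y z → c (suc i) ≡ 0 ⊎ y ≡ z) (pr (suc i)) (pl i) (tight i)
  ; N = N ; entry = entry }
  where open BurgeRule R

-- The conditions say that `r` is the minimum of `b` and `r + c`, and `c` is the excess; so the sum
-- determines both. This is one step of the Burge rule read forwards.
complementary-≡ : ∀ {b r r' c c'} → r ≤ b → r' ≤ b → c ≡ 0 ⊎ r ≡ b → c' ≡ 0 ⊎ r' ≡ b →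
  r + c ≡ r' + c' → c ≡ c'
complementary-≡ h h' (inj₁ p) (inj₁ q) e = trans p (sym q)
complementary-≡ {r' = r'} {c' = c'} h h' (inj₁ refl) (inj₂ refl) e =
  sym (n≤0⇒n≡0 (+-cancelˡ-≤ r' c' 0 (subst₂ _≤_ e (sym (+-identityʳ r')) ((+-identityʳ _) ≡≤ h))))
complementary-≡ {r = r} {c = c} h h' (inj₂ refl) (inj₁ refl) e =
  n≤0⇒n≡0 (+-cancelˡ-≤ r c 0 (subst₂ _≤_ (sym e) (sym (+-identityʳ r)) ((+-identityʳ _) ≡≤ h')))
complementary-≡ {r = r} h h' (inj₂ refl) (inj₂ refl) e = +-cancelˡ-≡ r _ _ e

-- The dual for the inverse rule: `l` is the maximum of `b` and the integer `l - c`, and the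
-- equation says that this difference is the same on both sides.
complementary-≥-≡ : ∀ {b l l' c c'} → b ≤ l → b ≤ l' → c ≡ 0 ⊎ b ≡ l → c' ≡ 0 ⊎ b ≡ l' →
  l + c' ≡ l' + c → c ≡ c'
complementary-≥-≡ h h' (inj₁ p) (inj₁ q) e = trans p (sym q)
complementary-≥-≡ {l = l} {c' = c'} h h' (inj₁ refl) (inj₂ refl) e =
  sym (n≤0⇒n≡0 (+-cancelˡ-≤ l c' 0 (e ≡≤ +-monoˡ-≤ 0 h)))
complementary-≥-≡ {l' = l'} {c = c} h h' (inj₂ refl) (inj₁ refl) e =
  n≤0⇒n≡0 (+-cancelˡ-≤ l' c 0 (sym e ≡≤ +-monoˡ-≤ 0 h'))
complementary-≥-≡ {b} h h' (inj₂ refl) (inj₂ refl) e = sym (+-cancelˡ-≡ b _ _ e)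

private
  swap-mass : ∀ r l c m n d → r + l + c ≡ m + n + d → (r + c) + l ≡ m + n + d
  swap-mass r l c m n d e = by-≡ e (solve (r ∷ l ∷ c ∷ m ∷ n ∷ d ∷ []))

forward-unique : ∀ k {l m n x r l' m' n' x' r'} → Local k l m n x r → Local k l' m' n' x' r' →
  l ≗ l' → m ≗ m' → n ≗ n' → x ≡ x' → r ≗ r'
forward-unique rsk (rskRule f _) (rskRule f' _) pl pm pn refl zero =
  trans f (trans (cong (_ +_) (cong₂ _⊔_ (pm 0) (pn 0))) (sym f'))
forward-unique rsk {l} {r = r} {r' = r'} (rskRule _ g) (rskRule _ g') pl pm pn refl (suc i) =
  +-cancelʳ-≡ (l i) (r (suc i)) (r' (suc i)) (trans (g i)
    (trans (cong₂ _+_ (cong₂ _⊔_ (pm (suc i)) (pn (suc i))) (cong₂ _⊓_ (pm i) (pn i)))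
      (trans (sym (g' i)) (cong (r' (suc i) +_) (sym (pl i))))))
forward-unique burge {l} {m} {n} {x} {r} {l'} {m'} {n'} {.x} {r'} R R' pl pm pn refl = r≗r'
  where
  module R  = BurgeRule R
  module R' = BurgeRule R'
  mass' : ∀ i → r' i + l i + R'.c i ≡ m i + n i + R'.c (suc i)
  mass' i = trans (cong (λ z → r' i + z + R'.c i) (pl i))
    (trans (R'.mass i) (cong₂ (λ y z → y + z + R'.c (suc i)) (sym (pm i)) (sym (pn i))))
  rc : ∀ i → R.c (suc i) ≡ R'.c (suc i) → r i + R.c i ≡ r' i + R'.c i
  rc i e = +-cancelʳ-≡ (l i) _ _
    (trans (swap-mass (r i) (l i) (R.c i) (m i) (n i) _ (R.mass i))
      (trans (cong (m i + n i +_) e) (sym (swap-mass (r' i) (l i) (R'.c i) (m i) (n i) _ (mass' i)))))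
  -- Induction on the distance `d` to an index from which on both carries equal the entry: forwards,
  -- the carries are known at the far end and descend to index 0.
  c≡ : ∀ d i → R.N ⊔ R'.N ≤ i + d → R.c i ≡ R'.c i
  c≡ zero i h = trans (R.entry i (≤-trans (m≤m⊔n R.N R'.N) h'))
                      (sym (R'.entry i (≤-trans (m≤n⊔m R.N R'.N) h')))
    where h' = h ≤≡ +-identityʳ i
  c≡ (suc d) zero h = trans R.c0 (sym R'.c0)
  c≡ (suc d) (suc i) h =
    complementary-≡ (R.cap i) (R'.cap i ≤≡ sym (pl i)) (R.tight i)
      (Sum.map (λ z → z) (λ z → trans z (sym (pl i))) (R'.tight i))
      (rc (suc i) (c≡ d (suc (suc i)) (h ≤≡ +-suc (suc i) d)))
  all≡ : ∀ i → R.c i ≡ R'.c i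
  all≡ i = c≡ (R.N ⊔ R'.N) i (m≤n+m _ i)
  r≗r' : r ≗ r'
  r≗r' i = +-cancelʳ-≡ (R.c i) (r i) (r' i)
    (trans (rc i (all≡ (suc i))) (cong (r' i +_) (sym (all≡ i))))

inverse-unique : ∀ k {l m n x r l' m' n' x' r'} → Local k l m n x r → Local k l' m' n' x' r' →
  m ≗ m' → n ≗ n' → r ≗ r' → l ≗ l' × x ≡ x'
inverse-unique rsk {l} {m} {n} {x} {r} {l'} {m'} {n'} {x'} {r'} (rskRule f g) (rskRule f' g') pm pn pr =
  (λ i → +-cancelˡ-≡ (r (suc i)) _ _ (trans (g i)
    (trans (cong₂ _+_ (cong₂ _⊔_ (pm (suc i)) (pn (suc i))) (cong₂ _⊓_ (pm i) (pn i)))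
      (trans (sym (g' i)) (cong (_+ l' i) (sym (pr (suc i))))))))
  , +-cancelʳ-≡ (m 0 ⊔ n 0) x x' (trans (sym f) (trans (pr 0) (trans f'
      (cong (x' +_) (cong₂ _⊔_ (sym (pm 0)) (sym (pn 0)))))))
inverse-unique burge {l} {m} {n} {x} {r} {l'} {m'} {n'} {x'} {r'} R R' pm pn pr =
  l≗l' , trans (sym (R.entry _ (m≤m⊔n R.N R'.N))) (trans (c≡ (R.N ⊔ R'.N)) (R'.entry _ (m≤n⊔m R.N R'.N)))
  where
  module R  = BurgeRule R
  module R' = BurgeRule R'
  mass' : ∀ i → r i + l' i + R'.c i ≡ m i + n i + R'.c (suc i)
  mass' i = trans (cong (λ z → z + l' i + R'.c i) (pr i))
    (trans (R'.mass i) (cong₂ (λ y z → y + z + R'.c (suc i)) (sym (pm i)) (sym (pn i))))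
  cross : ∀ i → R.c i ≡ R'.c i → l i + R'.c (suc i) ≡ l' i + R.c (suc i)
  cross i e = lem (r i) (l i) (l' i) (R.c i) (R'.c i) (m i) (n i) _ _ (R.mass i) (mass' i) e
    where
    lem : ∀ r l l' c c' m n d d' → r + l + c ≡ m + n + d → r + l' + c' ≡ m + n + d' → c ≡ c' → l + d' ≡ l' + d
    lem r l l' c .c m n d d' p q refl = by-≡ (cong₂ _+_ p (sym q)) (solve (r ∷ l ∷ l' ∷ c ∷ m ∷ n ∷ d ∷ d' ∷ []))
  -- Backwards the carries start from `c 0 ≡ 0` and ascend; the entry is what is still carried at
  -- large indices.
  c≡ : ∀ i → R.c i ≡ R'.c i
  c≡ zero = trans R.c0 (sym R'.c0)
  c≡ (suc i) = complementary-≥-≡ (R.cap i) (pr (suc i) ≡≤ R'.cap i) (R.tight i)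
    (Sum.map (λ z → z) (λ z → trans (pr (suc i)) z) (R'.tight i)) (cross i (c≡ i))
  l≗l' : l ≗ l'
  l≗l' i = +-cancelʳ-≡ (R'.c (suc i)) _ _ (trans (cross i (c≡ i)) (cong (l' i +_) (c≡ (suc i))))

Local-swap : ∀ k {l m n x r} → Local k l m n x r → Local k l n m x r
Local-swap rsk {l} {m} {n} {x} {r} (rskRule f g) = rskRule
  (trans f (cong (x +_) (⊔-comm (m 0) (n 0))))
  (λ i → trans (g i) (cong₂ _+_ (⊔-comm (m (suc i)) (n (suc i))) (⊓-comm (m i) (n i))))
Local-swap burge {l} {m} {n} R = record
  { c = c ; c0 = c0 ; mass = λ i → trans (mass i) (cong (_+ c (suc i)) (+-comm (m i) (n i)))
  ; cap = cap ; tight = tight ; N = N ; entry = entry }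
  where open BurgeRule R

private
  add-≤ : ∀ r l m n → r + l ≡ m + n → l ≤ n → m ≤ r
  add-≤ r l m n e h = by-≤ (+-mono-≤ h (≤-reflexive (sym e))) (solve (r ∷ l ∷ m ∷ n ∷ []))
  add-≤-carry : ∀ r l m n d → r + l + 0 ≡ m + n + d → l ≤ n → m ≤ r
  add-≤-carry r l m n d e h = ≤-trans (m≤m+n m d)
    (by-≤ {m + d} {r} (+-mono-≤ h (≤-reflexive (sym e))) (solve (r ∷ l ∷ m ∷ n ∷ d ∷ [])))

Local-≺ : ∀ k {l m n x r} → Local k l m n x r → l ≺ m → l ≺ n → m ≺ r
Local-≺ rsk {l} {m} {n} {x} {r} (rskRule f g) (interlace u d) (interlace u' d') = interlace up down
  where
  up : ∀ i → m i ≤ r i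
  up zero = ≤-trans (m≤m⊔n (m 0) (n 0)) (m≤n+m _ x) ≤≡ sym f
  up (suc i) = ≤-trans (m≤m⊔n (m (suc i)) (n (suc i)))
    (add-≤ (r (suc i)) (l i) _ (m i ⊓ n i) (g i) (⊓-glb (u i) (u' i)))
  down : ∀ i → r (suc i) ≤ m i
  down i = ≤-trans (add-≤ (m i ⊓ n i) (m (suc i) ⊔ n (suc i)) (r (suc i)) (l i)
      (trans (+-comm (m i ⊓ n i) _) (sym (g i))) (⊔-lub (d i) (d' i)))
    (m⊓n≤m (m i) (n i))
Local-≺ burge {l} {m} {n} {x} {r} R (interlace u d) (interlace u' d') = interlace up (λ i → ≤-trans (cap i) (u i))
  where
  open BurgeRule R
  carry-free : ∀ i → c i ≡ 0 → m i ≤ r i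
  carry-free i e = add-≤-carry (r i) (l i) (m i) (n i) (c (suc i))
    (subst (λ z → r i + l i + z ≡ m i + n i + c (suc i)) e (mass i)) (u' i)
  up : ∀ i → m i ≤ r i
  up zero = carry-free 0 c0
  up (suc i) with tight i
  ... | inj₁ e = carry-free (suc i) e
  ... | inj₂ e = d i ≤≡ sym e

-- A label outside B or E contributes a row or column of zeros. Together with `forward-unique` this
-- shows that such a label merely copies shapes.
Local-zero : ∀ k {l m} → l ≺ m → Local k l m l 0 m
Local-zero rsk {l} {m} (interlace u d) = rskRule (sym (m≥n⇒m⊔n≡m (u 0)))
  (λ i → cong₂ _+_ (sym (m≥n⇒m⊔n≡m (u (suc i)))) (sym (m≥n⇒m⊓n≡n (u i))))
Local-zero burge (interlace u d) = record
  { c = λ _ → 0 ; c0 = refl ; mass = λ _ → refl ; cap = d ; tight = λ _ → inj₁ refl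
  ; N = 0 ; entry = λ _ _ → refl }

-- The inverse rules; N bounds the number of parts of r.

-- The first component is the least `l` that satisfies the cap `r (suc i) ≤ l` and leaves no
-- negative carry. Being least, it attains one of the two bounds, which is the field `tight`.
burgeState : (m n r : Seq) → ℕ → ℕ → ℕ × ℕ
burgeState m n r c i = l , (r i + c + l) ∸ (m i + n i)
  where l = r (suc i) ⊔ ((m i + n i) ∸ (r i + c))

burgeCarry : (m n r : Seq) → Seq
burgeCarry m n r zero = 0
burgeCarry m n r (suc i) = proj₂ (burgeState m n r (burgeCarry m n r i) i)

invShape : Rule → (m n r : Seq) → Seq
invShape rsk m n r i = ((m (suc i) ⊔ n (suc i)) + (m i ⊓ n i)) ∸ r (suc i)
invShape burge m n r i = proj₁ (burgeState m n r (burgeCarry m n r i) i)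

-- From index `N` on all parts vanish and the Burge carry is constant, so its value there is the
-- entry.
invEntry : Rule → ℕ → (m n r : Seq) → ℕ
invEntry rsk N m n r = r 0 ∸ (m 0 ⊔ n 0)
invEntry burge N m n r = burgeCarry m n r N

module _ {m n r : Seq} (mr : m ≺ r) (nr : n ≺ r) (N : ℕ) (vanish : ∀ i → N ≤ i → r i ≡ 0) where
  private
    max≤r : ∀ i → m i ⊔ n i ≤ r i
    max≤r i = ⊔-lub (upper mr i) (upper nr i)
    r≤min : ∀ i → r (suc i) ≤ m i ⊓ n i
    r≤min i = ⊓-glb (lower mr i) (lower nr i)

    c = burgeCarry m n r

    between : ∀ a b r → r ≤ b → a ≤ r → ∀ {z} → z ≡ (a + b) ∸ r → a ≤ z × z ≤ b
    between a b r h k refl =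
      sym (m+n∸n≡m a r) ≡≤ ∸-monoˡ-≤ r (+-monoʳ-≤ a h) ,
      ∸-monoˡ-≤ r (+-monoˡ-≤ b k) ≤≡ m+n∸m≡n r b

    burge-min : ∀ a b r c → a ≤ r → (a + b) ∸ (r + c) ≤ b
    burge-min a b r c h = ∸-monoʳ-≤ (a + b) (≤-trans h (m≤m+n r c)) ≤≡ m+n∸m≡n a b

    burge-tight : ∀ k r l → r ≤ k → l ≤ r → l + (k ∸ r) ∸ k ≡ 0
    burge-tight k r l h h' = m≤n⇒m∸n≡0 (+-monoˡ-≤ (k ∸ r) h' ≤≡ m+[n∸m]≡n h)

  inverse-≺ : ∀ k → invShape k m n r ≺ m × invShape k m n r ≺ n
  inverse-≺ rsk =
    interlace (λ i → ≤-trans (proj₂ (b i)) (m⊓n≤m (m i) (n i)))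
              (λ i → ≤-trans (m≤m⊔n (m (suc i)) (n (suc i))) (proj₁ (b i))) ,
    interlace (λ i → ≤-trans (proj₂ (b i)) (m⊓n≤n (m i) (n i)))
              (λ i → ≤-trans (m≤n⊔m (m (suc i)) (n (suc i))) (proj₁ (b i)))
    where
    b : ∀ i → (m (suc i) ⊔ n (suc i)) ≤ invShape rsk m n r i × invShape rsk m n r i ≤ (m i ⊓ n i)
    b i = between (m (suc i) ⊔ n (suc i)) (m i ⊓ n i) (r (suc i)) (r≤min i) (max≤r (suc i)) refl
  inverse-≺ burge =
    interlace (λ i → ⊔-lub (lower mr i) ((cong (_∸ (r i + c i)) (+-comm (m i) (n i)))
                                           ≡≤ burge-min (n i) (m i) (r i) (c i) (upper nr i)))
              (λ i → ≤-trans (upper mr (suc i)) (m≤m⊔n (r (suc i)) _)) ,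
    interlace (λ i → ⊔-lub (lower nr i) (burge-min (m i) (n i) (r i) (c i) (upper mr i)))
              (λ i → ≤-trans (upper nr (suc i)) (m≤m⊔n (r (suc i)) _))

  inverse-Local : ∀ k → Local k (invShape k m n r) m n (invEntry k N m n r) r
  inverse-Local rsk = rskRule (sym (m∸n+n≡m (max≤r 0)))
    (λ i → m+[n∸m]≡n (≤-trans (r≤min i) (m≤n+m _ (m (suc i) ⊔ n (suc i)))))
  inverse-Local burge = record
    { c = c ; c0 = refl ; mass = mass ; cap = λ i → m≤m⊔n (r (suc i)) _
    ; tight = tight ; N = N ; entry = entry }
    where
    l = invShape burge m n r
    mass : ∀ i → r i + l i + c i ≡ m i + n i + c (suc i)
    mass i = trans (lem (r i) (l i) (c i)) (sym (m+[n∸m]≡n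
      (≤-trans (m≤n+m∸n (m i + n i) (r i + c i)) (+-monoʳ-≤ (r i + c i) (m≤n⊔m (r (suc i)) _)))))
      where
      lem : ∀ r l c → r + l + c ≡ r + c + l
      lem r l c = solve (r ∷ l ∷ c ∷ [])
    tight : ∀ i → c (suc i) ≡ 0 ⊎ r (suc i) ≡ l i
    tight i with ≤-total ((m i + n i) ∸ (r i + c i)) (r (suc i))
    ... | inj₁ h = inj₂ (sym (m≥n⇒m⊔n≡m h))
    ... | inj₂ h with ≤-total (r i + c i) (m i + n i)
    ...   | inj₁ h' = inj₁ (trans (cong (λ z → r i + c i + z ∸ (m i + n i)) (m≤n⇒m⊔n≡n h))
                        (burge-tight (m i + n i) (r i + c i) _ h' ≤-refl))
    ...   | inj₂ h' = inj₂ (trans (n≤0⇒n≡0 (h ≤≡ m≤n⇒m∸n≡0 h'))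
                        (sym (trans (m≤n⇒m⊔n≡n h) (m≤n⇒m∸n≡0 h'))))
    step : ∀ i → N ≤ i → c (suc i) ≡ c i
    step i h = trans (cong₂ _∸_ (cong₂ _+_ (cong (_+ c i) (vanish i h)) l≡0) m+n≡0) (+-identityʳ (c i))
      where
      m+n≡0 : m i + n i ≡ 0
      m+n≡0 = cong₂ _+_ (n≤0⇒n≡0 (upper mr i ≤≡ vanish i h))
                        (n≤0⇒n≡0 (upper nr i ≤≡ vanish i h))
      l≡0 : l i ≡ 0
      l≡0 = cong₂ _⊔_ (vanish (suc i) (m≤n⇒m≤1+n h)) (trans (cong (_∸ (r i + c i)) m+n≡0) (0∸n≡0 (r i + c i)))
    entry : ∀ i → N ≤ i → c i ≡ c N
    entry i h = subst (λ z → c z ≡ c N) (m+[n∸m]≡n h) (go (i ∸ N))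
      where
      go : ∀ d → c (N + d) ≡ c N
      go zero = cong c (+-identityʳ N)
      go (suc d) = trans (cong c (+-suc N d)) (trans (step (N + d) (m≤m+n N d)) (go d))

≺-zero-below : ∀ {l m i} → l ≺ m → m i ≡ 0 → l i ≡ 0
≺-zero-below {i = i} h e = n≤0⇒n≡0 (upper h i ≤≡ e)

≺-zero-above : ∀ {l m i} → l ≺ m → l i ≡ 0 → m (suc i) ≡ 0
≺-zero-above {i = i} h e = n≤0⇒n≡0 (lower h i ≤≡ e)

≺-left-refl : ∀ {l m} → l ≺ m → l ≺ l
≺-left-refl h = interlace (λ _ → ≤-refl) (λ i → ≤-trans (upper h (suc i)) (lower h i))

-- Growth diagrams on the staircase b < e: s b e stands for the shape of the entries in the rows
-- 1, …, b and the columns e, …, n.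

module Growth (rule : ℕ → ℕ → Rule) (n : ℕ) (B? E? : ℕ → Bool) (cB cE : ℕ → ℕ)
  (stepB : ∀ b → cB (suc b) ≡ (if B? (suc b) then suc (cB b) else cB b))
  (stepE : ∀ e → cE (suc e) ≡ (if E? (suc e) then suc (cE (suc (suc e))) else cE (suc (suc e))))
  where

  record Supported (F : ℕ → ℕ → ℕ) : Set where
    field
      row-zero : ∀ b e → b < e → B? b ≡ false → F b e ≡ 0
      col-zero : ∀ b e → b < e → E? e ≡ false → F b e ≡ 0

  record IsGrowth (F : ℕ → ℕ → ℕ) (s : ℕ → ℕ → Seq) : Set where
    field
      top   : ∀ e i → s 0 e i ≡ 0
      right : ∀ b i → s b (suc n) i ≡ 0
      local : ∀ b e → suc b < e → e ≤ n →
              Local (rule (suc b) e) (s b (suc e)) (s b e) (s (suc b) (suc e)) (F (suc b) e) (s (suc b) e)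

  module _ {F s} (gr : IsGrowth F s) where
    open IsGrowth gr

    -- Each box transfers the interlacing from its two sides at the corner l to its two sides at the
    -- corner r, so both directions are proved together. In `vertical′` the number `d` counts the
    -- columns e, ..., n, along which the induction runs backwards.
    horizontal : ∀ b e → b < e → e ≤ n → s b (suc e) ≺ s b e
    vertical′ : ∀ d b e → e + d ≡ suc n → suc b < e → s b e ≺ s (suc b) e
    horizontal zero e lt le = ≺-zero (top _) (top _)
    horizontal (suc b) e lt le = Local-≺ (rule (suc b) e) (Local-swap (rule (suc b) e) (local b e lt le))
      (vertical′ (n ∸ e) b (suc e) (cong suc (m+[n∸m]≡n le)) (m<n⇒m<1+n lt))
      (horizontal b e (<-trans (n<1+n b) lt) le)
    vertical′ zero b e eq lt rewrite trans (sym (+-identityʳ e)) eq = ≺-zero (right b) (right (suc b))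
    vertical′ (suc d) b e eq lt = Local-≺ (rule (suc b) e) (local b e lt le)
      (horizontal b e (<-trans (n<1+n b) lt) le)
      (vertical′ d b (suc e) (trans (sym (+-suc e d)) eq) (m<n⇒m<1+n lt))
      where le = m≤m+n e d ≤≡ suc-injective (trans (sym (+-suc e d)) eq)

    vertical : ∀ b e → suc b < e → e ≤ suc n → s b e ≺ s (suc b) e
    vertical b e lt le = vertical′ (suc n ∸ e) b e (m+[n∸m]≡n le) lt

    module _ (sup : Supported F) where
      open Supported sup

      private
        row-copy′ : ∀ d b e → e + d ≡ suc n → B? (suc b) ≡ false → suc b < e → s (suc b) e ≗ s b e
        row-copy′ zero b e eq nb lt i rewrite trans (sym (+-identityʳ e)) eq = trans (right (suc b) i) (sym (right b i))
        row-copy′ (suc d) b e eq nb lt = forward-unique (rule (suc b) e) (local b e lt le)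
          (Local-zero (rule (suc b) e) (horizontal b e (<-trans (n<1+n b) lt) le))
          (λ _ → refl) (λ _ → refl)
          (row-copy′ d b (suc e) (trans (sym (+-suc e d)) eq) nb (m<n⇒m<1+n lt))
          (row-zero (suc b) e lt nb)
          where le = m≤m+n e d ≤≡ suc-injective (trans (sym (+-suc e d)) eq)

      row-copy : ∀ b e → B? (suc b) ≡ false → suc b < e → e ≤ suc n → s (suc b) e ≗ s b e
      row-copy b e nb lt le = row-copy′ (suc n ∸ e) b e (m+[n∸m]≡n le) nb lt

      col-copy : ∀ b e → E? e ≡ false → b < e → e ≤ n → s b e ≗ s b (suc e)
      col-copy zero e ne lt le i = trans (top e i) (sym (top (suc e) i))
      col-copy (suc b) e ne lt le = forward-unique (rule (suc b) e)
        (Local-swap (rule (suc b) e) (local b e lt le))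
        (Local-zero (rule (suc b) e) (vertical b (suc e) (m<n⇒m<1+n lt) (s≤s le)))
        (λ _ → refl) (λ _ → refl) (col-copy b e ne (<-trans (n<1+n b) lt) le) (col-zero (suc b) e lt ne)

      -- Interlacing allows a row in B to create at most one new part, and any other row is a copy.
      vanishB : ∀ b e i → b < e → e ≤ suc n → cB b ≤ i → s b e i ≡ 0
      vanishB zero e i lt le h = top e i
      vanishB (suc b) e i lt le h with B? (suc b) in eq | stepB b
      vanishB (suc b) e (suc i) lt le h | true | st = ≺-zero-above (vertical b e lt le)
        (vanishB b e i (<-trans (n<1+n b) lt) le (s≤s⁻¹ (sym st ≡≤ h)))
      vanishB (suc b) e zero lt le h | true | st with ≤-trans (≤-reflexive (sym st)) h
      ... | ()
      vanishB (suc b) e i lt le h | false | st = trans (row-copy b e eq lt le i)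
        (vanishB b e i (<-trans (n<1+n b) lt) le (sym st ≡≤ h))

      private
        vanishE′ : ∀ d b e i → e + d ≡ suc n → b < e → cE e ≤ i → s b e i ≡ 0
        vanishE′ zero b e i eq lt h rewrite trans (sym (+-identityʳ e)) eq = right b i
        vanishE′ (suc d) b (suc e) i eq lt h with E? (suc e) in q | stepE e
        vanishE′ (suc d) b (suc e) (suc i) eq lt h | true | st = ≺-zero-above
          (horizontal b (suc e) lt (m≤m+n (suc e) d ≤≡ suc-injective (trans (sym (+-suc (suc e) d)) eq)))
          (vanishE′ d b (suc (suc e)) i (trans (sym (+-suc (suc e) d)) eq) (m<n⇒m<1+n lt)
            (s≤s⁻¹ (sym st ≡≤ h)))
        vanishE′ (suc d) b (suc e) zero eq lt h | true | st with ≤-trans (≤-reflexive (sym st)) h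
        ... | ()
        vanishE′ (suc d) b (suc e) i eq lt h | false | st = trans (col-copy b (suc e) q lt
            (m≤m+n (suc e) d ≤≡ suc-injective (trans (sym (+-suc (suc e) d)) eq)) i)
          (vanishE′ d b (suc (suc e)) i (trans (sym (+-suc (suc e) d)) eq) (m<n⇒m<1+n lt)
            (sym st ≡≤ h))

      vanishE : ∀ b e i → b < e → e ≤ suc n → cE e ≤ i → s b e i ≡ 0
      vanishE b e i lt le h = vanishE′ (suc n ∸ e) b e i (m+[n∸m]≡n le) lt h

      adjacent-B : ∀ m → m < n → E? (suc m) ≡ false → s m (suc m) ≺ s (suc m) (suc (suc m))
      adjacent-B m lt ne = ≺-resp (λ i → sym (col-copy m (suc m) ne (n<1+n m) lt i)) (λ _ → refl)
        (vertical m (suc (suc m)) ≤-refl (s≤s lt))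

      adjacent-E : ∀ m → m < n → B? (suc m) ≡ false → s (suc m) (suc (suc m)) ≺ s m (suc m)
      adjacent-E m lt nb = ≺-resp (λ i → sym (row-copy m (suc (suc m)) nb ≤-refl (s≤s lt) i)) (λ _ → refl)
        (horizontal m (suc m) (n<1+n m) lt)

  growth-determined : ∀ {F s F' s'} → (∀ b e → b < e → e ≤ n → F b e ≡ F' b e) →
    IsGrowth F s → IsGrowth F' s' → ∀ b e → b < e → e ≤ suc n → s b e ≗ s' b e
  growth-determined {F} {s} {F'} {s'} eq gr gr' b e lt le = go (suc n ∸ e) b e (m+[n∸m]≡n le) lt
    where
    module g  = IsGrowth gr
    module g' = IsGrowth gr'
    go : ∀ d b e → e + d ≡ suc n → b < e → s b e ≗ s' b e
    go zero b e q lt i rewrite trans (sym (+-identityʳ e)) q = trans (g.right b i) (sym (g'.right b i))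
    go (suc d) zero e q lt i = trans (g.top e i) (sym (g'.top e i))
    go (suc d) (suc b) e q lt = forward-unique (rule (suc b) e) (g.local b e lt le') (g'.local b e lt le')
      (go d b (suc e) q' (m<n⇒m<1+n (<-trans (n<1+n b) lt)))
      (go (suc d) b e q (<-trans (n<1+n b) lt))
      (go d (suc b) (suc e) q' (m<n⇒m<1+n lt)) (eq (suc b) e lt le')
      where
      q' = trans (sym (+-suc e d)) q
      le' = m≤m+n e d ≤≡ suc-injective q'

  -- A box (m , m) lies outside the staircase, but m is not both in B and in E, so one of its
  -- sides is a copy of the other.
  module _ (disjoint : ∀ m → B? m ≡ true → E? m ≡ true → ⊥) {F s F' s'}
    (gr : IsGrowth F s) (gr' : IsGrowth F' s') (sup : Supported F) (sup' : Supported F')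
    (eq : ∀ m → m ≤ n → s m (suc m) ≗ s' m (suc m)) where
    private
      module g  = IsGrowth gr
      module g' = IsGrowth gr'

      Same : ℕ → Set
      Same d = ∀ b → b + d ≤ n → s b (suc (b + d)) ≗ s' b (suc (b + d))

      -- The corner r of this box lies on the diagonal d, the corners m and n on d + 1, and l on d +
      -- 2. The inverse rule therefore carries agreement outwards, away from the border of the
      -- staircase.
      cell : ∀ d → Same d → Same (suc d) → ∀ b → suc (suc (b + d)) ≤ n →
        s b (suc (suc (suc (b + d)))) ≗ s' b (suc (suc (suc (b + d)))) ×
        F (suc b) (suc (suc (b + d))) ≡ F' (suc b) (suc (suc (b + d)))
      cell d h h' b le = inverse-unique (rule (suc b) (suc (suc (b + d))))
        (g.local b _ (s≤s (s≤s (m≤m+n b d))) le) (g'.local b _ (s≤s (s≤s (m≤m+n b d))) le)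
        (λ i → subst (λ z → s b (suc z) i ≡ s' b (suc z) i) (+-suc b d)
                 (h' b (+-suc b d ≡≤ <⇒≤ le) i))
        (λ i → subst (λ z → s (suc b) (suc (suc z)) i ≡ s' (suc b) (suc (suc z)) i) (+-suc b d)
                 (h' (suc b) (cong suc (+-suc b d) ≡≤ le) i))
        (h (suc b) (<⇒≤ le))

      same : ∀ d → Same d
      same zero b le rewrite +-identityʳ b = eq b le
      same (suc zero) b le rewrite +-comm b 1 with B? (suc b) in q
      ... | false = λ i → trans (sym (row-copy gr sup b _ q ≤-refl (s≤s le) i))
                     (trans (eq (suc b) le i) (row-copy gr' sup' b _ q ≤-refl (s≤s le) i))
      ... | true with E? (suc b) in q'
      ...   | true = ⊥-elim (disjoint _ q q')
      ...   | false = λ i → trans (sym (col-copy gr sup b _ q' ≤-refl le i))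
                     (trans (eq b (<⇒≤ le) i) (col-copy gr' sup' b _ q' ≤-refl le i))
      same (suc (suc d)) b le i = subst (λ z → s b (suc z) i ≡ s' b (suc z) i) (sym b+2)
        (proj₁ (cell d (same d) (same (suc d)) b (sym b+2 ≡≤ le)) i)
        where
        b+2 : b + suc (suc d) ≡ suc (suc (b + d))
        b+2 = trans (+-suc b (suc d)) (cong suc (+-suc b d))

    growth-injective : ∀ b e → suc b < e → e ≤ n → F (suc b) e ≡ F' (suc b) e
    growth-injective b e lt le = subst (λ z → F (suc b) z ≡ F' (suc b) z) e≡
      (proj₂ (cell _ (same _) (same _) b (e≡ ≡≤ le)))
      where e≡ = m+[n∸m]≡n lt

  module _ (cB0 : cB 0 ≡ 0) (cEn : cE (suc n) ≡ 0) (G : ℕ → Seq)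
    (G-B : ∀ m → B? (suc m) ≡ true → G m ≺ G (suc m))
    (G-E : ∀ m → E? (suc m) ≡ true → G (suc m) ≺ G m)
    (G-none : ∀ m → B? (suc m) ≡ false → E? (suc m) ≡ false → G m ≗ G (suc m))
    (G-dec : ∀ m → G m ≺ G m)
    (G-vanishB : ∀ m i → cB m ≤ i → G m i ≡ 0)
    (G-vanishE : ∀ m i → cE (suc m) ≤ i → G m i ≡ 0) where

    -- σ d b is the shape at (b , b + 1 + d), rebuilt from the diagonal d = 0.
    σ : ℕ → ℕ → Seq
    σ zero b = G b
    σ (suc zero) b = if B? (suc b) then G b else G (suc b)
    σ (suc (suc d)) b =
      if B? (suc b)
      then (if E? (suc (suc (b + d)))
            then invShape (rule (suc b) (suc (suc (b + d)))) (σ (suc d) b) (σ (suc d) (suc b)) (σ d (suc b))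
            else σ (suc d) b)
      else σ (suc d) (suc b)

    -- The value at the box (b + 1, b + 2 + d). The bound `cB (suc b)` on the number of parts of its
    -- corner r tells the inverse Burge rule where the carry has become constant.
    entry : ℕ → ℕ → ℕ
    entry d b =
      if B? (suc b)
      then (if E? (suc (suc (b + d)))
            then invEntry (rule (suc b) (suc (suc (b + d)))) (cB (suc b)) (σ (suc d) b) (σ (suc d) (suc b)) (σ d (suc b))
            else 0)
      else 0

    rebuilt : ℕ → ℕ → ℕ
    rebuilt zero e = 0
    rebuilt (suc b) e = entry (e ∸ suc (suc b)) b

    private
      copyB : ∀ d b → B? (suc b) ≡ false → σ (suc d) b ≗ σ d (suc b)
      copyB zero b q rewrite q = λ _ → refl
      copyB (suc d) b q rewrite q = λ _ → refl

      copyE : ∀ d b → E? (suc (b + d)) ≡ false → σ (suc d) b ≗ σ d b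
      copyE zero b q with B? (suc b) in q'
      ... | true = λ _ → refl
      ... | false = λ i → sym (G-none b q' (subst (λ z → E? (suc z) ≡ false) (+-identityʳ b) q) i)
      copyE (suc d) b q with B? (suc b) in q' | E? (suc (suc (b + d))) in q''
      ... | true  | true  = true≢false q'' (subst (λ z → E? (suc z) ≡ false) (+-suc b d) q)
      ... | true  | false = λ _ → refl
      ... | false | _ = λ i → trans (copyE d (suc b) (subst (λ z → E? (suc z) ≡ false) (+-suc b d) q) i)
                                    (sym (copyB d b q' i))

      Inv : ℕ → Set
      Inv d = ∀ b → σ (suc d) b ≺ σ d b × σ (suc d) b ≺ σ d (suc b)

      -- Proved together with `vanB`: an inverse rule needs a bound on the parts of its corner r,
      -- and that bound spreads outwards by interlacing.
      inv  : ∀ d → Inv d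
      vanB : ∀ d b i → cB b ≤ i → σ d b i ≡ 0
      vanB zero b i h = G-vanishB b i h
      vanB (suc d) b i h = ≺-zero-below (proj₁ (inv d b)) (vanB d b i h)
      inv zero b with B? (suc b) in q | E? (suc b) in q'
      ... | true | _ = G-dec b , G-B b q
      ... | false | true = G-E b q' , G-dec (suc b)
      ... | false | false = ≺-resp (λ _ → refl) (λ i → sym (G-none b q q' i)) (G-dec (suc b)) , G-dec (suc b)
      inv (suc d) b with B? (suc b) in q | E? (suc (suc (b + d))) in q'
      ... | true | true = inverse-≺ (proj₂ (inv d b)) (proj₁ (inv d (suc b))) (cB (suc b))
                            (vanB d (suc b)) (rule (suc b) (suc (suc (b + d))))
      ... | true | false = ≺-left-refl (proj₂ (inv d b)) ,
                           ≺-resp (λ _ → refl) (λ i → sym (copyE d (suc b) q' i)) (proj₂ (inv d b))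
      ... | false | _ = ≺-resp (λ _ → refl) (λ i → sym (copyB d b q i)) (proj₁ (inv d (suc b))) ,
                        ≺-left-refl (proj₁ (inv d (suc b)))

      vanE : ∀ d b i → cE (suc (b + d)) ≤ i → σ d b i ≡ 0
      vanE zero b i h = G-vanishE b i (subst (λ z → cE (suc z) ≤ i) (+-identityʳ b) h)
      vanE (suc d) b i h = ≺-zero-below (proj₂ (inv d b)) (vanE d (suc b) i (subst (λ z → cE (suc z) ≤ i) (+-suc b d) h))

      -- In the copied cases the rule holds literally for the shape of which `σ d (suc b)` is a
      -- copy, hence the auxiliary `r`.
      loc : ∀ d b → Σ Seq λ r → r ≗ σ d (suc b) ×
        Local (rule (suc b) (suc (suc (b + d)))) (σ (suc (suc d)) b) (σ (suc d) b) (σ (suc d) (suc b)) (entry d b) r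
      loc d b with B? (suc b) in q | E? (suc (suc (b + d))) in q'
      ... | true | true = _ , (λ _ → refl) , inverse-Local (proj₂ (inv d b)) (proj₁ (inv d (suc b))) (cB (suc b))
                            (vanB d (suc b)) (rule (suc b) (suc (suc (b + d))))
      ... | true | false = σ (suc d) (suc b) , copyE d (suc b) q' ,
        Local-swap (rule (suc b) _) (Local-zero (rule (suc b) _)
          (≺-resp (λ _ → refl) (λ i → sym (copyE d (suc b) q' i)) (proj₂ (inv d b))))
      ... | false | _ = σ (suc d) b , copyB d b q ,
        Local-zero (rule (suc b) _) (≺-resp (λ _ → refl) (λ i → sym (copyB d b q i)) (proj₁ (inv d (suc b))))

    rebuilt-supported : Supported rebuilt
    rebuilt-supported = record { row-zero = rz ; col-zero = cz }
      where
      rz : ∀ b e → b < e → B? b ≡ false → rebuilt b e ≡ 0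
      rz zero e lt q = refl
      rz (suc b) e lt q rewrite q = refl
      cz : ∀ b e → b < e → E? e ≡ false → rebuilt b e ≡ 0
      cz zero e lt q = refl
      cz (suc b) e lt q with B? (suc b)
      ... | false = refl
      ... | true rewrite m+[n∸m]≡n lt | q = refl

    rebuilt-growth : ∀ {s} → IsGrowth rebuilt s → ∀ m → m ≤ n → s m (suc m) ≗ G m
    rebuilt-growth {s} gr m le i = subst (λ z → s m (suc z) i ≡ G m i) (+-identityʳ m)
      (agree m 0 (n ∸ m) (trans (cong (_+ (n ∸ m)) (+-identityʳ m)) (m+[n∸m]≡n le)) i)
      where
      open IsGrowth gr
      -- `σ` was built from the diagonal outwards, whereas `s` is determined from the outer border
      -- inwards. The recursion goes from the corner r to the other three corners; `k` is the number
      -- of columns of the rectangle, and the border is reached when `b` or `k` is 0.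
      agree : ∀ b d k → b + d + k ≡ n → s b (suc (b + d)) ≗ σ d b
      agree zero d k q i = trans (top _ i) (sym (vanB d 0 i (cB0 ≡≤ z≤n)))
      agree (suc b) d zero q i = trans (subst (λ z → s (suc b) (suc z) i ≡ 0) (sym q') (right (suc b) i))
        (sym (vanE d (suc b) i (trans (cong (λ z → cE (suc z)) q') cEn ≡≤ z≤n)))
        where q' = trans (sym (+-identityʳ _)) q
      agree (suc b) d (suc k) q i with loc d b
      ... | r , r≗ , L = trans (forward-unique (rule (suc b) _) (local b _ (s≤s (s≤s (m≤m+n b d))) le') L
          (λ i → subst (λ z → s b (suc z) i ≡ σ (suc (suc d)) b i) (trans (+-suc b (suc d)) (cong suc (+-suc b d)))
            (agree b (suc (suc d)) k q₂ i))
          (λ i → subst (λ z → s b (suc z) i ≡ σ (suc d) b i) (+-suc b d) (agree b (suc d) (suc k) q₁ i))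
          (λ i → subst (λ z → s (suc b) (suc z) i ≡ σ (suc d) (suc b) i) (+-suc (suc b) d)
            (agree (suc b) (suc d) k q₃ i))
          (cong (λ z → entry z b) (m+n∸m≡n b d)) i) (r≗ i)
        where
        q₁ : b + suc d + suc k ≡ n
        q₁ = trans (cong (_+ suc k) (+-suc b d)) q
        q₃ : suc b + suc d + k ≡ n
        q₃ = trans (cong (_+ k) (+-suc (suc b) d)) (trans (sym (+-suc (suc b + d) k)) q)
        q₂ : b + suc (suc d) + k ≡ n
        q₂ = trans (cong (_+ k) (+-suc b (suc d))) q₃
        le' : suc (suc (b + d)) ≤ n
        le' = (m≤m+n _ k) ≤≡ trans (sym (+-suc (suc b + d) k)) q

-- Last passage values through column functions

Line Column : Set
Line   = ℕ → ℕ
Column = ℕ → ℕ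

cum : Line → ℕ → ℕ
cum x zero = 0
cum x (suc t) = cum x t + x t

Monotone : Column → Set
Monotone g = ∀ t → g t ≤ g (suc t)

monotone-≤ : ∀ {g} → Monotone g → ∀ {s t} → s ≤ t → g s ≤ g t
monotone-≤ {g} m {s} {t} h = subst (λ z → g s ≤ g z) (m+[n∸m]≡n h) (go (t ∸ s))
  where
  go : ∀ d → g s ≤ g (s + d)
  go zero = ≤-reflexive (cong g (sym (+-identityʳ s)))
  go (suc d) = ≤-trans (go d) (m (s + d) ≤≡ cong g (sym (+-suc s d)))

cum-mono : ∀ x → Monotone (cum x)
cum-mono x t = m≤m+n (cum x t) (x t)

-- `near` compares the bottom left corner of a box with its top right corner: each box is covered at
-- most once.
record Step (g b : Column) : Set where
  field
    mono  : Monotone g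
    above : ∀ t → b t ≤ g t
    near  : ∀ t → g (suc t) ≤ suc (b t)

-- An ℓ-tuple of noncrossing paths is encoded by the number of paths that separate a lattice point
-- from the top right corner; g and b are these numbers on the left and on the right side of the
-- column y, so that g (suc t) ∸ b t tells whether the box (t , y) is covered.
coverage : ℕ → Line → Column → Column → ℕ
coverage zero y g b = 0
coverage (suc T) y g b = coverage T y g b + y T * (g (suc T) ∸ b T)

infixr 5 _◁_
-- The lines are listed from the last column of the grid to the first.
data Columns (T : ℕ) : Column → List Line → Column → ℕ → Set where
  none : ∀ {b} → Columns T b [] b 0
  _◁_  : ∀ {g b y Ls a w} → Step g b → Columns T g Ls a w →
        Columns T b (y ∷ Ls) a (coverage T y g b + w)

infix 4 _⊑[_]_
-- Both outer columns `b` and `a` are prescribed. This makes the relation compatible with further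
-- lines on either side.
_⊑[_]_ : List Line → ℕ → List Line → Set
Ls ⊑[ T ] Ls' = ∀ {b a w} → Monotone b → Columns T b Ls a w → ∃ λ w' → w ≤ w' × Columns T b Ls' a w'

⊑-refl : ∀ {T Ls} → Ls ⊑[ T ] Ls
⊑-refl _ C = _ , ≤-refl , C

⊑-trans : ∀ {T Ls Ls' Ls''} → Ls ⊑[ T ] Ls' → Ls' ⊑[ T ] Ls'' → Ls ⊑[ T ] Ls''
⊑-trans p q m C with p m C
... | w' , h , C' with q m C'
...   | w'' , h' , C'' = w'' , ≤-trans h h' , C''

⊑-cons : ∀ {T y Ls Ls'} → Ls ⊑[ T ] Ls' → y ∷ Ls ⊑[ T ] y ∷ Ls'
⊑-cons p m (s ◁ C) with p (Step.mono s) C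
... | w' , h , C' = _ , +-monoʳ-≤ _ h , s ◁ C'

coverage-cong : ∀ T {y y' g b} → (∀ t → t < T → y t ≡ y' t) → coverage T y g b ≡ coverage T y' g b
coverage-cong zero h = refl
coverage-cong (suc T) {g = g} {b} h =
  cong₂ _+_ (coverage-cong T (λ t lt → h t (m<n⇒m<1+n lt))) (cong (_* (g (suc T) ∸ b T)) (h T ≤-refl))

-- Two adjacent lines: x in front of y

increment : (x y : Line) (a g b : Column) → ℕ → ℕ
increment x y a g b t = y t * (g (suc t) ∸ b t) + x t * (a (suc t) ∸ g t)

pairCoverage : ℕ → (x y : Line) (a g b : Column) → ℕ
pairCoverage zero x y a g b = 0
pairCoverage (suc T) x y a g b = pairCoverage T x y a g b + increment x y a g b T

pairCoverage-≡ : ∀ T x y a g b → pairCoverage T x y a g b ≡ coverage T y g b + coverage T x a g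
pairCoverage-≡ zero x y a g b = refl
pairCoverage-≡ (suc T) x y a g b =
  trans (cong (_+ increment x y a g b T) (pairCoverage-≡ T x y a g b))
        (interchange (coverage T y g b) (coverage T x a g) _ _)

covered : ∀ k {p q} → p ≡ suc q → k * (p ∸ q) ≡ k
covered k {q = q} refl = trans (cong (k *_) (m+n∸n≡m 1 q)) (*-identityʳ k)

uncovered : ∀ k {p q} → p ≤ q → k * (p ∸ q) ≡ 0
uncovered k h = trans (cong (k *_) (m≤n⇒m∸n≡0 h)) (*-zeroʳ k)

splice : ℕ → (f g : ℕ → ℕ) → ℕ → ℕ
splice k f g t = if t <ᵇ k then f t else g t

splice-elim : ∀ (P : ℕ → Set) k {f g} t → (t < k → P (f t)) → (k ≤ t → P (g t)) → P (splice k f g t)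
splice-elim P k t p q with t <ᵇ k in e
... | true  = p (<ᵇ⇒< t k (subst Bool.T (sym e) _))
... | false = q (≮⇒≥ λ lt → subst Bool.T e (<⇒<ᵇ lt))

splice-< : ∀ k {f g t} → t < k → splice k f g t ≡ f t
splice-< k {f} {g} {t} lt = splice-elim (_≡ f t) k {f} {g} t (λ _ → refl) (λ h → ⊥-elim (<⇒≱ lt h))

splice-≥ : ∀ k {f g t} → k ≤ t → splice k f g t ≡ g t
splice-≥ k {f} {g} {t} h = splice-elim (_≡ g t) k {f} {g} t (λ lt → ⊥-elim (<⇒≱ lt h)) (λ _ → refl)

splice-mono : ∀ k {f g} → Monotone f → Monotone g → (∀ t → f t ≤ g t) → Monotone (splice k f g)
splice-mono k {f} {g} mf mg h t = splice-elim (_≤ splice k f g (suc t)) k {f} {g} t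
  (λ _ → splice-elim (f t ≤_) k {f} {g} (suc t) (λ _ → mf t) (λ _ → ≤-trans (mf t) (h (suc t))))
  (λ k≤t → mg t ≤≡ sym (splice-≥ k {f} {g} (m≤n⇒m≤1+n k≤t)))

pairCoverage-mono : ∀ {x y x' y' a g g' b} k → pairCoverage k x y a g b ≤ pairCoverage k x' y' a g' b →
  (∀ t → k ≤ t → increment x y a g b t ≤ increment x' y' a g' b t) →
  ∀ T → k ≤ T → pairCoverage T x y a g b ≤ pairCoverage T x' y' a g' b
pairCoverage-mono {x} {y} {x'} {y'} {a} {g} {g'} {b} k h₀ h T le =
  subst (λ z → pairCoverage z x y a g b ≤ pairCoverage z x' y' a g' b) (m+[n∸m]≡n le) (go (T ∸ k))
  where
  go : ∀ d → pairCoverage (k + d) x y a g b ≤ pairCoverage (k + d) x' y' a g' b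
  go zero rewrite +-identityʳ k = h₀
  go (suc d) rewrite +-suc k d = +-mono-≤ (go d) (h (k + d) (m≤m+n k d))

-- Moving the amount e from x τ to y τ does not change the maximum over the column between the
-- two lines: a path that leaves x after τ can be made to leave it at τ, and conversely.
module Move (τ e : ℕ) (x y x' y' : Line) (x'+e : x' τ + e ≡ x τ) (y+e : y' τ ≡ y τ + e)
  (x≡ : ∀ t → t ≢ τ → x' t ≡ x t) (y≡ : ∀ t → t ≢ τ → y' t ≡ y t)
  (after  : ∀ s → τ < s → cum x (suc s) + cum y τ ≤ cum y s + cum x (suc τ))
  (before : ∀ s → s ≤ τ → cum x s + cum y τ + e ≤ cum x (suc τ) + cum y (pred s))
  {a g b : Column} (mb : Monotone b) (gb : Step g b) (ag : Step a g)
  where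
  private
    module ag = Step ag
    module gb = Step gb
    v = b τ
    old new : ℕ → Column → ℕ
    old T g = pairCoverage T x y a g b
    new T g = pairCoverage T x' y' a g b

    same : ∀ {t} g → t ≢ τ → increment x y a g b t ≡ increment x' y' a g b t
    same {t} g ne = cong₂ _+_ (cong (_* _) (sym (y≡ t ne))) (cong (_* _) (sym (x≡ t ne)))

    prefix : ∀ T g g' → T ≤ τ → (∀ t → t ≤ T → g t ≡ g' t) → old T g ≡ new T g'
    prefix zero g g' le h = refl
    prefix (suc T) g g' le h = cong₂ _+_ (prefix T g g' (<⇒≤ le) (λ t q → h t (m≤n⇒m≤1+n q)))
      (trans (same g (<⇒≢ le)) (cong₂ (λ p q → y' T * (p ∸ b T) + x' T * (a (suc T) ∸ q)) (h (suc T) ≤-refl) (h T (n≤1+n T))))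

    -- The only case in which the move loses weight: at τ the line x is covered and y is not. The
    -- path running down x past τ is sent into y at τ, by raising the heights between the lines
    -- after τ to at least `suc v`.
    module Raise (g↓ : g (suc τ) ≤ v) (a↑ : g τ < a (suc τ)) where
      gτ : g τ ≡ v
      gτ = ≤-antisym (≤-trans (gb.mono τ) g↓) (gb.above τ)
      aτ : a (suc τ) ≡ suc v
      aτ = ≤-antisym (≤-trans (ag.near τ) (s≤s (≤-reflexive gτ))) (≤-trans (s≤s (≤-reflexive (sym gτ))) a↑)
      g↑ : Column
      g↑ t = g t ⊔ suc v
      g' : Column
      g' = splice (suc τ) g g↑
      g'< : ∀ {t} → t ≤ τ → g' t ≡ g t
      g'< le = splice-< (suc τ) {g} {g↑} (s≤s le)
      g'> : ∀ {t} → τ < t → g' t ≡ g t ⊔ suc v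
      g'> lt = splice-≥ (suc τ) {g} {g↑} lt
      g≤g' : ∀ t → g t ≤ g' t
      g≤g' t = splice-elim (g t ≤_) (suc τ) {g} {g↑} t (λ _ → ≤-refl) (λ _ → m≤m⊔n (g t) _)
      g'b : Step g' b
      g'b = record
        { mono = splice-mono (suc τ) gb.mono (λ t → ⊔-monoˡ-≤ (suc v) (gb.mono t)) (λ t → m≤m⊔n (g t) _)
        ; above = λ t → ≤-trans (gb.above t) (g≤g' t)
        ; near = λ t → splice-elim (_≤ suc (b t)) (suc τ) {g} {g↑} (suc t) (λ _ → gb.near t)
                   (λ lt → ⊔-lub (gb.near t) (s≤s (monotone-≤ {b} mb (s≤s⁻¹ lt)))) }
      ag' : Step a g'
      ag' = record
        { mono = ag.mono
        ; above = λ t → splice-elim (_≤ a t) (suc τ) {g} {g↑} t (λ _ → ag.above t)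
                    (λ lt → ⊔-lub (ag.above t) (sym aτ ≡≤ monotone-≤ {a} ag.mono lt))
        ; near = λ t → ≤-trans (ag.near t) (s≤s (g≤g' t)) }

      -- `low`: the old path is still in x, and the new one has collected y from τ on instead of x
      -- after τ; the difference is recorded exactly. `high`: the old path has crossed as well, and
      -- by `after` nothing was lost.
      data State (T : ℕ) : Set where
        low  : g T ≡ v → new T g' + cum x T + cum y τ ≡ old T g + cum y T + cum x (suc τ) → State T
        high : suc v ≤ g T → old T g ≤ new T g' → State T

      start : State (suc τ)
      start = low (≤-antisym g↓ (sym gτ ≡≤ gb.mono τ))
        (lem (old τ g) (new τ g') (x τ) (y τ) (x' τ) (y' τ) _ _ _ _ (cum x τ) (cum y τ)
          (prefix τ g g' ≤-refl (λ t le → sym (g'< le))) x'+e y+e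
          (covered (y' τ) (trans (g'> ≤-refl) (m≤n⇒m⊔n≡n (m≤n⇒m≤1+n g↓))))
          (covered (x' τ) (trans aτ (cong suc (trans (sym gτ) (sym (g'< ≤-refl))))))
          (uncovered (y τ) g↓)
          (covered (x τ) (trans aτ (cong suc (sym gτ)))))
        where
        lem : ∀ o n x y x' y' p q r s X Y → o ≡ n → x' + e ≡ x → y' ≡ y + e →
          p ≡ y' → q ≡ x' → r ≡ 0 → s ≡ x → n + (p + q) + (X + x) + Y ≡ o + (r + s) + (Y + y) + (X + x)
        lem o .o .(x' + e) y x' .(y + e) .(y + e) .x' .0 .(x' + e) X Y refl refl refl refl refl refl refl =
          solve (o ∷ e ∷ y ∷ x' ∷ X ∷ Y ∷ [])

      module Low {T} (lt : τ < T) (h : g T ≡ v) where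
        b≡v : b T ≡ v
        b≡v = ≤-antisym (gb.above T ≤≡ h) (monotone-≤ {b} mb (<⇒≤ lt))
        a≡ : a (suc T) ≡ suc v
        a≡ = ≤-antisym (≤-trans (ag.near T) (s≤s (≤-reflexive h)))
               (sym aτ ≡≤ monotone-≤ {a} ag.mono (s≤s (<⇒≤ lt)))

      next : ∀ T → τ < T → State T → State (suc T)
      next T lt (high h i) = high (≤-trans h (gb.mono T)) (+-mono-≤ i (≤-reflexive
        (trans (same g (≢-sym (<⇒≢ lt)))
          (cong₂ (λ p q → y' T * (p ∸ b T) + x' T * (a (suc T) ∸ q))
            (sym (trans (g'> (m<n⇒m<1+n lt)) (m≥n⇒m⊔n≡m (≤-trans h (gb.mono T)))))
            (sym (trans (g'> lt) (m≥n⇒m⊔n≡m h)))))))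
      next T lt (low h i) with g (suc T) ≤? v
      ... | yes q = low g≡v
        (lem (old T g) (new T g') (x T) (y T) (x' T) (y' T) _ _ _ _ (cum x T) (cum y T) (cum x (suc τ)) (cum y τ) i
          (x≡ T (≢-sym (<⇒≢ lt))) (y≡ T (≢-sym (<⇒≢ lt)))
          (covered (y' T) (trans (g'> (m<n⇒m<1+n lt)) (trans (m≤n⇒m⊔n≡n (m≤n⇒m≤1+n q)) (cong suc (sym b≡v)))))
          (uncovered (x' T) (a≡ ≡≤ (m≤n⊔m (g T) (suc v) ≤≡ sym (g'> lt))))
          (uncovered (y T) (q ≤≡ sym b≡v))
          (covered (x T) (trans a≡ (cong suc (sym h)))))
        where
        open Low lt h
        g≡v : g (suc T) ≡ v
        g≡v = ≤-antisym q (sym h ≡≤ gb.mono T)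
        lem : ∀ o n x y x' y' p q r s X Y X₀ Y₀ → n + X + Y₀ ≡ o + Y + X₀ → x' ≡ x → y' ≡ y →
          p ≡ y' → q ≡ 0 → r ≡ 0 → s ≡ x → n + (p + q) + (X + x) + Y₀ ≡ o + (r + s) + (Y + y) + X₀
        lem o n x y .x .y .y .0 .0 .x X Y X₀ Y₀ i refl refl refl refl refl refl =
          by-≡ i (solve (o ∷ n ∷ x ∷ y ∷ X ∷ Y ∷ X₀ ∷ Y₀ ∷ []))
      ... | no q = high (≰⇒> q)
        (lem (old T g) (new T g') (x T) (y T) (x' T) (y' T) _ _ _ _ (cum x T) (cum y T) (cum x (suc τ)) (cum y τ) i
          (after T lt)
          (x≡ T (≢-sym (<⇒≢ lt))) (y≡ T (≢-sym (<⇒≢ lt)))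
          (covered (y' T) (trans (g'> (m<n⇒m<1+n lt)) (trans (m≥n⇒m⊔n≡m (≰⇒> q)) g≡)))
          (uncovered (x' T) (a≡ ≡≤ (m≤n⊔m (g T) (suc v) ≤≡ sym (g'> lt))))
          (covered (y T) g≡)
          (covered (x T) (trans a≡ (cong suc (sym h)))))
        where
        open Low lt h
        g≡ : g (suc T) ≡ suc (b T)
        g≡ = ≤-antisym (gb.near T) (≤-trans (s≤s (≤-reflexive b≡v)) (≰⇒> q))
        lem : ∀ o n x y x' y' p q r s X Y X₀ Y₀ → n + X + Y₀ ≡ o + Y + X₀ → X + x + Y₀ ≤ Y + X₀ → x' ≡ x → y' ≡ y →
          p ≡ y' → q ≡ 0 → r ≡ y → s ≡ x → o + (r + s) ≤ n + (p + q)
        lem o n x y .x .y .y .0 .y .x X Y X₀ Y₀ i c refl refl refl refl refl refl =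
          by-≤ (+-mono-≤ c (≤-reflexive (sym i))) (solve (o ∷ n ∷ x ∷ y ∷ X ∷ Y ∷ X₀ ∷ Y₀ ∷ []))

      states : ∀ d → State (suc τ + d)
      states zero rewrite +-identityʳ τ = start
      states (suc d) rewrite +-suc τ d = next (suc (τ + d)) (s≤s (m≤m+n τ d)) (states d)

      old≤new : ∀ T → old T g ≤ new T g'
      old≤new T with T ≤? τ
      ... | yes le = ≤-reflexive (prefix T g g' le (λ t q → sym (g'< (≤-trans q le))))
      ... | no gt with subst State (m+[n∸m]≡n (≰⇒> gt)) (states (T ∸ suc τ))
      ...   | high _ h = h
      ...   | low _ h = lem (old T g) (new T g') (cum x T) (cum y T) (cum x (suc τ)) (cum y τ) h
                (≤-trans (+-monoˡ-≤ (cum y τ) (cum-mono x T)) (after T (≰⇒> gt)))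
        where
        lem : ∀ o n X Y X₀ Y₀ → n + X + Y₀ ≡ o + Y + X₀ → X + Y₀ ≤ Y + X₀ → o ≤ n
        lem o n X Y X₀ Y₀ i c = by-≤ (+-mono-≤ c (≤-reflexive (sym i))) (solve (o ∷ n ∷ X ∷ Y ∷ X₀ ∷ Y₀ ∷ []))

    -- The mirror case: at τ the line y is covered and x is not. The path that was already in y is
    -- kept in x through row τ, by lowering the heights up to τ to at most `v`.
    module Lower (a↓ : a (suc τ) ≤ g τ) (g↑ : v < g (suc τ)) where
      gτ₁ : g (suc τ) ≡ suc v
      gτ₁ = ≤-antisym (gb.near τ) g↑
      aτ : a (suc τ) ≡ suc v
      aτ = ≤-antisym (≤-trans a↓ (gb.mono τ ≤≡ gτ₁)) (≤-trans g↑ (ag.above (suc τ)))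
      gτ : g τ ≡ suc v
      gτ = ≤-antisym (gb.mono τ ≤≡ gτ₁) (sym aτ ≡≤ a↓)
      g↓ : Column
      g↓ t = g t ⊓ v
      g' : Column
      g' = splice (suc τ) g↓ g
      g'< : ∀ {t} → t ≤ τ → g' t ≡ g t ⊓ v
      g'< le = splice-< (suc τ) {g↓} {g} (s≤s le)
      g'> : ∀ {t} → τ < t → g' t ≡ g t
      g'> lt = splice-≥ (suc τ) {g↓} {g} lt
      g'≤g : ∀ t → g' t ≤ g t
      g'≤g t = splice-elim (_≤ g t) (suc τ) {g↓} {g} t (λ _ → m⊓n≤m (g t) v) (λ _ → ≤-refl)
      g'b : Step g' b
      g'b = record
        { mono = splice-mono (suc τ) (λ t → ⊓-monoˡ-≤ v (gb.mono t)) gb.mono (λ t → m⊓n≤m (g t) v)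
        ; above = λ t → splice-elim (b t ≤_) (suc τ) {g↓} {g} t
                    (λ lt → ⊓-glb (gb.above t) (monotone-≤ {b} mb (s≤s⁻¹ lt))) (λ _ → gb.above t)
        ; near = λ t → ≤-trans (g'≤g (suc t)) (gb.near t) }
      ag' : Step a g'
      ag' = record
        { mono = ag.mono
        ; above = λ t → ≤-trans (g'≤g t) (ag.above t)
        ; near = λ t → splice-elim (λ z → a (suc t) ≤ suc z) (suc τ) {g↓} {g} t
                   (λ lt → ⊓-glb (ag.near t) (monotone-≤ {a} ag.mono lt ≤≡ aτ))
                   (λ _ → ag.near t) }

      -- In `high`, `s` is the row after the crossing from x to y, or 0 if the path is in y from the
      -- start. The rerouted path collects x from row `s` on where the given one collects y from row
      -- `pred s` on: in the crossing row itself both keep the same share of x.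
      data State (T : ℕ) : Set where
        low  : g T ≤ v → old T g' ≡ new T g → State T
        high : g T ≡ suc v → ∀ s → s ≤ T → old T g' + cum y T + cum x s ≡ new T g + cum x T + cum y (pred s) → State T

      next : ∀ T → T < τ → State T → State (suc T)
      next T lt st with g (suc T) ≤? v
      next T lt (low h i) | yes q = low q (cong₂ _+_ i
        (trans (same g' (<⇒≢ lt)) (cong₂ (λ p q → y' T * (p ∸ b T) + x' T * (a (suc T) ∸ q))
            (trans (g'< lt) (m≤n⇒m⊓n≡m q)) (trans (g'< (<⇒≤ lt)) (m≤n⇒m⊓n≡m h)))))
      next T lt (high h _ _ _) | yes q = ⊥-elim (<-irrefl refl (sym h ≡≤ ≤-trans (gb.mono T) q))
      next T lt st | no q = step st
        where
        g≡ : g (suc T) ≡ suc v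
        g≡ = ≤-antisym (monotone-≤ {g} gb.mono lt ≤≡ gτ) (≰⇒> q)
        b≡v : b T ≡ v
        b≡v = ≤-antisym (monotone-≤ {b} mb (<⇒≤ lt)) (s≤s⁻¹ (≤-trans (≰⇒> q) (gb.near T)))
        y-out : y T * (g' (suc T) ∸ b T) ≡ 0
        y-out = uncovered (y T) (g'< lt ≡≤ (m⊓n≤n (g (suc T)) v ≤≡ sym b≡v))
        y-in : y' T * (g (suc T) ∸ b T) ≡ y' T
        y-in = covered (y' T) (trans g≡ (cong suc (sym b≡v)))
        step : State T → State (suc T)
        step (low h i) = high g≡ (suc T) ≤-refl
          (lem (old T g') (new T g) (cum x T) (cum y T) (x T) (y T) _ _ _ _ (y' T) i y-out
            (cong₂ _*_ (x≡ T (<⇒≢ lt)) (cong (a (suc T) ∸_) (sym (trans (g'< (<⇒≤ lt)) (m≤n⇒m⊓n≡m h))))) y-in (y≡ T (<⇒≢ lt)))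
          where
          lem : ∀ o n X Y x y p q r s y' → o ≡ n → p ≡ 0 → s ≡ q → r ≡ y' → y' ≡ y →
            o + (p + q) + (Y + y) + (X + x) ≡ n + (r + s) + (X + x) + Y
          lem o .o X Y x y .0 q .y .q .y refl refl refl refl refl = solve (o ∷ X ∷ Y ∷ x ∷ y ∷ q ∷ [])
        step (high h s le i) = high g≡ s (m≤n⇒m≤1+n le)
          (lem (old T g') (new T g) (cum x T) (cum y T) (cum x s) (cum y (pred s)) (x T) (y T) _ _ _ _ (y' T) i y-out
            (covered (x T) (trans a≡ (cong suc (sym (trans (g'< (<⇒≤ lt)) (m≥n⇒m⊓n≡n (n≤1+n v ≤≡ sym h)))))))
            y-in
            (uncovered (x' T) (≤-reflexive (trans a≡ (sym h)))) (y≡ T (<⇒≢ lt)))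
          where
          a≡ : a (suc T) ≡ suc v
          a≡ = ≤-antisym (monotone-≤ {a} ag.mono (m<n⇒m<1+n lt) ≤≡ aτ)
                 (sym g≡ ≡≤ ag.above (suc T))
          lem : ∀ o n X Y X₀ Y₀ x y p q r s y' → o + Y + X₀ ≡ n + X + Y₀ → p ≡ 0 → q ≡ x → r ≡ y' → s ≡ 0 → y' ≡ y →
            o + (p + q) + (Y + y) + X₀ ≡ n + (r + s) + (X + x) + Y₀
          lem o n X Y X₀ Y₀ x y .0 .x .y .0 .y i refl refl refl refl refl =
            by-≡ i (solve (o ∷ n ∷ X ∷ Y ∷ X₀ ∷ Y₀ ∷ x ∷ y ∷ []))

      start : State 0
      start with g 0 ≤? v
      ... | yes q = low q refl
      ... | no q = high (≤-antisym (monotone-≤ {g} gb.mono {0} {τ} z≤n ≤≡ gτ) (≰⇒> q)) 0 z≤n refl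

      states : ∀ T → T ≤ τ → State T
      states zero le = start
      states (suc T) le = next T le (states T (<⇒≤ le))

      crossing : new (suc τ) g ≤ old (suc τ) g'
      crossing with states τ ≤-refl
      ... | low q _ = ⊥-elim (<-irrefl refl (sym gτ ≡≤ q))
      ... | high _ s le i = lem (old τ g') (new τ g) (cum x τ) (cum y τ) (cum x s) (cum y (pred s)) (x τ) (y τ) _ _ _ _ (y' τ)
              i (before s le)
              (covered (y τ) (trans (g'> ≤-refl) gτ₁))
              (covered (x τ) (trans aτ (cong suc (sym (trans (g'< ≤-refl) (m≥n⇒m⊓n≡n (n≤1+n v ≤≡ sym gτ)))))))
              (covered (y' τ) gτ₁)
              (uncovered (x' τ) a↓) y+e
        where
        lem : ∀ o n X Y X₀ Y₀ x y p q r s y' → o + Y + X₀ ≡ n + X + Y₀ → X₀ + Y + e ≤ X + x + Y₀ →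
          p ≡ y → q ≡ x → r ≡ y' → s ≡ 0 → y' ≡ y + e → n + (r + s) ≤ o + (p + q)
        lem o n X Y X₀ Y₀ x y .y .x .(y + e) .0 .(y + e) i c refl refl refl refl refl =
          by-≤ (+-mono-≤ c (≤-reflexive (sym i))) (solve (o ∷ n ∷ X ∷ Y ∷ X₀ ∷ Y₀ ∷ x ∷ y ∷ e ∷ []))

      new≤old : ∀ T → τ < T → new T g ≤ old T g'
      new≤old T gt = pairCoverage-mono (suc τ) crossing
        (λ t lt → ≤-reflexive (trans (sym (same g (≢-sym (<⇒≢ lt))))
           (cong₂ (λ p q → y t * (p ∸ b t) + x t * (a (suc t) ∸ q)) (sym (g'> (m<n⇒m<1+n lt))) (sym (g'> lt)))))
        T gt

    y-covered : g (suc τ) ≰ v → g (suc τ) ∸ v ≡ 1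
    y-covered h = trans (cong (_∸ v) (≤-antisym (gb.near τ) (≰⇒> h))) (m+n∸n≡m 1 v)

    x-covered : a (suc τ) ≰ g τ → a (suc τ) ∸ g τ ≡ 1
    x-covered h = trans (cong (_∸ g τ) (≤-antisym (ag.near τ) (≰⇒> h))) (m+n∸n≡m 1 (g τ))

    x-near : a (suc τ) ∸ g τ ≤ 1
    x-near = ∸-monoˡ-≤ (g τ) (ag.near τ) ≤≡ m+n∸n≡m 1 (g τ)

    y-near : g (suc τ) ∸ v ≤ 1
    y-near = ∸-monoˡ-≤ v (gb.near τ) ≤≡ m+n∸n≡m 1 v

    by-cases : ∀ {x y x' y' : Line} → (∀ t → t ≢ τ → increment x y a g b t ≡ increment x' y' a g b t) →
      increment x y a g b τ ≤ increment x' y' a g b τ → ∀ T → pairCoverage T x y a g b ≤ pairCoverage T x' y' a g b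
    by-cases {x} {y} {x'} {y'} h hτ T = pairCoverage-mono {x} {y} {x'} {y'} {a} {g} {g} {b} 0 z≤n step T z≤n
      where
      step : ∀ t → 0 ≤ t → increment x y a g b t ≤ increment x' y' a g b t
      step t _ with t ≟ τ
      ... | yes refl = hτ
      ... | no ne = ≤-reflexive (h t ne)

    forward-τ : ∀ x y x' y' u v → x' + e ≡ x → y' ≡ y + e → u ≤ v → y * v + x * u ≤ y' * v + x' * u
    forward-τ .(x' + e) y x' .(y + e) u v refl refl h =
      by-≤ {p = e * u} {q = e * v} (*-monoʳ-≤ e h) (solve (x' ∷ y ∷ u ∷ v ∷ e ∷ []))

    backward-τ : ∀ x y x' y' u v → x' + e ≡ x → y' ≡ y + e → v ≤ u → y' * v + x' * u ≤ y * v + x * u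
    backward-τ .(x' + e) y x' .(y + e) u v refl refl h =
      by-≤ {p = e * v} {q = e * u} (*-monoʳ-≤ e h) (solve (x' ∷ y ∷ u ∷ v ∷ e ∷ []))

  move-forward : ∀ T → ∃ λ g' → Step g' b × Step a g' × pairCoverage T x y a g b ≤ pairCoverage T x' y' a g' b
  move-forward T with a (suc τ) ≤? g τ | g (suc τ) ≤? v
  ... | no h | yes h' = g' , g'b , ag' , old≤new T
    where open Raise h' (≰⇒> h)
  ... | yes h | _ = g , gb , ag , by-cases (λ t → same g)
        (forward-τ (x τ) (y τ) (x' τ) (y' τ) _ _ x'+e y+e (m≤n⇒m∸n≡0 h ≡≤ z≤n)) T
  ... | no _ | no h = g , gb , ag , by-cases (λ t → same g)
        (forward-τ (x τ) (y τ) (x' τ) (y' τ) _ _ x'+e y+e (x-near ≤≡ sym (y-covered h))) T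

  move-backward : ∀ T → ∃ λ g' → Step g' b × Step a g' × pairCoverage T x' y' a g b ≤ pairCoverage T x y a g' b
  move-backward T with T ≤? τ | a (suc τ) ≤? g τ | g (suc τ) ≤? v
  ... | yes le | _ | _ = g , gb , ag , ≤-reflexive (sym (prefix T g g le (λ _ _ → refl)))
  ... | no gt | yes h | no h' = g' , g'b , ag' , new≤old T (≰⇒> gt)
    where open Lower h (≰⇒> h')
  ... | no _ | _ | yes h = g , gb , ag , by-cases (λ t ne → sym (same g ne))
        (backward-τ (x τ) (y τ) (x' τ) (y' τ) _ _ x'+e y+e (m≤n⇒m∸n≡0 h ≡≤ z≤n)) T
  ... | no _ | no h | no _ = g , gb , ag , by-cases (λ t ne → sym (same g ne))
        (backward-τ (x τ) (y τ) (x' τ) (y' τ) _ _ x'+e y+e (y-near ≤≡ sym (x-covered h))) T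

pair-⊑ : ∀ {T x y x' y' Ls} →
  (∀ {a g b} → Monotone b → Step g b → Step a g →
    ∃ λ g' → Step g' b × Step a g' × pairCoverage T x y a g b ≤ pairCoverage T x' y' a g' b) →
  y ∷ x ∷ Ls ⊑[ T ] y' ∷ x' ∷ Ls
pair-⊑ {T} {x} {y} {x'} {y'} f {b} mb (_◁_ {g = g} gb (_◁_ {g = a} {w = w} ag C)) with f mb gb ag
... | g' , gb' , ag' , h = _ , le , gb' ◁ (ag' ◁ C)
  where
  le : coverage T y g b + (coverage T x a g + w) ≤ coverage T y' g' b + (coverage T x' a g' + w)
  le = subst₂ _≤_ (+-assoc (coverage T y g b) _ w) (+-assoc (coverage T y' g' b) _ w)
    (+-monoˡ-≤ w (subst₂ _≤_ (pairCoverage-≡ T x y a g b) (pairCoverage-≡ T x' y' a g' b) h))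

pair-cong-⊑ : ∀ {T x y x' y' Ls} → (∀ t → t < T → x t ≡ x' t) → (∀ t → t < T → y t ≡ y' t) →
  y ∷ x ∷ Ls ⊑[ T ] y' ∷ x' ∷ Ls
pair-cong-⊑ {T} {x} {y} {x'} {y'} hx hy = pair-⊑ λ {a} {g} {b} mb gb ag → g , gb , ag , ≤-reflexive
  (trans (pairCoverage-≡ T x y a g b) (trans (cong₂ _+_ (coverage-cong T hy) (coverage-cong T hx))
    (sym (pairCoverage-≡ T x' y' a g b))))

m+[n∸m]≡m⊔n : ∀ m n → m + (n ∸ m) ≡ m ⊔ n
m+[n∸m]≡m⊔n m n with ≤-total m n
... | inj₁ h = trans (m+[n∸m]≡n h) (sym (m≤n⇒m⊔n≡n h))
... | inj₂ h = trans (cong (m +_) (m≤n⇒m∸n≡0 h)) (trans (+-identityʳ m) (sym (m≥n⇒m⊔n≡m h)))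

cum-splice-≤ : ∀ k f g t → t ≤ k → cum (splice k f g) t ≡ cum f t
cum-splice-≤ k f g zero h = refl
cum-splice-≤ k f g (suc t) h = cong₂ _+_ (cum-splice-≤ k f g t (<⇒≤ h)) (splice-< k {f} {g} h)

cum-splice-≥ : ∀ k f g t → k ≤ t → cum (splice k f g) t + cum g k ≡ cum f k + cum g t
cum-splice-≥ k f g t h = subst (λ z → cum (splice k f g) z + cum g k ≡ cum f k + cum g z) (m+[n∸m]≡n h) (go (t ∸ k))
  where
  go : ∀ d → cum (splice k f g) (k + d) + cum g k ≡ cum f k + cum g (k + d)
  go zero rewrite +-identityʳ k = cong (_+ cum g k) (cum-splice-≤ k f g k ≤-refl)
  go (suc d) rewrite +-suc k d =
    lem (cum (splice k f g) (k + d)) (cum g k) (cum f k) (cum g (k + d)) _ _ (go d) (splice-≥ k {f} {g} (m≤m+n k d))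
    where
    lem : ∀ a b c d x y → a + b ≡ c + d → x ≡ y → a + x + b ≡ c + (d + y)
    lem a b c d x .x h refl = by-≡ h (solve (a ∷ b ∷ c ∷ d ∷ x ∷ []))

-- Sorting two adjacent lines (the Pitman transform)

-- The last passage value through two lines: at `suc t` it is the maximum over s ≤ t of x summed up
-- to row s plus y summed from row s to row t. Sorting makes these values the partial sums of one
-- line; it moves the amount `sortGain` from x to y within each row.
sortCum : (x y : Line) → ℕ → ℕ
sortCum x y zero = 0
sortCum x y (suc t) = y t + (sortCum x y t ⊔ cum x (suc t))

sortGain sortTop sortRest : (x y : Line) → Line
sortGain x y t = cum x (suc t) ∸ sortCum x y t
sortTop  x y t = y t + sortGain x y t
sortRest x y t = x t ∸ sortGain x y t

module _ (x y : Line) where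
  private
    P = sortCum x y
    gain = sortGain x y
    top = sortTop x y
    rest = sortRest x y

  cum-sortTop : ∀ t → cum top t ≡ P t
  cum-sortTop zero = refl
  cum-sortTop (suc t) = trans (cong (_+ top t) (cum-sortTop t))
    (trans (lem (P t) (y t) (gain t)) (cong (y t +_) (m+[n∸m]≡m⊔n (P t) (cum x (suc t)))))
    where
    lem : ∀ p y g → p + (y + g) ≡ y + (p + g)
    lem p y g = solve (p ∷ y ∷ g ∷ [])

  cum-sortTop-suc : ∀ t → cum top (suc t) ≡ y t + (cum top t ⊔ cum x (suc t))
  cum-sortTop-suc t = trans (cum-sortTop (suc t)) (cong (λ z → y t + (z ⊔ cum x (suc t))) (sym (cum-sortTop t)))

  x≤sortCum : ∀ t → cum x t ≤ P t
  x≤sortCum zero = z≤n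
  x≤sortCum (suc t) = ≤-trans (m≤n⊔m (P t) _) (m≤n+m _ (y t))

  gain≤x : ∀ t → gain t ≤ x t
  gain≤x t = ∸-monoʳ-≤ (cum x (suc t)) (x≤sortCum t) ≤≡ m+n∸m≡n (cum x t) (x t)

  rest+gain : ∀ t → rest t + gain t ≡ x t
  rest+gain t = m∸n+n≡m (gain≤x t)

  sort-mass : ∀ t → cum rest t + cum top t ≡ cum x t + cum y t
  sort-mass zero = refl
  sort-mass (suc t) = lem (cum rest t) (cum top t) (cum x t) (cum y t) (rest t) (gain t) (x t) (y t) (sort-mass t) (rest+gain t)
    where
    lem : ∀ R T X Y r g x y → R + T ≡ X + Y → r + g ≡ x → R + r + (T + (y + g)) ≡ X + x + (Y + y)
    lem R T X Y r g .(r + g) y h refl = by-≡ h (solve (R ∷ T ∷ X ∷ Y ∷ r ∷ g ∷ y ∷ []))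

  y≤sortTop : ∀ t → cum y t ≤ cum top t
  y≤sortTop zero = z≤n
  y≤sortTop (suc t) = +-mono-≤ (y≤sortTop t) (m≤m+n (y t) (gain t))

  rest≤y : ∀ t → cum rest (suc t) ≤ cum y t
  rest≤y t = lem (cum rest (suc t)) (cum top (suc t)) (cum x (suc t)) (cum y t) (y t) (sort-mass (suc t))
    (+-monoʳ-≤ (y t) (m≤n⊔m (P t) _) ≤≡ sym (cum-sortTop (suc t)))
    where
    lem : ∀ R T X Y y → R + T ≡ X + (Y + y) → y + X ≤ T → R ≤ Y
    lem R T X Y y e h = by-≤ (+-mono-≤ h (≤-reflexive e)) (solve (R ∷ T ∷ X ∷ Y ∷ y ∷ []))

  -- The bound `rest≤y` is attained in every row where something moves. This is the source of
  -- `tight` in the Burge rule.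
  sort-saturated : ∀ t → cum top t ≤ cum x (suc t) → cum rest (suc t) ≡ cum y t
  sort-saturated t h = lem (cum rest (suc t)) (cum top (suc t)) (cum x (suc t)) (cum y t) (y t) (sort-mass (suc t))
    (trans (cum-sortTop-suc t) (cong (y t +_) (m≤n⇒m⊔n≡n h)))
    where
    lem : ∀ R T X Y y → R + T ≡ X + (Y + y) → T ≡ y + X → R ≡ Y
    lem R .(y + X) X Y y e refl = by-≡ e (solve (R ∷ X ∷ Y ∷ y ∷ []))

  rest≤top : ∀ t → cum rest (suc t) ≤ cum top t
  rest≤top t = ≤-trans (rest≤y t) (y≤sortTop t)

  gain-mono : ∀ {s t} → s ≤ t → cum top s + cum y t ≤ cum top t + cum y s
  gain-mono {s} {t} h = subst (λ z → cum top s + cum y z ≤ cum top z + cum y s) (m+[n∸m]≡n h) (go (t ∸ s))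
    where
    go : ∀ d → cum top s + cum y (s + d) ≤ cum top (s + d) + cum y s
    go zero rewrite +-identityʳ s = ≤-refl
    go (suc d) rewrite +-suc s d = lem (cum top s) (cum y (s + d)) (cum top (s + d)) (cum y s) (y (s + d)) (gain (s + d)) (go d)
      where
      lem : ∀ a b c d y g → a + b ≤ c + d → a + (b + y) ≤ c + (y + g) + d
      lem a b c d y g h = ≤-trans (m≤m+n _ g) (by-≤ {a + (b + y) + g} {c + (y + g) + d} h (solve (a ∷ b ∷ c ∷ d ∷ y ∷ g ∷ [])))

  sortRest-min : ∀ t → rest t + cum x t ≡ cum top t ⊓ cum x (suc t)
  sortRest-min t = trans (trans (+-comm (rest t) (cum x t)) (sym (+-∸-assoc (cum x t) (gain≤x t))))
    (trans (m∸[m∸n]≡n⊓m (cum x (suc t)) (P t)) (cong (_⊓ cum x (suc t)) (sym (cum-sortTop t))))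
    where
    m∸[m∸n]≡n⊓m : ∀ m n → m ∸ (m ∸ n) ≡ n ⊓ m
    m∸[m∸n]≡n⊓m m n with ≤-total n m
    ... | inj₁ h = trans (m∸[m∸n]≡n h) (sym (m≤n⇒m⊓n≡m h))
    ... | inj₂ h = trans (cong (m ∸_) (m≤n⇒m∸n≡0 h)) (sym (m≥n⇒m⊓n≡n h))

  -- The moves are carried out from the last time to the first: splice k x rest is the line after
  -- the moves at the times t ≥ k.
  private
    xs ys : ℕ → Line
    xs k = splice k x rest
    ys k = splice k y top

    -- In the rows excluded by `P≤X` nothing moves. After τ the lines are already sorted, and
    -- `after` follows from `rest≤y` and from the growth of the total gain. Up to τ they are still
    -- the original ones, and `before` holds because `cum top` dominates each single passage from x
    -- to y.
    module Stage (τ : ℕ) (P≤X : P τ ≤ cum x (suc τ)) where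
      Y≤rest : cum y τ ≤ cum rest (suc τ)
      Y≤rest = ≤-reflexive (sym (sort-saturated τ (cum-sortTop τ ≡≤ P≤X)))

      after : ∀ s → τ < s → cum (xs (suc τ)) (suc s) + cum (ys (suc τ)) τ ≤ cum (ys (suc τ)) s + cum (xs (suc τ)) (suc τ)
      after s lt = subst₂ (λ p q → cum (xs (suc τ)) (suc s) + p ≤ cum (ys (suc τ)) s + q)
        (sym (cum-splice-≤ (suc τ) y top τ (n≤1+n τ))) (sym (cum-splice-≤ (suc τ) x rest (suc τ) ≤-refl))
        (lem (cum (xs (suc τ)) (suc s)) (cum (ys (suc τ)) s) (cum y τ) (cum x (suc τ)) (cum rest (suc τ)) (cum rest (suc s))
          (cum top (suc τ)) (cum top s) (cum y (suc τ)) (cum y s)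
          (cum-splice-≥ (suc τ) x rest (suc s) (m<n⇒m<1+n lt))
          (cum-splice-≥ (suc τ) y top s lt) (rest≤y s) (gain-mono lt) Y≤rest)
        where
        lem : ∀ XS YS Y X R R' T T' Y₁ Y' → XS + R ≡ X + R' → YS + T ≡ Y₁ + T' → R' ≤ Y' → T + Y' ≤ T' + Y₁ → Y ≤ R →
          XS + Y ≤ YS + X
        lem XS YS Y X R R' T T' Y₁ Y' h₁ h₂ h₃ h₄ h₅ = by-≤
          (+-mono-≤ (≤-reflexive h₁) (+-mono-≤ (≤-reflexive (sym h₂)) (+-mono-≤ h₃ (+-mono-≤ h₄ h₅))))
          (solve (XS ∷ YS ∷ Y ∷ X ∷ R ∷ R' ∷ T ∷ T' ∷ Y₁ ∷ Y' ∷ []))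

      before₀ : ∀ s → s ≤ τ → cum x s + cum y τ ≤ cum top τ + cum y (pred s)
      before₀ zero le = ≤-trans (y≤sortTop τ) (m≤m+n _ 0)
      before₀ (suc s) le = lem (cum x (suc s)) (cum y τ) (cum top τ) (cum y s) (y s) (cum top (suc s)) (gain-mono le)
        (+-monoʳ-≤ (y s) (m≤n⊔m (P s) _) ≤≡ sym (cum-sortTop (suc s)))
        where
        lem : ∀ X Y T Y' y T' → T' + Y ≤ T + (Y' + y) → y + X ≤ T' → X + Y ≤ T + Y'
        lem X Y T Y' y T' h₁ h₂ = by-≤ (+-mono-≤ h₁ h₂) (solve (X ∷ Y ∷ T ∷ Y' ∷ y ∷ T' ∷ []))

      before : ∀ s → s ≤ τ → cum (xs (suc τ)) s + cum (ys (suc τ)) τ + gain τ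
                               ≤ cum (xs (suc τ)) (suc τ) + cum (ys (suc τ)) (pred s)
      before s le = subst₂ _≤_
        (cong (_+ gain τ) (cong₂ _+_ (sym (cum-splice-≤ (suc τ) x rest s (m≤n⇒m≤1+n le))) (sym (cum-splice-≤ (suc τ) y top τ (n≤1+n τ)))))
        (cong₂ _+_ (sym (cum-splice-≤ (suc τ) x rest (suc τ) ≤-refl))
          (sym (cum-splice-≤ (suc τ) y top (pred s) (≤-trans (pred[n]≤n {s}) (m≤n⇒m≤1+n le)))))
        (lem (cum x s) (cum y τ) (cum top τ) (cum y (pred s)) (gain τ) (cum x (suc τ)) (before₀ s le)
          (trans (cong (_+ gain τ) (cum-sortTop τ)) (m+[n∸m]≡n P≤X)))
        where
        lem : ∀ X Y T Y' g X₁ → X + Y ≤ T + Y' → T + g ≡ X₁ → X + Y + g ≤ X₁ + Y'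
        lem X Y T Y' g .(T + g) h refl = by-≤ h (solve (X ∷ Y ∷ T ∷ Y' ∷ g ∷ []))

      xs≡ : ∀ t → t ≢ τ → xs τ t ≡ xs (suc τ) t
      xs≡ t ne = splice-elim (_≡ xs (suc τ) t) τ {x} {rest} t
        (λ lt → sym (splice-< (suc τ) {x} {rest} (m<n⇒m<1+n lt)))
        (λ h → sym (splice-≥ (suc τ) {x} {rest} (≤∧≢⇒< h (≢-sym ne))))
      ys≡ : ∀ t → t ≢ τ → ys τ t ≡ ys (suc τ) t
      ys≡ t ne = splice-elim (_≡ ys (suc τ) t) τ {y} {top} t
        (λ lt → sym (splice-< (suc τ) {y} {top} (m<n⇒m<1+n lt)))
        (λ h → sym (splice-≥ (suc τ) {y} {top} (≤∧≢⇒< h (≢-sym ne))))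
      xτ : xs τ τ + gain τ ≡ xs (suc τ) τ
      xτ = trans (cong (_+ gain τ) (splice-≥ τ {x} {rest} ≤-refl))
             (trans (rest+gain τ) (sym (splice-< (suc τ) {x} {rest} ≤-refl)))
      yτ : ys τ τ ≡ ys (suc τ) τ + gain τ
      yτ = trans (splice-≥ τ {y} {top} ≤-refl) (cong (_+ gain τ) (sym (splice-< (suc τ) {y} {top} ≤-refl)))

      stage-⊑ : ∀ {T Ls} → ys (suc τ) ∷ xs (suc τ) ∷ Ls ⊑[ T ] ys τ ∷ xs τ ∷ Ls
      stage-⊑ {T} = pair-⊑ λ mb gb ag →
        Move.move-forward τ (gain τ) (xs (suc τ)) (ys (suc τ)) (xs τ) (ys τ) xτ yτ xs≡ ys≡ after before mb gb ag T
      stage-⊒ : ∀ {T Ls} → ys τ ∷ xs τ ∷ Ls ⊑[ T ] ys (suc τ) ∷ xs (suc τ) ∷ Ls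
      stage-⊒ {T} = pair-⊑ λ mb gb ag →
        Move.move-backward τ (gain τ) (xs (suc τ)) (ys (suc τ)) (xs τ) (ys τ) xτ yτ xs≡ ys≡ after before mb gb ag T

    idle : ∀ τ → cum x (suc τ) ≤ P τ → (∀ t → xs (suc τ) t ≡ xs τ t) × (∀ t → ys (suc τ) t ≡ ys τ t)
    idle τ h = (λ t → idle′ x rest t (λ where refl → cong (x τ ∸_) (m≤n⇒m∸n≡0 h))) ,
               (λ t → idle′ y top t (λ where refl → trans (cong (y τ +_) (m≤n⇒m∸n≡0 h)) (+-identityʳ (y τ))))
      where
      idle′ : ∀ (f g : Line) t → (t ≡ τ → g t ≡ f t) → splice (suc τ) f g t ≡ splice τ f g t
      idle′ f g t e = splice-elim (splice (suc τ) f g t ≡_) τ {f} {g} t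
        (λ lt → splice-< (suc τ) {f} {g} (m<n⇒m<1+n lt))
        (λ le → splice-elim (_≡ g t) (suc τ) {f} {g} t (λ lt → sym (e (≤-antisym (s≤s⁻¹ lt) le))) (λ _ → refl))

    stages : ∀ {T Ls} k → ys k ∷ xs k ∷ Ls ⊑[ T ] ys 0 ∷ xs 0 ∷ Ls × ys 0 ∷ xs 0 ∷ Ls ⊑[ T ] ys k ∷ xs k ∷ Ls
    stages zero = ⊑-refl , ⊑-refl
    stages (suc k) with ≤-total (P k) (cum x (suc k))
    ... | inj₁ h = ⊑-trans (Stage.stage-⊑ k h) (proj₁ (stages k)) , ⊑-trans (proj₂ (stages k)) (Stage.stage-⊒ k h)
    ... | inj₂ h = ⊑-trans (pair-cong-⊑ (λ t _ → proj₁ (idle k h) t) (λ t _ → proj₂ (idle k h) t)) (proj₁ (stages k)) ,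
                   ⊑-trans (proj₂ (stages k)) (pair-cong-⊑ (λ t _ → sym (proj₁ (idle k h) t)) (λ t _ → sym (proj₂ (idle k h) t)))

  sort-⊑ : ∀ {T Ls} → y ∷ x ∷ Ls ⊑[ T ] top ∷ rest ∷ Ls
  sort-⊑ {T} = ⊑-trans (pair-cong-⊑ (λ t lt → sym (splice-< T {x} {rest} lt)) (λ t lt → sym (splice-< T {y} {top} lt)))
                       (proj₁ (stages T))

  sort-⊒ : ∀ {T Ls} → top ∷ rest ∷ Ls ⊑[ T ] y ∷ x ∷ Ls
  sort-⊒ {T} = ⊑-trans (proj₂ (stages T))
    (pair-cong-⊑ (λ t lt → splice-< T {x} {rest} lt) (λ t lt → splice-< T {y} {top} lt))

-- Melons: families of lines sorted in such a way that the maxima can be read off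

-- The line listed first is the later column. It dominates the next one even when that one is a row
-- ahead; exactly this shift is used up by the summation by parts in `headRest≤slack`.
IsMelon : List Line → Set
IsMelon = Linked (λ y x → ∀ t → cum x (suc t) ≤ cum y t)

part : List Line → ℕ → Seq
part [] T k = 0
part (y ∷ Ls) T zero = cum y T
part (y ∷ Ls) T (suc k) = part Ls T k

insertLast : Line → List Line → List Line
insertLast X [] = X ∷ []
insertLast X (q ∷ qs) = sortTop q X ∷ insertLast (sortRest q X) qs

-- A new first column enters at the far end of the list. At each sorting the larger line is carried
-- on towards the head and the smaller one stays, whereas `insertLast` passes the smaller line on.
insertFirst : Line → List Line → Line × List Line
insertFirst X [] = X , []
insertFirst X (q ∷ qs) = sortTop (proj₁ (insertFirst X qs)) q , sortRest (proj₁ (insertFirst X qs)) q ∷ proj₂ (insertFirst X qs)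

insertFirst′ : Line → List Line → List Line
insertFirst′ X qs = proj₁ (insertFirst X qs) ∷ proj₂ (insertFirst X qs)

melon : List Line → List Line
melon [] = []
melon (L ∷ Ls) = insertLast L (melon Ls)

insertLast-⊑ : ∀ {T} X qs → X ∷ qs ⊑[ T ] insertLast X qs
insertLast-⊑ X [] = ⊑-refl
insertLast-⊑ X (q ∷ qs) = ⊑-trans (sort-⊑ q X) (⊑-cons (insertLast-⊑ (sortRest q X) qs))

insertLast-⊒ : ∀ {T} X qs → insertLast X qs ⊑[ T ] X ∷ qs
insertLast-⊒ X [] = ⊑-refl
insertLast-⊒ X (q ∷ qs) = ⊑-trans (⊑-cons (insertLast-⊒ (sortRest q X) qs)) (sort-⊒ q X)

insertFirst-⊑ : ∀ {T} X qs → qs ∷ʳ X ⊑[ T ] insertFirst′ X qs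
insertFirst-⊑ X [] = ⊑-refl
insertFirst-⊑ X (q ∷ qs) = ⊑-trans (⊑-cons (insertFirst-⊑ X qs)) (sort-⊑ (proj₁ (insertFirst X qs)) q)

insertFirst-⊒ : ∀ {T} X qs → insertFirst′ X qs ⊑[ T ] qs ∷ʳ X
insertFirst-⊒ X [] = ⊑-refl
insertFirst-⊒ X (q ∷ qs) = ⊑-trans (sort-⊒ (proj₁ (insertFirst X qs)) q) (⊑-cons (insertFirst-⊒ X qs))

melon-⊑ : ∀ {T} Ls → Ls ⊑[ T ] melon Ls
melon-⊑ [] = ⊑-refl
melon-⊑ (L ∷ Ls) = ⊑-trans (⊑-cons (melon-⊑ Ls)) (insertLast-⊑ L (melon Ls))

melon-⊒ : ∀ {T} Ls → melon Ls ⊑[ T ] Ls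
melon-⊒ [] = ⊑-refl
melon-⊒ (L ∷ Ls) = ⊑-trans (insertLast-⊒ L (melon Ls)) (⊑-cons (melon-⊒ Ls))

unsnoc : ∀ {T X b a w} Ls → Columns T b (Ls ∷ʳ X) a w →
  ∃ λ g → ∃ λ v → Columns T b Ls g v × Step a g × w ≡ v + coverage T X a g
unsnoc [] (s ◁ none) = _ , _ , none , s , +-identityʳ _
unsnoc {T} {X} (L ∷ Ls) (_◁_ {g = h} s C) with unsnoc Ls C
... | g , v , C' , s' , refl = g , _ , s ◁ C' , s' , sym (+-assoc (coverage T L h _) v _)

snoc : ∀ {T X b g a v} {Ls} → Columns T b Ls g v → Step a g → Columns T b (Ls ∷ʳ X) a (v + coverage T X a g)
snoc none s = subst (Columns _ _ _ _) (+-identityʳ _) (s ◁ none)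
snoc {T} {X} (_◁_ {g = h} {y = y} {w = w} s' C) s =
  subst (Columns T _ _ _) (sym (+-assoc (coverage T y h _) w (coverage T X _ _))) (s' ◁ snoc C s)

⊑-snoc : ∀ {T X} {Ls Ls'} → Ls ⊑[ T ] Ls' → Ls ∷ʳ X ⊑[ T ] Ls' ∷ʳ X
⊑-snoc {T} {X} {Ls} p m C with unsnoc Ls C
... | g , v , C' , s , refl with p m C'
...   | v' , h , C'' = _ , +-monoˡ-≤ (coverage T X _ g) h , snoc C'' s

-- Both terms of the maximum for the second sorted line stay below `cum q`, the second one by the
-- melon property. In `insertLast-melon`, `sortRest-min` turns this into a bound by the first sorted
-- line.
insertLast-head : ∀ {q} q₂ X → (∀ t → cum q₂ (suc t) ≤ cum q t) → ∀ t → cum (sortTop q₂ (sortRest q X)) t ≤ cum q t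
insertLast-head q₂ X h zero = z≤n
insertLast-head {q} q₂ X h (suc t) = (cum-sortTop-suc q₂ (sortRest q X) t)
  ≡≤ ((+-mono-≤ (m∸n≤m (q t) (sortGain q X t)) (⊔-lub (insertLast-head {q} q₂ X h t) (h t)))
           ≤≡ +-comm (q t) (cum q t))

insertLast-melon : ∀ X {qs} → IsMelon qs → IsMelon (insertLast X qs)
insertLast-melon X Linked.[] = [-]
insertLast-melon X {q ∷ []} [-] = rest≤top q X Linked.∷ [-]
insertLast-melon X {q ∷ q₂ ∷ qs} (h Linked.∷ m) = below Linked.∷ insertLast-melon (sortRest q X) m
  where
  below : ∀ t → cum (sortTop q₂ (sortRest q X)) (suc t) ≤ cum (sortTop q X) t
  below t = (cum-sortTop-suc q₂ (sortRest q X) t)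
    ≡≤ (≤-trans (+-monoʳ-≤ (sortRest q X t) (⊔-lub (insertLast-head {q} q₂ X h t) (h t)))
      (sortRest-min q X t ≡≤ (m⊓n≤m (cum (sortTop q X) t) _)))

-- Row by row: in a saturated row the rest has reached `cum q t`, which dominates q₂ one row ahead;
-- in any other row nothing moves, and the rest grows by `sortTop C q₂ t`, which is at least `q₂ t`.
insertFirst-head : ∀ q q₂ C → (∀ t → cum q₂ (suc t) ≤ cum q t) → ∀ t → cum q₂ t ≤ cum (sortRest (sortTop C q₂) q) t
insertFirst-head q q₂ C h zero = z≤n
insertFirst-head q q₂ C h (suc t) with ≤-total (cum (sortTop c q) t) (cum c (suc t))
  where c = sortTop C q₂
... | inj₁ le = h t ≤≡ sym (sort-saturated (sortTop C q₂) q t le)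
... | inj₂ le = ≤-trans (+-mono-≤ (insertFirst-head q q₂ C h t) (m≤m+n (q₂ t) (sortGain C q₂ t)))
    (+-monoʳ-≤ (cum (sortRest c q) t) (≤-reflexive (sym (cong (c t ∸_)
      (m≤n⇒m∸n≡0 (le ≤≡ cum-sortTop c q t))))))
  where c = sortTop C q₂

insertFirst-melon : ∀ X {qs} → IsMelon qs → IsMelon (insertFirst′ X qs)
insertFirst-melon X Linked.[] = [-]
insertFirst-melon X {q ∷ []} [-] = rest≤top X q Linked.∷ [-]
insertFirst-melon X {q ∷ q₂ ∷ qs} (h Linked.∷ m) = rest≤top (sortTop C q₂) q Linked.∷ below (insertFirst-melon X m)
  where
  C = proj₁ (insertFirst X qs)
  below : ∀ {r} → IsMelon (sortTop C q₂ ∷ sortRest C q₂ ∷ r) → IsMelon (sortRest (sortTop C q₂) q ∷ sortRest C q₂ ∷ r)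
  below (_ Linked.∷ m') = (λ t → ≤-trans (rest≤y C q₂ t) (insertFirst-head q q₂ C h t)) Linked.∷ m'

melon-melon : ∀ Ls → IsMelon (melon Ls)
melon-melon [] = Linked.[]
melon-melon (L ∷ Ls) = insertLast-melon L (melon-melon Ls)

-- Row t acts as one box. By `sortRest-min` the amount handed to the second line is the minimum of
-- the first parts of m and n minus the first part of l, so the rule for the later parts is the
-- recursion with this amount as its entry.
insertLast-rule : ∀ X qs t →
  RSKRule (part qs t) (part (insertLast X qs) t) (part qs (suc t)) (X t) (part (insertLast X qs) (suc t))
insertLast-rule X [] t = rskRule (trans (+-comm (cum X t) (X t)) (cong (X t +_) (sym (⊔-identityʳ (cum X t)))))
  (λ i → sym (⊓-zeroʳ _))
insertLast-rule X (q ∷ qs) t = rskRule (cum-sortTop-suc q X t) later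
  where
  ps = insertLast (sortRest q X) qs
  IH = insertLast-rule (sortRest q X) qs t
  lem : ∀ p r m q z → p ≡ r + m → r + q ≡ z → p + q ≡ m + z
  lem .(r + m) r m q z refl h = by-≡ h (solve (r ∷ m ∷ q ∷ z ∷ []))
  later : ∀ i → part (sortTop q X ∷ ps) (suc t) (suc i) + part (q ∷ qs) t i
              ≡ (part (sortTop q X ∷ ps) t (suc i) ⊔ part (q ∷ qs) (suc t) (suc i))
                + (part (sortTop q X ∷ ps) t i ⊓ part (q ∷ qs) (suc t) i)
  later zero = lem (part ps (suc t) 0) (sortRest q X t) (part ps t 0 ⊔ part qs (suc t) 0) (cum q t) _
    (RSKRule.first IH) (sortRest-min q X t)
  later (suc i) = RSKRule.later IH i

insertFirst-rule : ∀ X qs t →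
  BurgeRule (part qs t) (part (insertFirst′ X qs) t) (part qs (suc t)) (X t) (part (insertFirst′ X qs) (suc t))
insertFirst-rule X [] t = record
  { c = λ where zero → 0
                (suc _) → X t
  ; c0 = refl
  ; mass = λ where zero → trans (+-identityʳ _) (trans (+-identityʳ _) (cong (_+ X t) (sym (+-identityʳ (cum X t)))))
                   (suc i) → refl
  ; cap = λ _ → z≤n ; tight = λ _ → inj₂ refl ; N = 1
  ; entry = λ where (suc i) _ → refl }
insertFirst-rule X (q ∷ qs) t = record
  { c = c ; c0 = refl ; mass = mass ; cap = cap ; tight = tight ; N = suc (suc R.N) ; entry = entry }
  where
  module R = BurgeRule (insertFirst-rule X qs t)
  C = proj₁ (insertFirst X qs)
  -- The amount that the last sorting moves in row t into the head line, hence the overflow from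
  -- part 1 into part 0. The carries of the recursion follow from index 2 on.
  D = cum C (suc t) ∸ cum (sortTop C q) t
  c : ℕ → ℕ
  c zero = 0
  c (suc zero) = D
  c (suc (suc i)) = R.c (suc i)
  top-suc : cum (sortTop C q) (suc t) ≡ q t + (cum (sortTop C q) t + D)
  top-suc = trans (cum-sortTop-suc C q t) (cong (q t +_) (sym (m+[n∸m]≡m⊔n (cum (sortTop C q) t) (cum C (suc t)))))
  mass : ∀ i → part (insertFirst′ X (q ∷ qs)) (suc t) i + part (q ∷ qs) t i + c i ≡
               part (insertFirst′ X (q ∷ qs)) t i + part (q ∷ qs) (suc t) i + c (suc i)
  mass zero = lem (cum (sortTop C q) (suc t)) (cum (sortTop C q) t) D (cum q t) (q t) top-suc
    where
    lem : ∀ T' T D Q q → T' ≡ q + (T + D) → T' + Q + 0 ≡ T + (Q + q) + D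
    lem .(q + (T + D)) T D Q q refl = solve (T ∷ D ∷ Q ∷ q ∷ [])
  mass (suc zero) = lem (cum (sortRest C q) (suc t)) (cum (sortRest C q) t) (cum (sortTop C q) (suc t)) (cum (sortTop C q) t) D (cum q t) (q t)
      (cum C (suc t)) (cum C t) (part qs t 0) (part qs (suc t) 0) (R.c 0) (R.c 1) top-suc (sort-mass C q (suc t)) (sort-mass C q t) (R.mass 0) R.c0
    where
    lem : ∀ R' R T' T D Q q C' C λ₁ ν₁ c₀ c₁ → T' ≡ q + (T + D) → R' + T' ≡ C' + (Q + q) → R + T ≡ C + Q →
      C' + λ₁ + c₀ ≡ C + ν₁ + c₁ → c₀ ≡ 0 → R' + λ₁ + D ≡ R + ν₁ + c₁
    lem R' R .(q + (T + D)) T D Q q C' C λ₁ ν₁ .0 c₁ refl h₁ h₂ h₃ refl =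
      by-≡ (cong₂ _+_ h₁ (cong₂ _+_ (sym h₂) h₃)) (solve (R' ∷ R ∷ T ∷ D ∷ Q ∷ q ∷ C' ∷ C ∷ λ₁ ∷ ν₁ ∷ c₁ ∷ []))
  mass (suc (suc i)) = R.mass (suc i)
  cap : ∀ i → part (insertFirst′ X (q ∷ qs)) (suc t) (suc i) ≤ part (q ∷ qs) t i
  cap zero = rest≤y C q t
  cap (suc i) = R.cap i
  tight : ∀ i → c (suc i) ≡ 0 ⊎ part (insertFirst′ X (q ∷ qs)) (suc t) (suc i) ≡ part (q ∷ qs) t i
  tight zero with ≤-total (cum C (suc t)) (cum (sortTop C q) t)
  ... | inj₁ h = inj₁ (m≤n⇒m∸n≡0 h)
  ... | inj₂ h = inj₂ (sort-saturated C q t h)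
  tight (suc i) = R.tight i
  entry : ∀ i → suc (suc R.N) ≤ i → c i ≡ X t
  entry (suc (suc i)) (s≤s (s≤s h)) = R.entry (suc i) (m≤n⇒m≤1+n h)

-- Evaluation of the maxima of a melon, by summation by parts

headRest : ℕ → List Line → Column → ℕ
headRest T [] g = 0
headRest zero (x ∷ _) g = 0
headRest (suc T) (x ∷ Ls) g = headRest T (x ∷ Ls) g + cum x (suc T) * (g (suc T) ∸ g T)

slack : ℕ → Line → Column → ℕ
slack zero y g = 0
slack (suc T) y g = slack T y g + cum y T * (g (suc T) ∸ g T)

-- The boundary term that summation by parts leaves for one line is absorbed by the line listed
-- before it.
headRest≤slack : ∀ T {y Ls} g → IsMelon (y ∷ Ls) → headRest T Ls g ≤ slack T y g
headRest≤slack T {Ls = []} g m = z≤n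
headRest≤slack zero {Ls = x ∷ Ls} g m = z≤n
headRest≤slack (suc T) {Ls = x ∷ Ls} g (h Linked.∷ m) =
  +-mono-≤ (headRest≤slack T g (h Linked.∷ m)) (*-monoˡ-≤ (g (suc T) ∸ g T) (h T))

coverage-by-parts : ∀ T {y Ls g b} → Monotone b → Step g b →
  coverage T y g b + slack T y g ≡ cum y T * (g T ∸ b T) + headRest T (y ∷ Ls) b
coverage-by-parts zero mb s = refl
coverage-by-parts (suc T) {y} {Ls} {g} {b} mb s =
  lem (coverage T y g b) (slack T y g) (headRest T (y ∷ Ls) b) (cum y T) (y T) (b T) (b (suc T)) (g T) (g (suc T))
    (mb T) (Step.mono s T) (Step.above s T) (Step.above s (suc T)) (coverage-by-parts T mb s)
  where
  core : ∀ C S H Y y β b a a' g → a + g ≡ b + a' → C + S ≡ Y * a + H →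
    C + y * (a + g) + (S + Y * g) ≡ (Y + y) * a' + (H + (Y + y) * b)
  core C S H Y y β b a a' g e h = by-≡ (cong₂ _+_ h (cong (λ z → (Y + y) * z) e))
    (solve (C ∷ S ∷ H ∷ Y ∷ y ∷ b ∷ a ∷ a' ∷ g ∷ []))
  lem : ∀ C S H Y y b₀ b₁ g₀ g₁ → b₀ ≤ b₁ → g₀ ≤ g₁ → b₀ ≤ g₀ → b₁ ≤ g₁ → C + S ≡ Y * (g₀ ∸ b₀) + H →
    C + y * (g₁ ∸ b₀) + (S + Y * (g₁ ∸ g₀)) ≡ (Y + y) * (g₁ ∸ b₁) + (H + (Y + y) * (b₁ ∸ b₀))
  lem C S H Y y b₀ b₁ g₀ g₁ p q r t h = trans
    (cong (λ z → C + y * z + (S + Y * (g₁ ∸ g₀))) (sym split))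
    (core C S H Y y b₀ (b₁ ∸ b₀) (g₀ ∸ b₀) (g₁ ∸ b₁) (g₁ ∸ g₀) (trans split (sym split′)) h)
    where
    telescope : ∀ {x y z} → x ≤ y → y ≤ z → (y ∸ x) + (z ∸ y) ≡ z ∸ x
    telescope {x} {y} {z} h k = trans (sym (+-∸-comm (z ∸ y) h)) (cong (_∸ x) (m+[n∸m]≡n k))
    split = telescope r q
    split′ = telescope p t

part-decreasing : ∀ T {Ls} → IsMelon Ls → ∀ k → part Ls T (suc k) ≤ part Ls T k
part-decreasing T Linked.[] k = z≤n
part-decreasing T [-] k = z≤n
part-decreasing T {y ∷ x ∷ Ls} (h Linked.∷ m) zero = ≤-trans (cum-mono x T) (h T)
part-decreasing T (h Linked.∷ m) (suc k) = part-decreasing T m k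

cum-shift : ∀ s k → cum s (suc k) ≡ s 0 + cum (λ i → s (suc i)) k
cum-shift s zero = sym (+-identityʳ (s 0))
cum-shift s (suc k) = trans (cong (_+ s (suc k)) (cum-shift s k)) (+-assoc (s 0) _ _)

cum-pointwise : ∀ {s s'} k → (∀ i → s i ≤ s' i) → cum s k ≤ cum s' k
cum-pointwise zero h = z≤n
cum-pointwise (suc k) h = +-mono-≤ (cum-pointwise k h) (h k)

columns-above : ∀ {T b Ls a w} → Columns T b Ls a w → ∀ t → b t ≤ a t
columns-above none t = ≤-refl
columns-above (s ◁ C) t = ≤-trans (Step.above s t) (columns-above C t)

columns-monotone : ∀ {T b Ls a w} → Monotone b → Columns T b Ls a w → Monotone a
columns-monotone mb none = mb
columns-monotone mb (s ◁ C) = columns-monotone (Step.mono s) C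

melon-upper : ∀ {T b a w} Ls → IsMelon Ls → Monotone b → Columns T b Ls a w →
  w ≤ headRest T Ls b + cum (part Ls T) (a T ∸ b T)
melon-upper [] m mb none = z≤n
melon-upper {T} {b} {a} (y ∷ Ls) m mb (_◁_ {g = g} {w = w} s C) = ≤-trans
  (+-monoʳ-≤ (coverage T y g b) (≤-trans (melon-upper Ls (tail m) (Step.mono s) C)
    (+-monoˡ-≤ (cum (part Ls T) (a T ∸ g T)) (headRest≤slack T g m))))
  ((trans (sym (+-assoc (coverage T y g b) _ _))
      (cong (_+ cum (part Ls T) (a T ∸ g T)) (coverage-by-parts T mb s)))
    ≡≤ ((lem (cum y T * (g T ∸ b T)) (headRest T (y ∷ Ls) b) _)
      ≡≤ +-monoʳ-≤ (headRest T (y ∷ Ls) b) last))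
  where
  tail : ∀ {Ls} → IsMelon (y ∷ Ls) → IsMelon Ls
  tail [-] = Linked.[]
  tail (_ Linked.∷ m) = m
  lem : ∀ p q r → p + q + r ≡ q + (p + r)
  lem p q r = solve (p ∷ q ∷ r ∷ [])
  last : cum y T * (g T ∸ b T) + cum (part Ls T) (a T ∸ g T) ≤ cum (part (y ∷ Ls) T) (a T ∸ b T)
  -- In row T the line y raises the height by 0 or 1. If by 1, it contributes its own part; if by 0,
  -- the parts of `Ls` are replaced by the larger ones of `y ∷ Ls`.
  last with g T ≤? b T
  ... | yes h = (cong (_+ cum (part Ls T) (a T ∸ g T)) (uncovered (cum y T) h))
        ≡≤ ((cum-pointwise (a T ∸ g T) (part-decreasing T m))
          ≤≡ cong (λ z → cum (part (y ∷ Ls) T) (a T ∸ z)) (≤-antisym h (Step.above s T)))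
  ... | no h = ≤-reflexive (trans (cong (_+ cum (part Ls T) (a T ∸ g T)) (covered (cum y T) g≡))
        (trans (sym (cum-shift (part (y ∷ Ls) T) (a T ∸ g T))) (cong (cum (part (y ∷ Ls) T)) a∸b)))
    where
    g≡ : g T ≡ suc (b T)
    g≡ = ≤-antisym (≤-trans (Step.mono s T) (Step.near s T)) (≰⇒> h)
    a∸b : suc (a T ∸ g T) ≡ a T ∸ b T
    a∸b = trans (cong (λ z → suc (a T ∸ z)) g≡)
      (sym (+-∸-assoc 1 (sym g≡ ≡≤ columns-above C T)))

Zero : Column
Zero _ = 0

headRest-zero : ∀ T Ls → headRest T Ls Zero ≡ 0
headRest-zero T [] = refl
headRest-zero zero (x ∷ Ls) = refl
headRest-zero (suc T) (x ∷ Ls) = cong₂ _+_ (headRest-zero T (x ∷ Ls)) (*-zeroʳ (cum x (suc T)))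

coverage-const-0 : ∀ T y i → coverage T y (λ _ → i) (λ _ → i) ≡ 0
coverage-const-0 zero y i = refl
coverage-const-0 (suc T) y i = cong₂ _+_ (coverage-const-0 T y i) (uncovered (y T) {i} ≤-refl)

coverage-const-1 : ∀ T y i → coverage T y (λ _ → suc i) (λ _ → i) ≡ cum y T
coverage-const-1 zero y i = refl
coverage-const-1 (suc T) y i = cong₂ _+_ (coverage-const-1 T y i) (covered (y T) {q = i} refl)

-- The first `r` lines are covered completely, by columns that are constant in t.
melon-lower : ∀ T Ls i r → ∃ λ a → ∃ λ w → Columns T (λ _ → i) Ls a w × a T ≤ i + r × w ≡ cum (part Ls T) r
melon-lower T [] i r = _ , _ , none , m≤m+n i r , sym (zeros r)
  where
  zeros : ∀ r → cum (part [] T) r ≡ 0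
  zeros zero = refl
  zeros (suc r) = trans (+-identityʳ _) (zeros r)
melon-lower T (y ∷ Ls) i zero with melon-lower T Ls i zero
... | a , w , C , h , e = a , _ ,
  record { mono = λ _ → ≤-refl ; above = λ _ → ≤-refl ; near = λ _ → n≤1+n i } ◁ C , h ,
  cong₂ _+_ (coverage-const-0 T y i) e
melon-lower T (y ∷ Ls) i (suc r) with melon-lower T Ls (suc i) r
... | a , w , C , h , e = a , _ ,
  record { mono = λ _ → ≤-refl ; above = λ _ → n≤1+n i ; near = λ _ → ≤-refl } ◁ C ,
  h ≤≡ sym (+-suc i r) ,
  trans (cong₂ _+_ (coverage-const-1 T y i) e) (sym (cum-shift (part (y ∷ Ls) T) r))

-- shape T Ls is the Greene-Kleitman shape of the first T rows of the grid with columns Ls.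
shape : ℕ → List Line → Seq
shape T Ls = part (melon Ls) T

-- Comparison of shapes through path maxima

infix 4 _≼[_,_]_
-- Weaker than `⊑`: the left column is free and only its value in the last row, the number of paths,
-- is controlled. Grids with unrelated rows can thus be compared.
record _≼[_,_]_ (Ls : List Line) (T T' : ℕ) (Ls' : List Line) : Set where
  constructor dominated
  field
    dominate : ∀ {a w} → Columns T Zero Ls a w → ∃ λ a' → ∃ λ w' → a' T' ≤ a T × w ≤ w' × Columns T' Zero Ls' a' w'
open _≼[_,_]_ public

⊑⇒≼ : ∀ {T Ls Ls'} → Ls ⊑[ T ] Ls' → Ls ≼[ T , T ] Ls'
⊑⇒≼ p .dominate C with p (λ _ → z≤n) C
... | w' , h , C' = _ , w' , ≤-refl , h , C'

≼-trans : ∀ {T T' T'' Ls Ls' Ls''} → Ls ≼[ T , T' ] Ls' → Ls' ≼[ T' , T'' ] Ls'' → Ls ≼[ T , T'' ] Ls''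
≼-trans p q .dominate C with dominate p C
... | a' , w' , h , k , C' with dominate q C'
...   | a'' , w'' , h' , k' , C'' = a'' , w'' , ≤-trans h' h , ≤-trans k k' , C''

cum-≤ : ∀ s {k l} → k ≤ l → cum s k ≤ cum s l
cum-≤ s = monotone-≤ {cum s} (cum-mono s)

melon-value : ∀ {T Ls a w} → IsMelon Ls → Columns T Zero Ls a w → w ≤ cum (part Ls T) (a T)
melon-value {T} {Ls} {a} m C = (melon-upper Ls m (λ _ → z≤n) C)
  ≤≡ cong (_+ cum (part Ls T) (a T)) (headRest-zero T Ls)

≼⇒cum-≤ : ∀ {T T' Ls Ls'} → IsMelon Ls' → Ls ≼[ T , T' ] Ls' → ∀ l → cum (part Ls T) l ≤ cum (part Ls' T') l
≼⇒cum-≤ {T} {T'} {Ls} {Ls'} m p l with melon-lower T Ls 0 l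
... | a , w , C , h , refl with dominate p C
...   | a' , w' , h' , k , C' = ≤-trans k (≤-trans (melon-value m C') (cum-≤ (part Ls' T') (≤-trans h' h)))

cum-injective : ∀ {s s'} → (∀ l → cum s l ≡ cum s' l) → s ≗ s'
cum-injective {s} {s'} h l = +-cancelˡ-≡ (cum s l) _ _ (trans (h (suc l)) (cong (_+ s' l) (sym (h l))))

melon-unique : ∀ {T T' Ls Ls'} → IsMelon Ls → IsMelon Ls' → Ls ≼[ T , T' ] Ls' → Ls' ≼[ T' , T ] Ls → part Ls T ≗ part Ls' T'
melon-unique m m' p q = cum-injective λ l → ≤-antisym (≼⇒cum-≤ m' p l) (≼⇒cum-≤ m q l)

shape-unique : ∀ {T T' Ls Ls'} → Ls ≼[ T , T' ] Ls' → Ls' ≼[ T' , T ] Ls → shape T Ls ≗ shape T' Ls'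
shape-unique {T} {T'} {Ls} {Ls'} p q = melon-unique (melon-melon Ls) (melon-melon Ls')
  (≼-trans (⊑⇒≼ (melon-⊒ Ls)) (≼-trans p (⊑⇒≼ (melon-⊑ Ls'))))
  (≼-trans (⊑⇒≼ (melon-⊒ Ls')) (≼-trans q (⊑⇒≼ (melon-⊑ Ls))))

shape-upper : ∀ {T Ls a w} → Columns T Zero Ls a w → w ≤ cum (shape T Ls) (a T)
shape-upper {T} {Ls} C with melon-⊑ Ls (λ _ → z≤n) C
... | w' , h , C' = ≤-trans h (melon-value (melon-melon Ls) C')

shape-attained : ∀ T Ls l → ∃ λ a → ∃ λ w → Columns T Zero Ls a w × a T ≤ l × cum (shape T Ls) l ≤ w
shape-attained T Ls l with melon-lower T (melon Ls) 0 l
... | a , w , C , h , e with melon-⊒ Ls (λ _ → z≤n) C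
...   | w' , k , C' = a , w' , C' , h , sym e ≡≤ k

shape-last : ∀ X Ls t → RSKRule (shape t Ls) (shape t (X ∷ Ls)) (shape (suc t) Ls) (X t) (shape (suc t) (X ∷ Ls))
shape-last X Ls t = insertLast-rule X (melon Ls) t

-- `melon` adds last columns only. But inserting a first column into a melon gives a melon with the
-- same maxima as the enlarged grid, and the maxima determine the parts.
shape-first : ∀ X Ls t → BurgeRule (shape t Ls) (shape t (Ls ∷ʳ X)) (shape (suc t) Ls) (X t) (shape (suc t) (Ls ∷ʳ X))
shape-first X Ls t = Local-resp burge (λ _ → refl) (same t) (λ _ → refl) refl (same (suc t)) (insertFirst-rule X (melon Ls) t)
  where
  same : ∀ t → part (insertFirst′ X (melon Ls)) t ≗ shape t (Ls ∷ʳ X)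
  same t = melon-unique (insertFirst-melon X (melon-melon Ls)) (melon-melon (Ls ∷ʳ X))
    (⊑⇒≼ (⊑-trans (insertFirst-⊒ X (melon Ls)) (⊑-trans (⊑-snoc (melon-⊒ Ls)) (melon-⊑ (Ls ∷ʳ X)))))
    (⊑⇒≼ (⊑-trans (melon-⊒ (Ls ∷ʳ X)) (⊑-trans (⊑-snoc (melon-⊑ Ls)) (insertFirst-⊑ X (melon Ls)))))

-- From families of paths to columns: the number of paths is replaced by the size of the longest
-- strict antichain among the covered boxes.

indicator : Bool → ℕ
indicator b = if b then 1 else 0

-- The longest sequence of selected boxes with strictly increasing row and list index, among t rows
-- and j lines. As lines are listed from the last column, no path contains two such boxes.
rank : (ℕ → ℕ → Bool) → ℕ → Column
rank S zero t = 0
rank S (suc j) zero = 0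
rank S (suc j) (suc t) = rank S (suc j) t ⊔ (rank S j (suc t) ⊔ (indicator (S t j) + rank S j t))

indicator≤1 : ∀ b → indicator b ≤ 1
indicator≤1 true = ≤-refl
indicator≤1 false = z≤n

rank-0 : ∀ S j → rank S j 0 ≡ 0
rank-0 S zero = refl
rank-0 S (suc j) = refl

rank-monotone : ∀ S j → Monotone (rank S j)
rank-monotone S zero t = z≤n
rank-monotone S (suc j) t = m≤m⊔n (rank S (suc j) t) _

rank-above : ∀ S j t → rank S j t ≤ rank S (suc j) t
rank-above S j zero = ≤-reflexive (rank-0 S j)
rank-above S j (suc t) = ≤-trans (m≤m⊔n (rank S j (suc t)) _) (m≤n⊔m (rank S (suc j) t) _)

rank-near : ∀ S j t → rank S (suc j) (suc t) ≤ suc (rank S j t)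
rank-near S j t = ⊔-lub (left t) (⊔-lub (below j) (+-monoˡ-≤ (rank S j t) (indicator≤1 (S t j))))
  where
  left : ∀ t → rank S (suc j) t ≤ suc (rank S j t)
  left zero = z≤n
  left (suc t) = ≤-trans (rank-near S j t) (s≤s (rank-monotone S j t))
  below : ∀ j → rank S j (suc t) ≤ suc (rank S j t)
  below zero = z≤n
  below (suc j) = ≤-trans (rank-near S j t) (s≤s (rank-above S j t))

rank-step : ∀ S j → Step (rank S (suc j)) (rank S j)
rank-step S j = record { mono = rank-monotone S (suc j) ; above = rank-above S j ; near = rank-near S j }

rank-selected : ∀ S j t → S t j ≡ true → suc (rank S j t) ≤ rank S (suc j) (suc t)
rank-selected S j t e = (cong (λ b → indicator b + rank S j t) (sym e))
  ≡≤ ≤-trans (m≤n⊔m (rank S j (suc t)) _) (m≤n⊔m (rank S (suc j) t) _)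

choose : Bool → ℕ → ℕ
choose b k = if b then k else 0

selected : ℕ → (ℕ → ℕ → Bool) → ℕ → List Line → ℕ
selected T S j [] = 0
selected T S j (y ∷ Ls) = cum (λ t → choose (S t j) (y t)) T + selected T S (suc j) Ls

rank-columns : ∀ T S j Ls → ∃ λ w → Columns T (rank S j) Ls (rank S (j + length Ls)) w × selected T S j Ls ≤ w
rank-columns T S j [] rewrite +-identityʳ j = 0 , none , z≤n
rank-columns T S j (y ∷ Ls) rewrite +-suc j (length Ls) with rank-columns T S (suc j) Ls
... | w , C , h = _ , rank-step S j ◁ C , +-mono-≤ (line T) h
  where
  line : ∀ T → cum (λ t → choose (S t j) (y t)) T ≤ coverage T y (rank S (suc j)) (rank S j)
  line zero = z≤n
  line (suc T) = +-mono-≤ (line T) (box (S T j) refl)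
    where
    box : ∀ b → S T j ≡ b → choose b (y T) ≤ y T * (rank S (suc j) (suc T) ∸ rank S j T)
    box false _ = z≤n
    box true e = ≤-reflexive (sym (covered (y T) (≤-antisym (rank-near S j T) (rank-selected S j T e))))

rank-∨ : ∀ (p q S : ℕ → ℕ → Bool) → (∀ t j → S t j ≡ p t j ∨ q t j) → ∀ j t → rank S j t ≤ rank p j t + rank q j t
rank-∨ p q S e zero t = z≤n
rank-∨ p q S e (suc j) zero = z≤n
rank-∨ p q S e (suc j) (suc t) = ⊔-lub
  (≤-trans (rank-∨ p q S e (suc j) t) (+-mono-≤ (rank-monotone p (suc j) t) (rank-monotone q (suc j) t)))
  (⊔-lub (≤-trans (rank-∨ p q S e j (suc t)) (+-mono-≤ (rank-above p j (suc t)) (rank-above q j (suc t))))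
    (≤-trans (+-mono-≤ (cong indicator (e t j) ≡≤ ind-∨ (p t j) (q t j)) (rank-∨ p q S e j t))
      ((interchange (indicator (p t j)) (indicator (q t j)) (rank p j t) (rank q j t))
        ≡≤ +-mono-≤ (corner p) (corner q))))
  where
  ind-∨ : ∀ a b → indicator (a ∨ b) ≤ indicator a + indicator b
  ind-∨ true b = s≤s z≤n
  ind-∨ false b = ≤-refl
  corner : ∀ p → indicator (p t j) + rank p j t ≤ rank p (suc j) (suc t)
  corner p = ≤-trans (m≤n⊔m (rank p j (suc t)) _) (m≤n⊔m (rank p (suc j) t) _)

Chain : ℕ → ℕ → (ℕ → ℕ → Bool) → Set
Chain T k p = ∀ {t j t' j'} → t < t' → j < j' → t' < T → j' < k → p t j ≡ true → p t' j' ≡ true → ⊥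

rank-chain : ∀ T k p → Chain T k p → ∀ j t → j ≤ k → t ≤ T →
  rank p j t ≡ 0 ⊎ (rank p j t ≤ 1 × ∃ λ t' → ∃ λ j' → t' < t × j' < j × p t' j' ≡ true)
rank-chain T k p c zero t hj ht = inj₁ refl
rank-chain T k p c (suc j) zero hj ht = inj₁ refl
rank-chain T k p c (suc j) (suc t) hj ht = join
  (rank-chain T k p c (suc j) t hj (<⇒≤ ht)) (rank-chain T k p c j (suc t) (<⇒≤ hj) ht)
  (rank-chain T k p c j t (<⇒≤ hj) (<⇒≤ ht)) (p t j) refl
  where
  W : Set
  W = ∃ λ t' → ∃ λ j' → t' < suc t × j' < suc j × p t' j' ≡ true
  Cases : ℕ → Set
  Cases r = r ≡ 0 ⊎ (r ≤ 1 × W)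
  max : ∀ {a b} → Cases a → Cases b → Cases (a ⊔ b)
  max (inj₁ refl) y = y
  max (inj₂ (h , w)) (inj₁ refl) = inj₂ (⊔-lub h z≤n , w)
  max (inj₂ (h , w)) (inj₂ (h' , _)) = inj₂ (⊔-lub h h' , w)
  join : (rank p (suc j) t ≡ 0 ⊎ (rank p (suc j) t ≤ 1 × ∃ λ t' → ∃ λ j' → t' < t × j' < suc j × p t' j' ≡ true)) →
         (rank p j (suc t) ≡ 0 ⊎ (rank p j (suc t) ≤ 1 × ∃ λ t' → ∃ λ j' → t' < suc t × j' < j × p t' j' ≡ true)) →
         (rank p j t ≡ 0 ⊎ (rank p j t ≤ 1 × ∃ λ t' → ∃ λ j' → t' < t × j' < j × p t' j' ≡ true)) →
         ∀ b → p t j ≡ b → Cases (rank p (suc j) (suc t))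
  join x y z b e = max (widen₁ x) (max (widen₂ y) (corner b e z))
    where
    widen₁ : _ → Cases (rank p (suc j) t)
    widen₁ (inj₁ h) = inj₁ h
    widen₁ (inj₂ (h , t' , j' , q , q' , r)) = inj₂ (h , t' , j' , m<n⇒m<1+n q , q' , r)
    widen₂ : _ → Cases (rank p j (suc t))
    widen₂ (inj₁ h) = inj₁ h
    widen₂ (inj₂ (h , t' , j' , q , q' , r)) = inj₂ (h , t' , j' , q , m<n⇒m<1+n q' , r)
    corner : ∀ b → p t j ≡ b → _ → Cases (indicator (p t j) + rank p j t)
    corner true e (inj₁ h) rewrite e | h = inj₂ (≤-refl , t , j , ≤-refl , ≤-refl , e)
    corner true e (inj₂ (_ , t' , j' , q , q' , r)) = ⊥-elim (c q q' ht hj r e)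
    corner false e (inj₁ h) rewrite e = inj₁ h
    corner false e (inj₂ (h , t' , j' , q , q' , r)) rewrite e =
      inj₂ (h , t' , j' , m<n⇒m<1+n q , m<n⇒m<1+n q' , r)

-- A single path has rank at most 1, and rank is subadditive under unions. How the paths cross or
-- overlap is irrelevant.
rank-family : ∀ T k (ps : List (ℕ → ℕ → Bool)) → All (Chain T k) ps →
  rank (λ t j → any (λ p → p t j) ps) k T ≤ length ps
rank-family T k [] All.[] = ≤-reflexive (rank-false k T)
  where
  rank-false : ∀ j t → rank (λ _ _ → false) j t ≡ 0
  rank-false zero t = refl
  rank-false (suc j) zero = refl
  rank-false (suc j) (suc t) = cong₂ _⊔_ (rank-false (suc j) t) (cong₂ _⊔_ (rank-false j (suc t)) (rank-false j t))
rank-family T k (p ∷ ps) (c All.∷ cs) = ≤-trans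
  (rank-∨ p (λ t j → any (λ p → p t j) ps) _ (λ _ _ → refl) k T)
  (+-mono-≤ (one (rank-chain T k p c k T ≤-refl ≤-refl)) (rank-family T k ps cs))
  where
  one : ∀ {r} {W : Set} → r ≡ 0 ⊎ (r ≤ 1 × W) → r ≤ 1
  one (inj₁ refl) = z≤n
  one (inj₂ (h , _)) = h

family⇒columns : ∀ T Ls ps → All (Chain T (length Ls)) ps → ∃ λ a → ∃ λ w →
  Columns T Zero Ls a w × a T ≤ length ps × selected T (λ t j → any (λ p → p t j) ps) 0 Ls ≤ w
family⇒columns T Ls ps cs with rank-columns T (λ t j → any (λ p → p t j) ps) 0 Ls
... | w , C , h = _ , w , C , rank-family T (length Ls) ps cs , h

-- From columns to families of paths: the k-th path is the boundary of the region of height > k.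

columnAt : ∀ {T b Ls a w} → Columns T b Ls a w → ℕ → Column
columnAt {b = b} C zero = b
columnAt {b = b} none (suc j) = b
columnAt (s ◁ C) (suc j) = columnAt C j

columnAt-monotone : ∀ {T b Ls a w} (C : Columns T b Ls a w) → Monotone b → ∀ j → Monotone (columnAt C j)
columnAt-monotone C m zero = m
columnAt-monotone none m (suc j) = m
columnAt-monotone (s ◁ C) m (suc j) = columnAt-monotone C (Step.mono s) j

columnAt-above : ∀ {T b Ls a w} (C : Columns T b Ls a w) j t → columnAt C j t ≤ columnAt C (suc j) t
columnAt-above none zero t = ≤-refl
columnAt-above none (suc j) t = ≤-refl
columnAt-above (s ◁ C) zero t = Step.above s t
columnAt-above (s ◁ C) (suc j) t = columnAt-above C j t

columnAt-≤ : ∀ {T b Ls a w} (C : Columns T b Ls a w) j t → columnAt C j t ≤ a t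
columnAt-≤ C zero t = columns-above C t
columnAt-≤ none (suc j) t = ≤-refl
columnAt-≤ (s ◁ C) (suc j) t = columnAt-≤ C j t

columns-selected : ∀ {T b Ls a w} (C : Columns T b Ls a w) S i →
  (∀ t j → t < T → j < length Ls → columnAt C (suc j) (suc t) ≡ suc (columnAt C j t) → S t (i + j) ≡ true) →
  w ≤ selected T S i Ls
columns-selected none S i h = z≤n
columns-selected {T} {b} (_◁_ {g = g} {y = y} {Ls = Ls} s C) S i h = +-mono-≤ (line T ≤-refl)
  (columns-selected C S (suc i) (λ t j lt lt' e → trans (cong (S t) (sym (+-suc i j))) (h t (suc j) lt (s≤s lt') e)))
  where
  line : ∀ t → t ≤ T → coverage t y g b ≤ cum (λ t → choose (S t i) (y t)) t
  line zero le = z≤n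
  line (suc t) le = +-mono-≤ (line t (<⇒≤ le)) box
    where
    box : y t * (g (suc t) ∸ b t) ≤ choose (S t i) (y t)
    box with g (suc t) ≤? b t
    ... | yes q = uncovered (y t) q ≡≤ z≤n
    ... | no q = ≤-reflexive (trans (covered (y t) e)
        (cong (λ z → choose z (y t)) (sym (trans (cong (S t) (sym (+-identityʳ i))) (h t 0 le (s≤s z≤n) e)))))
      where e = ≤-antisym (Step.near s t) (≰⇒> q)

Next : ℕ × ℕ → ℕ × ℕ → Set
Next (t , j) (t' , j') = (t' ≡ suc t × j' ≡ j) ⊎ (t' ≡ t × j ≡ suc j')

InGrid : ℕ → ℕ → ℕ × ℕ → Set
InGrid T k (t , j) = t < T × j < k

GridPath : ℕ → ℕ → List (ℕ × ℕ) → Set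
GridPath T k P = Linked Next P × All (InGrid T k) P

-- `r` rows and `j` columns remain. At the border the move is forced, so every walk ends in the
-- opposite corner and has the same number of boxes.
module Walk (right : ℕ → ℕ → Bool) where
  walk walkTail : (r j t : ℕ) → List (ℕ × ℕ)
  walk r j t = (t , j) ∷ walkTail r j t
  walkTail zero zero t = []
  walkTail zero (suc j) t = walk zero j t
  walkTail (suc r) zero t = walk r zero (suc t)
  walkTail (suc r) (suc j) t = if right t (suc j) then walk (suc r) j t else walk r (suc j) (suc t)

  walk-linked : ∀ r j t → Linked Next (walk r j t)
  walk-linked zero zero t = [-]
  walk-linked zero (suc j) t = inj₂ (refl , refl) Linked.∷ walk-linked zero j t
  walk-linked (suc r) zero t = inj₁ (refl , refl) Linked.∷ walk-linked r zero (suc t)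
  walk-linked (suc r) (suc j) t with right t (suc j)
  ... | true = inj₂ (refl , refl) Linked.∷ walk-linked (suc r) j t
  ... | false = inj₁ (refl , refl) Linked.∷ walk-linked r (suc j) (suc t)

  walk-inGrid : ∀ r j t {T k} → t + r < T → j < k → All (InGrid T k) (walk r j t)
  walk-inGrid r j t {T} {k} h h' = (≤-trans (s≤s (m≤m+n t r)) h , h') All.∷ tail r j h h'
    where
    tail : ∀ r j → t + r < T → j < k → All (InGrid T k) (walkTail r j t)
    tail zero zero h h' = All.[]
    tail zero (suc j) h h' = walk-inGrid zero j t h (<⇒≤ h')
    tail (suc r) zero h h' = walk-inGrid r zero (suc t) (subst (_< T) (+-suc t r) h) h'
    tail (suc r) (suc j) h h' with right t (suc j)
    ... | true = walk-inGrid (suc r) j t h (<⇒≤ h')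
    ... | false = walk-inGrid r (suc j) (suc t) (subst (_< T) (+-suc t r) h) h'

  walk-length : ∀ r j t → length (walk r j t) ≡ suc (r + j)
  walk-length zero zero t = refl
  walk-length zero (suc j) t = cong suc (walk-length zero j t)
  walk-length (suc r) zero t = cong suc (walk-length r zero (suc t))
  walk-length (suc r) (suc j) t with right t (suc j)
  ... | true = cong suc (trans (walk-length (suc r) j t) (cong suc (sym (+-suc r j))))
  ... | false = cong suc (walk-length r (suc j) (suc t))

module _ (col : ℕ → Column) (monotone : ∀ j → Monotone (col j)) (above : ∀ j t → col j t ≤ col (suc j) t) (lev : ℕ) where
  open Walk (λ t j → lev <ᵇ col j (suc t))

  private
    above-≤ : ∀ {i j} t → i ≤ j → col i t ≤ col j t
    above-≤ t h = monotone-≤ {λ j → col j t} (λ j → above j t) h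

  -- The walk cannot miss the box. In row t' it does not turn down before reaching column j', since
  -- heights grow with the column index; in column j' it does not turn right above row t', since the
  -- height there is still at most `lev`.
  walk-covers : ∀ r j t t' j' → t ≤ t' → t' ≤ t + r → j' ≤ j → col j' t' ≤ lev → lev < col (suc j') (suc t') →
    (t' , j') ∈ walk r j t
  walk-covers r j t t' j' h₁ h₂ h₃ low high with t' ≟ t | j' ≟ j
  ... | yes refl | yes refl = here refl
  ... | yes refl | no nj = there (sideways r j (≤∧≢⇒< h₃ nj))
    where
    sideways : ∀ r j → j' < j → (t , j') ∈ walkTail r j t
    sideways zero (suc j) lt = walk-covers zero j t t j' ≤-refl (m≤m+n t 0) (s≤s⁻¹ lt) low high
    sideways (suc r) (suc j) lt with lev <ᵇ col (suc j) (suc t) in e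
    ... | true = walk-covers (suc r) j t t j' ≤-refl (m≤m+n t _) (s≤s⁻¹ lt) low high
    ... | false = ⊥-elim (subst Bool.T e (<⇒<ᵇ (≤-trans high (above-≤ (suc t) lt))))
  ... | no nt | _ = there (downwards r j h₂ h₃)
    where
    t< = ≤∧≢⇒< h₁ (λ e → nt (sym e))
    downwards : ∀ r j → t' ≤ t + r → j' ≤ j → (t' , j') ∈ walkTail r j t
    downwards zero j q _ = ⊥-elim (<⇒≱ t< (q ≤≡ +-identityʳ t))
    downwards (suc r) zero q q' = walk-covers r zero (suc t) t' j' t< (q ≤≡ +-suc t r) q' low high
    downwards (suc r) (suc j) q q' with lev <ᵇ col (suc j) (suc t) in e
    ... | false = walk-covers r (suc j) (suc t) t' j' t< (q ≤≡ +-suc t r) q' low high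
    ... | true with j' ≟ suc j
    ...   | no nj = walk-covers (suc r) j t t' j' h₁ q (s≤s⁻¹ (≤∧≢⇒< q' nj)) low high
    ...   | yes refl = ⊥-elim (<⇒≱ (<ᵇ⇒< lev _ (subst Bool.T (sym e) _)) (≤-trans (monotone-≤ {col (suc j)} (monotone (suc j)) t<) low))

gridWalk : ℕ → ℕ → (ℕ → ℕ → Bool) → List (ℕ × ℕ)
gridWalk zero k right = []
gridWalk (suc T) zero right = []
gridWalk (suc T) (suc k) right = Walk.walk right T k 0

gridWalk-path : ∀ T k right → GridPath T k (gridWalk T k right)
gridWalk-path zero k right = Linked.[] , All.[]
gridWalk-path (suc T) zero right = Linked.[] , All.[]
gridWalk-path (suc T) (suc k) right = Walk.walk-linked right T k 0 , Walk.walk-inGrid right T k 0 ≤-refl ≤-refl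

gridWalk-length : ∀ T k right → length (gridWalk (suc T) (suc k) right) ≡ suc (T + k)
gridWalk-length T k right = Walk.walk-length right T k 0

columnPaths : ∀ {T Ls a w} → Columns T Zero Ls a w → ℕ → List (List (ℕ × ℕ))
columnPaths {T} {Ls} C l = map (λ lev → gridWalk T (length Ls) (λ t j → lev <ᵇ columnAt C j (suc t))) (upTo l)

columnPaths-cover : ∀ {T Ls a w} (C : Columns T Zero Ls a w) l → a T ≤ l → ∀ t j → t < T → j < length Ls →
  columnAt C (suc j) (suc t) ≡ suc (columnAt C j t) → ∃ λ P → P ∈ columnPaths C l × (t , j) ∈ P
columnPaths-cover {T} {Ls} {a} C l h t j lt lt' e = _ , ∈-map⁺ path (∈-upTo⁺ bound) , covers T (length Ls) lt lt'
  where
  lev = columnAt C j t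
  right = λ t j → lev <ᵇ columnAt C j (suc t)
  path = λ lev → gridWalk T (length Ls) (λ t j → lev <ᵇ columnAt C j (suc t))
  bound : lev < l
  bound = sym e ≡≤ (≤-trans (columnAt-≤ C (suc j) (suc t))
    (≤-trans (monotone-≤ {a} (columns-monotone (λ _ → z≤n) C) lt) h))
  covers : ∀ T k → t < T → j < k → (t , j) ∈ gridWalk T k right
  covers (suc T) (suc k) lt lt' = walk-covers (columnAt C) (columnAt-monotone C (λ _ → z≤n)) (columnAt-above C) lev
    T k 0 t j z≤n (s≤s⁻¹ lt) (s≤s⁻¹ lt') ≤-refl (≤-reflexive (sym e))

-- Grids with labelled rows and columns; the columns are listed from the last to the first.

Unique-↭ : {xs ys : List ℕ} → xs ↭ ys → Unique xs → Unique ys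
Unique-↭ p = PermSetoid.Unique-resp-↭ (setoid ℕ) (↭⇒↭ₛ p)

at-∈ : ∀ xs {i} → i < length xs → at xs i ∈ xs
at-∈ (x ∷ xs) {zero} lt = here refl
at-∈ (x ∷ xs) {suc i} (s≤s lt) = there (at-∈ xs lt)

at-injective : ∀ {xs} → Unique xs → ∀ {i j} → i < length xs → j < length xs → at xs i ≡ at xs j → i ≡ j
at-injective {x ∷ xs} u {zero} {zero} lt lt' e = refl
at-injective {x ∷ xs} (p AllPairs.∷ u) {zero} {suc j} lt (s≤s lt') e = ⊥-elim (All.lookup p (at-∈ xs lt') e)
at-injective {x ∷ xs} (p AllPairs.∷ u) {suc i} {zero} (s≤s lt) lt' e = ⊥-elim (All.lookup p (at-∈ xs lt) (sym e))
at-injective {x ∷ xs} (p AllPairs.∷ u) {suc i} {suc j} (s≤s lt) (s≤s lt') e = cong suc (at-injective u lt lt' e)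

at-++ˡ : ∀ xs ys {i} → i < length xs → at (xs ++ ys) i ≡ at xs i
at-++ˡ (x ∷ xs) ys {zero} lt = refl
at-++ˡ (x ∷ xs) ys {suc i} (s≤s lt) = at-++ˡ xs ys lt

at-++ʳ : ∀ xs ys i → at (xs ++ ys) (length xs + i) ≡ at ys i
at-++ʳ [] ys i = refl
at-++ʳ (x ∷ xs) ys i = at-++ʳ xs ys i

at-∷ʳ : ∀ xs (x : ℕ) → at (xs ∷ʳ x) (length xs) ≡ x
at-∷ʳ xs x = trans (cong (at (xs ∷ʳ x)) (sym (+-identityʳ (length xs)))) (at-++ʳ xs (x ∷ []) 0)

length-∷ʳ : ∀ {A : Set} (xs : List A) x → length (xs ∷ʳ x) ≡ suc (length xs)
length-∷ʳ xs x = trans (length-++ xs) (+-comm (length xs) 1)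

at-reverse : ∀ xs {i} → i < length xs → at (reverse xs) i ≡ at xs (length xs ∸ suc i)
at-reverse (x ∷ xs) {i} lt rewrite unfold-reverse x xs with m≤n⇒m<n∨m≡n (s≤s⁻¹ lt)
... | inj₁ i< = trans (at-++ˡ (reverse xs) _ (i< ≤≡ sym (length-reverse xs)))
        (trans (at-reverse xs i<) (cong (at (x ∷ xs)) (sym (+-∸-assoc 1 i<))))
... | inj₂ refl = trans (cong (at (reverse xs ∷ʳ x)) (sym (length-reverse xs)))
        (trans (at-∷ʳ (reverse xs) x) (cong (at (x ∷ xs)) (sym (n∸n≡0 (length xs)))))

any-true : ∀ {A : Set} (f : A → Bool) {xs x} → x ∈ xs → f x ≡ true → any f xs ≡ true
any-true f {y ∷ ys} (here refl) e rewrite e = refl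
any-true f {y ∷ ys} (there m) e with f y
... | true = refl
... | false = any-true f m e

any-witness : ∀ {A : Set} (f : A → Bool) xs → any f xs ≡ true → ∃ λ x → x ∈ xs × f x ≡ true
any-witness f (x ∷ xs) e with f x in q
... | true = x , here refl , q
... | false with any-witness f xs e
...   | y , m , r = y , there m , r

≡⇒T : ∀ {b} → b ≡ true → Bool.T b
≡⇒T refl = tt

T⇒≡ : ∀ {b} → Bool.T b → b ≡ true
T⇒≡ {true} _ = refl

≡ᵇ-true : ∀ a b → (a ≡ᵇ b) ≡ true → a ≡ b
≡ᵇ-true a b e = ≡ᵇ⇒≡ a b (≡⇒T e)

≡ᵇ-≡ : ∀ {a b} → a ≡ b → (a ≡ᵇ b) ≡ true
≡ᵇ-≡ {a} {b} e = T⇒≡ (≡⇒≡ᵇ a b e)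

≡ᵇ-refl : ∀ a → (a ≡ᵇ a) ≡ true
≡ᵇ-refl a = ≡ᵇ-≡ {a} refl

∧-true : ∀ {a b} → a ∧ b ≡ true → a ≡ true × b ≡ true
∧-true {true} {true} e = refl , refl

eqV-true : ∀ {u v} → eqV u v ≡ true → u ≡ v
eqV-true {a , b} {a' , b'} e = cong₂ _,_ (≡ᵇ-true a a' (proj₁ (∧-true e))) (≡ᵇ-true b b' (proj₂ (∧-true {a ≡ᵇ a'} e)))

eqV-refl : ∀ u → eqV u u ≡ true
eqV-refl (a , b) = cong₂ _∧_ (≡ᵇ-refl a) (≡ᵇ-refl b)

onPath : List Vertex → ℕ → ℕ → Bool
onPath p r e = any (eqV (r , e)) p

onSome : List (List Vertex) → ℕ → ℕ → Bool
onSome tup r e = any (λ p → onPath p r e) tup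

gridLines : (ℕ → ℕ → ℕ) → List ℕ → List ℕ → List Line
gridLines F R C = map (λ e t → F (at R t) e) C

gridSum : List ℕ → List ℕ → (ℕ → ℕ → ℕ) → ℕ
gridSum R C φ = sum (map (λ e → sum (map (λ r → φ r e) R)) C)

gridSum-↭ : ∀ {R R' C C'} φ → R ↭ R' → C ↭ C' → gridSum R C φ ≡ gridSum R' C' φ
gridSum-↭ {C' = C'} φ p q = trans (sum-↭ (Perm.map⁺ _ q)) (cong sum (map-cong (λ e → sum-↭ (Perm.map⁺ _ p)) C'))

cum-at : ∀ (φ : ℕ → ℕ) R → cum (λ t → φ (at R t)) (length R) ≡ sum (map φ R)
cum-at φ [] = refl
cum-at φ (r ∷ R) = trans (cum-shift (λ t → φ (at (r ∷ R) t)) (length R)) (cong (φ r +_) (cum-at φ R))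

cum-cong : ∀ {f g : ℕ → ℕ} k → (∀ t → f t ≡ g t) → cum f k ≡ cum g k
cum-cong zero h = refl
cum-cong (suc k) h = cong₂ _+_ (cum-cong k h) (h k)

selected-gridSum : ∀ F R C (s : ℕ → ℕ → Bool) S i → (∀ t j → S t (i + j) ≡ s (at R t) (at C j)) →
  selected (length R) S i (gridLines F R C) ≡ gridSum R C (λ r e → choose (s r e) (F r e))
selected-gridSum F R [] s S i h = refl
selected-gridSum F R (e ∷ C) s S i h = cong₂ _+_
  (trans (cum-cong (length R) (λ t → cong (λ z → choose z (F (at R t) e))
            (trans (cong (S t) (sym (+-identityʳ i))) (h t 0))))
    (cum-at (λ r → choose (s r e) (F r e)) R))
  (selected-gridSum F R C s S (suc i) (λ t j → trans (cong (S t) (sym (+-suc i j))) (h t (suc j))))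

LabelChain : List ℕ → List ℕ → List Vertex → Set
LabelChain R C p = Chain (length R) (length C) (λ t j → onPath p (at R t) (at C j))

label : List ℕ → List ℕ → ℕ × ℕ → Vertex
label R C (t , j) = at R t , at C j

linked-Next : ∀ {u P v} → Linked Next (u ∷ P) → v ∈ P → proj₁ u ≤ proj₁ v × proj₂ v ≤ proj₂ u
linked-Next {u} (h Linked.∷ l) (here refl) = step h
  where
  step : ∀ {u v} → Next u v → proj₁ u ≤ proj₁ v × proj₂ v ≤ proj₂ u
  step (inj₁ (refl , refl)) = n≤1+n _ , ≤-refl
  step (inj₂ (refl , refl)) = ≤-refl , n≤1+n _
linked-Next {u} (h Linked.∷ l) (there m) = below h (linked-Next l m)
  where
  below : ∀ {u w v} → Next u w → proj₁ w ≤ proj₁ v × proj₂ v ≤ proj₂ w → proj₁ u ≤ proj₁ v × proj₂ v ≤ proj₂ u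
  below (inj₁ (refl , refl)) (p , q) = <⇒≤ p , q
  below (inj₂ (refl , refl)) (p , q) = p , m≤n⇒m≤1+n q

linked-chain : ∀ {P t j t' j'} → Linked Next P → (t , j) ∈ P → (t' , j') ∈ P → t < t' → j < j' → ⊥
linked-chain l (here refl) (here refl) h h' = <-irrefl refl h
linked-chain l (here refl) (there m) h h' = <⇒≱ h' (proj₂ (linked-Next l m))
linked-chain l (there m) (here refl) h h' = <⇒≱ h (proj₁ (linked-Next l m))
linked-chain (_ Linked.∷ l) (there m) (there m') h h' = linked-chain l m m' h h'

module _ {R C : List ℕ} (uR : Unique R) (uC : Unique C) where
  onPath-position : ∀ {P} → All (InGrid (length R) (length C)) P → ∀ {t j} → t < length R → j < length C →
    onPath (map (label R C) P) (at R t) (at C j) ≡ true → (t , j) ∈ P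
  onPath-position {P} g {t} {j} lt lt' e with any-witness (eqV (at R t , at C j)) (map (label R C) P) e
  ... | v , m , q with ∈-map⁻ (label R C) m
  ...   | (t' , j') , m' , refl = subst (_∈ P) (sym (cong₂ _,_
          (at-injective uR lt (proj₁ (All.lookup g m')) (cong proj₁ (eqV-true {at R t , at C j} {at R t' , at C j'} q)))
          (at-injective uC lt' (proj₂ (All.lookup g m')) (cong proj₂ (eqV-true {at R t , at C j} {at R t' , at C j'} q))))) m'

  path-chain : ∀ {P} → GridPath (length R) (length C) P → LabelChain R C (map (label R C) P)
  path-chain (l , g) h h' lt lt' e e' = linked-chain l (onPath-position g (<-trans h lt) (<-trans h' lt') e)
    (onPath-position g lt lt' e') h h'

  -- Reversing both orders exchanges the two boxes of a forbidden pair and forbids the same pairs.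
  path-chain-reverse : ∀ {P} → GridPath (length R) (length C) P → LabelChain (reverse R) (reverse C) (map (label R C) P)
  path-chain-reverse {P} g {t} {j} {t'} {j'} h h' lt lt' e e' =
    path-chain g (∸-monoʳ-< (s≤s h) rt') (∸-monoʳ-< (s≤s h') rj')
      (∸-monoʳ-< {o = 0} (s≤s z≤n) (<-trans h rt')) (∸-monoʳ-< {o = 0} (s≤s z≤n) (<-trans h' rj'))
      (trans (cong₂ (onPath (map (label R C) P)) (sym (at-reverse R rt')) (sym (at-reverse C rj'))) e')
      (trans (cong₂ (onPath (map (label R C) P)) (sym (at-reverse R (<-trans h rt'))) (sym (at-reverse C (<-trans h' rj')))) e)
    where
    rt' : t' < length R
    rt' = lt ≤≡ length-reverse R
    rj' : j' < length C
    rj' = lt' ≤≡ length-reverse C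

paths⇒columns : ∀ F R C tup → All (LabelChain R C) tup → ∃ λ a → ∃ λ w →
  Columns (length R) Zero (gridLines F R C) a w × a (length R) ≤ length tup ×
  gridSum R C (λ r e → choose (onSome tup r e) (F r e)) ≤ w
paths⇒columns F R C tup cs with family⇒columns (length R) (gridLines F R C)
    (map (λ p t j → onPath p (at R t) (at C j)) tup) (chains tup cs)
  where
  chains : ∀ tup → All (LabelChain R C) tup →
    All (Chain (length R) (length (gridLines F R C))) (map (λ p t j → onPath p (at R t) (at C j)) tup)
  chains [] All.[] = All.[]
  chains (p ∷ tup) (c All.∷ cs) =
    (λ h h' lt lt' → c h h' lt (lt' ≤≡ length-map (λ e t → F (at R t) e) C)) All.∷ chains tup cs
... | a , w , K , h , h' = a , w , K , h ≤≡ (length-map _ tup) ,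
  sym (selected-gridSum F R C (onSome tup) _ 0 (λ t j → any-map tup t j)) ≡≤ h'
  where
  any-map : ∀ tup t j → any (λ p → p t j) (map (λ p t j → onPath p (at R t) (at C j)) tup) ≡ onSome tup (at R t) (at C j)
  any-map [] t j = refl
  any-map (p ∷ tup) t j = cong (onPath p (at R t) (at C j) ∨_) (any-map tup t j)

IsWalk : ℕ → ℕ → List (ℕ × ℕ) → Set
IsWalk T k P = ∃ λ right → P ≡ gridWalk T k right

columns⇒paths : ∀ F R C {a w} → Columns (length R) Zero (gridLines F R C) a w → ∀ l → a (length R) ≤ l →
  ∃ λ Ps → length Ps ≡ l × All (IsWalk (length R) (length C)) Ps ×
  w ≤ gridSum R C (λ r e → choose (onSome (map (map (label R C)) Ps) r e) (F r e))
columns⇒paths F R C {a} {w} K l h = Ps , trans (length-map _ (upTo l)) (length-upTo l) , walks (upTo l) ,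
  (columns-selected K (λ t j → onSome tup (at R t) (at C j)) 0 covered?)
    ≤≡ (selected-gridSum F R C (onSome tup) _ 0 (λ _ _ → refl))
  where
  Ps = columnPaths K l
  tup = map (map (label R C)) Ps
  k≡ : length (gridLines F R C) ≡ length C
  k≡ = length-map (λ e t → F (at R t) e) C
  walks : ∀ levs → All (IsWalk (length R) (length C))
    (map (λ lev → gridWalk (length R) (length (gridLines F R C)) (λ t j → lev <ᵇ columnAt K j (suc t))) levs)
  walks [] = All.[]
  walks (lev ∷ levs) = (_ , cong (λ k → gridWalk (length R) k (λ t j → lev <ᵇ columnAt K j (suc t))) k≡) All.∷ walks levs
  covered? : ∀ t j → t < length R → j < length (gridLines F R C) →
    columnAt K (suc j) (suc t) ≡ suc (columnAt K j t) → onSome tup (at R t) (at C j) ≡ true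
  covered? t j lt lt' e with columnPaths-cover K l h t j lt lt' e
  ... | P , m , m' = any-true (λ p → onPath p (at R t) (at C j)) (∈-map⁺ (map (label R C)) m)
        (any-true (eqV (at R t , at C j)) (∈-map⁺ (label R C) m') (eqV-refl (at R t , at C j)))

isWalk-path : ∀ {T k P} → IsWalk T k P → GridPath T k P
isWalk-path (right , refl) = gridWalk-path _ _ right

gridShape : (ℕ → ℕ → ℕ) → List ℕ → List ℕ → Seq
gridShape F R C = shape (length R) (gridLines F R C)

-- Reversing both orders reverses the paths.
reverse-≼ : ∀ F {R C} → Unique R → Unique C →
  gridLines F R C ≼[ length R , length (reverse R) ] gridLines F (reverse R) (reverse C)
reverse-≼ F {R} {C} uR uC .dominate {a} K with columns⇒paths F R C K (a (length R)) ≤-refl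
... | Ps , len , walks , h with paths⇒columns F (reverse R) (reverse C) (map (map (label R C)) Ps) (chains walks)
  where
  chains : ∀ {Ps} → All (IsWalk (length R) (length C)) Ps → All (LabelChain (reverse R) (reverse C)) (map (map (label R C)) Ps)
  chains All.[] = All.[]
  chains (w All.∷ ws) = path-chain-reverse uR uC (isWalk-path w) All.∷ chains ws
...   | a' , w' , K' , h' , h'' = a' , w' , h' ≤≡ trans (length-map _ Ps) len ,
  ≤-trans h ((gridSum-↭ {R} {reverse R} {C} {reverse C} _ (↭-sym (↭-reverse R)) (↭-sym (↭-reverse C))) ≡≤ h'') , K'

gridShape-reverse : ∀ F {R C} → Unique R → Unique C → gridShape F R C ≗ gridShape F (reverse R) (reverse C)
gridShape-reverse F {R} {C} uR uC = shape-unique (reverse-≼ F uR uC)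
  (subst₂ (λ X Y → gridLines F (reverse R) (reverse C) ≼[ length (reverse R) , length X ] gridLines F X Y)
    (reverse-involutive R) (reverse-involutive C)
    (reverse-≼ F (Unique-↭ (↭-sym (↭-reverse R)) uR) (Unique-↭ (↭-sym (↭-reverse C)) uC)))

-- Adding a row and a column at the ends of a labelled grid

columns-cong : ∀ {T b a w} {f g : ℕ → Line} C → (∀ e t → t < T → f e t ≡ g e t) →
  Columns T b (map f C) a w → Columns T b (map g C) a w
columns-cong [] h none = none
columns-cong {T} {b} {a} {g = g} (e ∷ C) h (_◁_ {g = c} {w = w} s K) =
  subst (Columns T b (map g (e ∷ C)) a) (cong (_+ w) (coverage-cong T {g = c} {b} (λ t lt → sym (h e t lt))))
    (s ◁ columns-cong C h K)

gridShape-prefix : ∀ F R r C → shape (length R) (gridLines F (R ∷ʳ r) C) ≗ gridShape F R C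
gridShape-prefix F R r C = shape-unique
  (record { dominate = λ K → _ , _ , ≤-refl , ≤-refl , columns-cong C (λ e t lt → cong (λ z → F z e) (at-++ˡ R (r ∷ []) lt)) K })
  (record { dominate = λ K → _ , _ , ≤-refl , ≤-refl , columns-cong C (λ e t lt → cong (λ z → F z e) (sym (at-++ˡ R (r ∷ []) lt))) K })

corner-last : ∀ F R r e C →
  RSKRule (gridShape F R C) (gridShape F R (e ∷ C)) (gridShape F (R ∷ʳ r) C) (F r e) (gridShape F (R ∷ʳ r) (e ∷ C))
corner-last F R r e C = Local-resp rsk (gridShape-prefix F R r C) (gridShape-prefix F R r (e ∷ C))
  (λ i → cong (λ T → shape T (gridLines F (R ∷ʳ r) C) i) (sym (length-∷ʳ R r)))
  (cong (λ z → F z e) (at-∷ʳ R r))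
  (λ i → cong (λ T → shape T (gridLines F (R ∷ʳ r) (e ∷ C)) i) (sym (length-∷ʳ R r)))
  (shape-last (λ t → F (at (R ∷ʳ r) t) e) (gridLines F (R ∷ʳ r) C) (length R))

corner-first : ∀ F R r e C →
  BurgeRule (gridShape F R C) (gridShape F R (C ∷ʳ e)) (gridShape F (R ∷ʳ r) C) (F r e) (gridShape F (R ∷ʳ r) (C ∷ʳ e))
corner-first F R r e C = Local-resp burge (gridShape-prefix F R r C)
  (λ i → trans (cong (λ Ls → shape (length R) Ls i) (sym snoc≡)) (gridShape-prefix F R r (C ∷ʳ e) i))
  (λ i → cong (λ T → shape T (gridLines F (R ∷ʳ r) C) i) (sym (length-∷ʳ R r)))
  (cong (λ z → F z e) (at-∷ʳ R r))
  (λ i → cong₂ (λ T Ls → shape T Ls i) (sym (length-∷ʳ R r)) (sym snoc≡))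
  (shape-first (λ t → F (at (R ∷ʳ r) t) e) (gridLines F (R ∷ʳ r) C) (length R))
  where
  snoc≡ : gridLines F (R ∷ʳ r) (C ∷ʳ e) ≡ gridLines F (R ∷ʳ r) C ∷ʳ (λ t → F (at (R ∷ʳ r) t) e)
  snoc≡ = map-++ _ C (e ∷ [])

-- Since columns are listed from the last to the first, `true` adds a last row but a first column.
extend : Bool → ℕ → List ℕ → List ℕ
extend true x xs = xs ∷ʳ x
extend false x xs = x ∷ xs

-- RSK where the new row and the new column are both last or both first, Burge where one is first
-- and the other last.
cornerRule : Bool → Bool → Rule
cornerRule true true = burge
cornerRule true false = rsk
cornerRule false true = rsk
cornerRule false false = burge

reverse-∷ʳ : ∀ xs (x : ℕ) → reverse (xs ∷ʳ x) ≡ x ∷ reverse xs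
reverse-∷ʳ xs x = reverse-++ xs (x ∷ [])

gridShape-corner : ∀ F p q r e R C → Unique (extend p r R) → Unique (extend q e C) → Unique R → Unique C →
  Local (cornerRule p q) (gridShape F R C) (gridShape F R (extend q e C)) (gridShape F (extend p r R) C) (F r e)
    (gridShape F (extend p r R) (extend q e C))
gridShape-corner F true true r e R C _ _ _ _ = corner-first F R r e C
gridShape-corner F true false r e R C _ _ _ _ = corner-last F R r e C
-- A new first row becomes a last row when both orders are reversed, and the shapes do not change;
-- so the cases of a last row suffice.
gridShape-corner F false true r e R C uR' uC' uR uC = Local-resp rsk
  (λ i → sym (gridShape-reverse F uR uC i))
  (λ i → trans (cong (λ Z → gridShape F (reverse R) Z i) (sym (reverse-∷ʳ C e))) (sym (gridShape-reverse F uR uC' i)))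
  (λ i → trans (cong (λ Z → gridShape F Z (reverse C) i) (sym (unfold-reverse r R))) (sym (gridShape-reverse F uR' uC i)))
  refl
  (λ i → trans (cong₂ (λ Y Z → gridShape F Y Z i) (sym (unfold-reverse r R)) (sym (reverse-∷ʳ C e))) (sym (gridShape-reverse F uR' uC' i)))
  (corner-last F (reverse R) r e (reverse C))
gridShape-corner F false false r e R C uR' uC' uR uC = Local-resp burge
  (λ i → sym (gridShape-reverse F uR uC i))
  (λ i → trans (cong (λ Z → gridShape F (reverse R) Z i) (sym (unfold-reverse e C))) (sym (gridShape-reverse F uR uC' i)))
  (λ i → trans (cong (λ Z → gridShape F Z (reverse C) i) (sym (unfold-reverse r R))) (sym (gridShape-reverse F uR' uC i)))
  refl
  (λ i → trans (cong₂ (λ Y Z → gridShape F Y Z i) (sym (unfold-reverse r R)) (sym (unfold-reverse e C))) (sym (gridShape-reverse F uR' uC' i)))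
  (corner-first F (reverse R) r e (reverse C))

-- The orders of the rows and columns, given the end at which each label is added

rowsAt : (ℕ → Bool) → ℕ → List ℕ
rowsAt σ zero = []
rowsAt σ (suc b) = extend (σ (suc b)) (suc b) (rowsAt σ b)

colsFrom : (ℕ → Bool) → ℕ → ℕ → List ℕ
colsFrom σ zero e = []
colsFrom σ (suc d) e = extend (σ e) e (colsFrom σ d (suc e))

colsAt : (ℕ → Bool) → ℕ → ℕ → List ℕ
colsAt σ n e = colsFrom σ (suc n ∸ e) e

colsAt-suc : ∀ σ {n e} → e ≤ n → colsAt σ n e ≡ extend (σ e) e (colsAt σ n (suc e))
colsAt-suc σ {n} {e} h = cong (λ d → colsFrom σ d e) (+-∸-assoc 1 h)

colsAt-end : ∀ σ n → colsAt σ n (suc n) ≡ []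
colsAt-end σ n = cong (λ d → colsFrom σ d (suc n)) (n∸n≡0 n)

extend-↭ : ∀ p x xs → extend p x xs ↭ x ∷ xs
extend-↭ true x xs = ↭-sym (∷↭∷ʳ x xs)
extend-↭ false x xs = ↭-refl

rowsAt-↭ : ∀ σ b → rowsAt σ b ↭ applyUpTo suc b
rowsAt-↭ σ zero = ↭-refl
rowsAt-↭ σ (suc b) = ↭-trans (extend-↭ (σ (suc b)) (suc b) _) (↭-trans (∷↭∷ʳ (suc b) _)
  (↭-trans (Perm.++⁺ʳ (suc b ∷ []) (rowsAt-↭ σ b)) (↭-reflexive (applyUpTo-∷ʳ suc b))))

colsFrom-↭ : ∀ σ d e (f : ℕ → ℕ) → (∀ i → f i ≡ e + i) → colsFrom σ d e ↭ applyUpTo f d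
colsFrom-↭ σ zero e f h = ↭-refl
colsFrom-↭ σ (suc d) e f h = ↭-trans (extend-↭ (σ e) e _)
  (↭-trans (↭-reflexive (cong (_∷ colsFrom σ d (suc e)) (sym (trans (h 0) (+-identityʳ e)))))
    (Perm.++⁺ˡ (f 0 ∷ []) (colsFrom-↭ σ d (suc e) (λ i → f (suc i)) (λ i → trans (h (suc i)) (+-suc e i)))))

rowsAt-unique : ∀ σ b → Unique (rowsAt σ b)
rowsAt-unique σ b = Unique-↭ (↭-sym (rowsAt-↭ σ b))
  (UniqueProps.applyUpTo⁺₁ suc b (λ i<j _ e → <⇒≢ i<j (suc-injective e)))

colsAt-unique : ∀ σ n e → Unique (colsAt σ n e)
colsAt-unique σ n e = Unique-↭ (↭-sym (colsFrom-↭ σ (suc n ∸ e) e (e +_) (λ _ → refl)))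
  (UniqueProps.applyUpTo⁺₁ (e +_) (suc n ∸ e) (λ i<j _ q → <⇒≢ i<j (+-cancelˡ-≡ e _ _ q)))

rowsAt-≤ : ∀ σ b {x} → x ∈ rowsAt σ b → x ≤ b
rowsAt-≤ σ b m with ∈-applyUpTo⁻ suc (Perm.∈-resp-↭ (rowsAt-↭ σ b) m)
... | i , lt , refl = lt

colsAt-≥ : ∀ σ n e {x} → x ∈ colsAt σ n e → e ≤ x
colsAt-≥ σ n e m with ∈-applyUpTo⁻ (e +_) (Perm.∈-resp-↭ (colsFrom-↭ σ (suc n ∸ e) e (e +_) (λ _ → refl)) m)
... | i , lt , refl = m≤m+n e i

rowsAt-length : ∀ σ b → length (rowsAt σ b) ≡ b
rowsAt-length σ b = trans (↭-length (rowsAt-↭ σ b)) (length-applyUpTo suc b)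

colsAt-length : ∀ σ n e → length (colsAt σ n e) ≡ suc n ∸ e
colsAt-length σ n e = trans (↭-length (colsFrom-↭ σ (suc n ∸ e) e (e +_) (λ _ → refl))) (length-applyUpTo (e +_) (suc n ∸ e))

shapeAt : (ℕ → Bool) → ℕ → (ℕ → ℕ → ℕ) → ℕ → ℕ → Seq
shapeAt σ n F b e = gridShape F (rowsAt σ b) (colsAt σ n e)

part-zero : ∀ Ls k → part Ls 0 k ≡ 0
part-zero [] k = refl
part-zero (y ∷ Ls) zero = refl
part-zero (y ∷ Ls) (suc k) = part-zero Ls k

module _ (side : ℕ → Bool) (n : ℕ) (B? E? : ℕ → Bool) (cB cE : ℕ → ℕ)
  (stepB : ∀ b → cB (suc b) ≡ (if B? (suc b) then suc (cB b) else cB b))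
  (stepE : ∀ e → cE (suc e) ≡ (if E? (suc e) then suc (cE (suc (suc e))) else cE (suc (suc e))))
  where
  open Growth (λ b e → cornerRule (side b) (side e)) n B? E? cB cE stepB stepE

  shapeAt-growth : ∀ F → IsGrowth F (shapeAt side n F)
  shapeAt-growth F = record
    { top = λ e i → part-zero (melon (gridLines F [] (colsAt side n e))) i
    ; right = λ b i → cong (λ C → gridShape F (rowsAt side b) C i) (colsAt-end side n)
    ; local = local }
    where
    local : ∀ b e → suc b < e → e ≤ n → Local (cornerRule (side (suc b)) (side e)) (shapeAt side n F b (suc e)) (shapeAt side n F b e)
      (shapeAt side n F (suc b) (suc e)) (F (suc b) e) (shapeAt side n F (suc b) e)
    local b e lt le = subst
      (λ C → Local (cornerRule (side (suc b)) (side e)) (shapeAt side n F b (suc e)) (gridShape F (rowsAt side b) C)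
        (shapeAt side n F (suc b) (suc e)) (F (suc b) e) (gridShape F (rowsAt side (suc b)) C))
      (sym (colsAt-suc side le))
      (gridShape-corner F (side (suc b)) (side e) (suc b) e (rowsAt side b) (colsAt side n (suc e))
        (rowsAt-unique side (suc b)) (subst Unique (colsAt-suc side le) (colsAt-unique side n e))
        (rowsAt-unique side b) (colsAt-unique side n (suc e)))

-- Coxeter elements as cycles

Steps : (ℕ → ℕ) → ℕ → List ℕ → ℕ → Set
Steps c a [] z = c a ≡ z
Steps c a (b ∷ bs) z = c a ≡ b × Steps c b bs z

Steps-∷ʳ : ∀ {c c' a a' N z} L → (∀ x → x ∈ L → c' x ≡ c x) → c' a' ≡ c a → Steps c a L N → c' N ≡ z → Steps c' a' (L ∷ʳ N) z
Steps-∷ʳ [] h e s e' = trans e s , e'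
Steps-∷ʳ (b ∷ L) h e (p , s) e' = trans e p , Steps-∷ʳ L (λ x m → h x (there m)) (h b (here refl)) s e'

Steps-retarget : ∀ {c c' a N z} L → (∀ x → x ≡ a ⊎ x ∈ L → c x ≡ N → c' x ≡ z) →
  (∀ x → x ≡ a ⊎ x ∈ L → c x ≢ N → c' x ≡ c x) → (∀ x → x ∈ L → x ≢ N) → Steps c a L N → Steps c' a L z
Steps-retarget [] h h' ne s = h _ (inj₁ refl) s
Steps-retarget {a = a} (b ∷ L) h h' ne (p , s) =
  trans (h' a (inj₁ refl) (λ q → ne b (here refl) (trans (sym p) q))) p ,
  Steps-retarget L (λ x m → h x (inj₂ (into m))) (λ x m → h' x (inj₂ (into m))) (λ x m → ne x (there m)) s
  where
  into : ∀ {x} → x ≡ b ⊎ x ∈ L → x ∈ b ∷ L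
  into (inj₁ refl) = here refl
  into (inj₂ m) = there m

≢⇒≡ᵇ : ∀ {a b} → a ≢ b → (a ≡ᵇ b) ≡ false
≢⇒≡ᵇ {a} {b} ne with a ≡ᵇ b in e
... | false = refl
... | true = ⊥-elim (ne (≡ᵇ-true a b e))

sAdj-left : ∀ a → sAdj a a ≡ suc a
sAdj-left a rewrite ≡ᵇ-refl a = refl

sAdj-right : ∀ a → sAdj a (suc a) ≡ a
sAdj-right a rewrite ≢⇒≡ᵇ {suc a} {a} (λ e → <⇒≢ (n<1+n a) (sym e)) | ≡ᵇ-refl a = refl

sAdj-other : ∀ {a x} → x ≢ a → x ≢ suc a → sAdj a x ≡ x
sAdj-other p q rewrite ≢⇒≡ᵇ p | ≢⇒≡ᵇ q = refl

sAdj-involutive : ∀ a x → sAdj a (sAdj a x) ≡ x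
sAdj-involutive a x with x ≟ a | x ≟ suc a
... | yes refl | _ = trans (cong (sAdj a) (sAdj-left a)) (sAdj-right a)
... | no _ | yes refl = trans (cong (sAdj a) (sAdj-right a)) (sAdj-left a)
... | no p | no q = trans (cong (sAdj a) (sAdj-other p q)) (sAdj-other p q)

cox-injective : ∀ w {x y} → cox w x ≡ cox w y → x ≡ y
cox-injective [] e = e
cox-injective (a ∷ w) {x} {y} e = cox-injective w
  (trans (sym (sAdj-involutive a (cox w x))) (trans (cong (sAdj a) e) (sAdj-involutive a (cox w y))))

cox-fixes : ∀ w {x} → (∀ a → a ∈ w → x ≢ a × x ≢ suc a) → cox w x ≡ x
cox-fixes [] h = refl
cox-fixes (a ∷ w) {x} h = trans (cong (sAdj a) (cox-fixes w (λ b m → h b (there m))))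
  (sAdj-other (proj₁ (h a (here refl))) (proj₂ (h a (here refl))))

override : (ℕ → Bool) → ℕ → Bool → ℕ → Bool
override σ N p k = if k ≡ᵇ N then p else σ k

rowsAt-override : ∀ σ N p b → b < N → rowsAt (override σ N p) b ≡ rowsAt σ b
rowsAt-override σ N p zero h = refl
rowsAt-override σ N p (suc b) h rewrite ≢⇒≡ᵇ (<⇒≢ h) = cong (extend (σ (suc b)) (suc b)) (rowsAt-override σ N p b (<⇒≤ h))

rowsAt-overridden : ∀ σ b p → rowsAt (override σ (suc b) p) (suc b) ≡ extend p (suc b) (rowsAt σ b)
rowsAt-overridden σ b p rewrite ≡ᵇ-refl b = cong (extend p (suc b)) (rowsAt-override σ (suc b) p b (n<1+n b))

-- Inserting the letter N = n + 1 into a word in s₁, …, sₙ puts N + 1 into the cycle, next to N: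
-- behind N if sₙ is not applied before s_N, and in front of N otherwise.
module InsertLetter (n : ℕ) (w₁ w₂ : List ℕ) (small : ∀ a → a ∈ w₁ ++ w₂ → a ≤ n) where
  N = suc n
  c c' : ℕ → ℕ
  c x = cox (w₁ ++ w₂) x
  c' x = cox (w₁ ++ N ∷ w₂) x

  c≡ : ∀ x → c x ≡ cox w₁ (cox w₂ x)
  c≡ x = foldr-++ sAdj x w₁ w₂

  c'≡ : ∀ x → c' x ≡ cox w₁ (sAdj N (cox w₂ x))
  c'≡ x = foldr-++ sAdj x w₁ (N ∷ w₂)

  fix₁ : ∀ {x} → N < x → cox w₁ x ≡ x
  fix₁ lt = cox-fixes w₁ (λ a m → (λ e → <⇒≢ (≤-<-trans (m≤n⇒m≤1+n (small a (∈-++⁺ˡ m))) lt) (sym e)) ,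
                                  (λ e → <⇒≢ (≤-<-trans (s≤s (small a (∈-++⁺ˡ m))) lt) (sym e)))

  fix₂ : ∀ {x} → N < x → cox w₂ x ≡ x
  fix₂ lt = cox-fixes w₂ (λ a m → (λ e → <⇒≢ (≤-<-trans (m≤n⇒m≤1+n (small a (∈-++⁺ʳ w₁ m))) lt) (sym e)) ,
                                  (λ e → <⇒≢ (≤-<-trans (s≤s (small a (∈-++⁺ʳ w₁ m))) lt) (sym e)))

  w₂-not-suc : ∀ {x} → x ≤ N → cox w₂ x ≢ suc N
  w₂-not-suc h e = <⇒≢ (s≤s h) (cox-injective w₂ (trans e (sym (fix₂ ≤-refl))))

  top : c' (suc N) ≡ cox w₁ N
  top = trans (c'≡ (suc N)) (cong (cox w₁) (trans (cong (sAdj N) (fix₂ ≤-refl)) (sAdj-right N)))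

  hit : ∀ {x} → cox w₂ x ≡ N → c' x ≡ suc N
  hit {x} e = trans (c'≡ x) (trans (cong (cox w₁) (trans (cong (sAdj N) e) (sAdj-left N))) (fix₁ ≤-refl))

  miss : ∀ {x} → x ≤ N → cox w₂ x ≢ N → c' x ≡ c x
  miss {x} h ne = trans (c'≡ x) (trans (cong (cox w₁) (sAdj-other ne (w₂-not-suc h))) (sym (c≡ x)))

  module _ (σ : ℕ → Bool) (s : Steps c N (rowsAt σ n) N) where
    private
      L = rowsAt σ n
      below : ∀ {x} → x ∈ L → x ≤ n
      below = rowsAt-≤ σ n

    behind : cox w₂ N ≡ N → Steps c' (suc N) (rowsAt (override σ N true) N) (suc N)
    behind f = subst (λ M → Steps c' (suc N) M (suc N)) (sym (rowsAt-overridden σ n true))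
      (Steps-∷ʳ L (λ x m → miss (m≤n⇒m≤1+n (below m)) (λ e → <⇒≢ (s≤s (below m)) (cox-injective w₂ (trans e (sym f)))))
        (trans top (trans (cong (cox w₁) (sym f)) (sym (c≡ N)))) s (hit f))

    front : cox w₁ N ≡ N → Steps c' (suc N) (rowsAt (override σ N false) N) (suc N)
    front f = subst (λ M → Steps c' (suc N) M (suc N)) (sym (rowsAt-overridden σ n false))
      (trans top f , Steps-retarget L
        (λ x m e → hit (cox-injective w₁ (trans (sym (c≡ x)) (trans e (sym f)))))
        (λ x m ne → miss (≤N m) (λ e → ne (trans (c≡ x) (trans (cong (cox w₁) e) f))))
        (λ x m → <⇒≢ (s≤s (below m))) s)
      where
      ≤N : ∀ {x} → x ≡ N ⊎ x ∈ L → x ≤ N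
      ≤N (inj₁ refl) = ≤-refl
      ≤N (inj₂ m) = m≤n⇒m≤1+n (below m)

cox-cycle : ∀ n w → w ↭ applyUpTo suc n → ∃ λ σ → Steps (cox w) (suc n) (rowsAt σ n) (suc n)
cox-cycle zero w p with Perm.↭-empty-inv p
... | refl = (λ _ → true) , refl
-- The largest letter is cut out of the word. Words act from the right, so `w₂` is applied before
-- that letter, and whether `n` occurs in `w₂` decides the side of the new label.
cox-cycle (suc n) w p with ∈-∃++ (Perm.∈-resp-↭ (↭-sym p) (∈-applyUpTo⁺ suc (n<1+n n)))
... | w₁ , w₂ , refl with Perm.drop-mid w₁ (applyUpTo suc n) (↭-trans p (↭-reflexive (sym (applyUpTo-∷ʳ suc n))))
...   | q with cox-cycle n (w₁ ++ w₂) (↭-trans q (↭-reflexive (++-identityʳ (applyUpTo suc n))))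
...     | σ , s with Any.any? (n ≟_) w₂
...       | no ∉w₂ = override σ (suc n) true , I.behind σ s (cox-fixes w₂ λ a m → (λ e → <⇒≢ (s≤s (small a (∈-++⁺ʳ w₁ m))) (sym e)) ,
                       (λ e → ∉w₂ (subst (_∈ w₂) (sym (suc-injective e)) m)))
  where
  small : ∀ a → a ∈ w₁ ++ w₂ → a ≤ n
  small a m with ∈-applyUpTo⁻ suc (subst (a ∈_) (++-identityʳ (applyUpTo suc n)) (Perm.∈-resp-↭ q m))
  ... | i , lt , refl = lt
  module I = InsertLetter n w₁ w₂ small
...       | yes ∈w₂ = override σ (suc n) false , I.front σ s (cox-fixes w₁ λ a m → (λ e → <⇒≢ (s≤s (small a (∈-++⁺ˡ m))) (sym e)) ,
                       (λ e → twice (subst (_∈ w₁) (sym (suc-injective e)) m)))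
  where
  small : ∀ a → a ∈ w₁ ++ w₂ → a ≤ n
  small a m with ∈-applyUpTo⁻ suc (subst (a ∈_) (++-identityʳ (applyUpTo suc n)) (Perm.∈-resp-↭ q m))
  ... | i , lt , refl = lt
  module I = InsertLetter n w₁ w₂ small
  unique : Unique (w₁ ++ w₂)
  unique = Unique-↭ (↭-sym q) (subst Unique (sym (++-identityʳ (applyUpTo suc n)))
    (UniqueProps.applyUpTo⁺₁ suc n (λ i<j _ e → <⇒≢ i<j (suc-injective e))))
  disjoint : ∀ xs {ys} {x : ℕ} → Unique (xs ++ ys) → x ∈ xs → x ∈ ys → ⊥
  disjoint (x ∷ xs) (p AllPairs.∷ u) (here refl) m' = All.lookup p (∈-++⁺ʳ xs m') refl
  disjoint (x ∷ xs) (p AllPairs.∷ u) (there m) m' = disjoint xs u m m'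
  twice : n ∈ w₁ → ⊥
  twice m = disjoint w₁ unique m ∈w₂

-- The cycle cut into rows and columns, and the resulting grid graph

Cycle : (ℕ → ℕ) → List ℕ → Set
Cycle c [] = ⊤
Cycle c (a ∷ as) = Steps c a as a

Steps-snoc : ∀ {c a z y} as → Steps c a as z → c z ≡ y → Steps c a (as ∷ʳ z) y
Steps-snoc [] s e = s , e
Steps-snoc (b ∷ as) (p , s) e = p , Steps-snoc as s e

Cycle-rotate : ∀ {c} a as → Cycle c (a ∷ as) → Cycle c (as ∷ʳ a)
Cycle-rotate a [] s = s
Cycle-rotate a (b ∷ bs) (p , s) = Steps-snoc bs s p

-- Descending induction on m. In the cycle the last row borders on the first column, and the last
-- column on the first row; this is why one σ serves rows and columns. For `true` the cut just moves
-- past m + 1, for `false` the cycle is also rotated by one place.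
cycle-at : ∀ {c σ n} → Steps c (suc n) (rowsAt σ n) (suc n) → ∀ d m → m + d ≡ n →
  Cycle c (rowsAt σ m ++ reverse (colsAt σ (suc n) (suc m)))
cycle-at {c} {σ} {n} s zero m e rewrite trans (sym (+-identityʳ m)) e =
  subst (λ C → Cycle c (rowsAt σ n ++ reverse C)) (sym last) (Cycle-rotate (suc n) (rowsAt σ n) s)
  where
  single : ∀ p x → extend p x [] ≡ x ∷ []
  single true x = refl
  single false x = refl
  last : colsAt σ (suc n) (suc n) ≡ suc n ∷ []
  last = trans (colsAt-suc σ ≤-refl) (trans (cong (extend (σ (suc n)) (suc n)) (colsAt-end σ (suc n))) (single (σ (suc n)) (suc n)))
cycle-at {c} {σ} {n} s (suc d) m e =
  subst (λ D → Cycle c (rowsAt σ m ++ reverse D)) (sym (colsAt-suc σ (s≤s (m≤m+n m (suc d) ≤≡ e))))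
    (move (σ (suc m)) (cycle-at {c} {σ} {n} s d (suc m) (trans (sym (+-suc m d)) e)))
  where
  R = rowsAt σ m
  C = colsAt σ (suc n) (suc (suc m))
  move : ∀ p → Cycle c (extend p (suc m) R ++ reverse C) → Cycle c (R ++ reverse (extend p (suc m) C))
  move true h = subst (Cycle c) (trans (++-assoc R (suc m ∷ []) (reverse C)) (cong (R ++_) (sym (reverse-∷ʳ C (suc m))))) h
  move false h = subst (Cycle c) (trans (++-assoc R (reverse C) (suc m ∷ [])) (cong (R ++_) (sym (unfold-reverse (suc m) C))))
    (Cycle-rotate (suc m) (R ++ reverse C) h)

Steps-next : ∀ {c a z} as → Steps c a as z → ∀ i → suc i < suc (length as) → c (at (a ∷ as) i) ≡ at as i
Steps-next (b ∷ as) (p , s) zero lt = p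
Steps-next (b ∷ as) (p , s) (suc i) (s≤s lt) = Steps-next as s i lt
Steps-next [] s i (s≤s ())

Steps-last : ∀ {c a z} as → Steps c a as z → c (at (a ∷ as) (length as)) ≡ z
Steps-last [] s = s
Steps-last (b ∷ as) (p , s) = Steps-last as s

Cycle-next : ∀ {c} L → Cycle c L → ∀ i → suc i < length L → c (at L i) ≡ at L (suc i)
Cycle-next (a ∷ as) s i lt = Steps-next as s i lt

Cycle-last : ∀ {c} L → Cycle c L → ∀ i → suc i ≡ length L → c (at L i) ≡ at L 0
Cycle-last (a ∷ as) s i refl = Steps-last as s

-- Along the columns c lowers the list index. By `row-last` and `col-last` no arrow wraps around:
-- from the last row and the last column c leads out of the rows or columns.
record GridGraph (c : ℕ → ℕ) (m : ℕ) (R C : List ℕ) : Set where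
  field
    rows-≤   : ∀ {t} → t < length R → at R t ≤ m
    cols->   : ∀ {j} → j < length C → m < at C j
    row-next : ∀ {t} → suc t < length R → c (at R t) ≡ at R (suc t)
    row-last : ∀ {t} → suc t ≡ length R → m < c (at R t)
    col-next : ∀ {j} → suc j < length C → c (at C (suc j)) ≡ at C j
    col-last : c (at C 0) ≤ m

cycle-grid : ∀ c m R C → Cycle c (R ++ reverse C) → 0 < length R → 0 < length C →
  (∀ {x} → x ∈ R → x ≤ m) → (∀ {x} → x ∈ C → m < x) → GridGraph c m R C
cycle-grid c m R C cyc R>0 C>0 R≤ C> = record
  { rows-≤ = λ lt → R≤ (at-∈ R lt)
  ; cols-> = λ lt → C> (at-∈ C lt)
  ; row-next = λ {t} lt → trans (cong c (sym (at-++ˡ R (reverse C) (<⇒≤ lt))))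
      (trans (Cycle-next X cyc t (≤-trans lt R≤X)) (at-++ˡ R (reverse C) lt))
  ; row-last = λ {t} e → (C> (Perm.∈-resp-↭ (↭-reverse C) (at-∈ (reverse C) revC>0)))
      ≤≡ (sym (trans (cong c (sym (at-++ˡ R (reverse C) (≤-reflexive e))))
        (trans (Cycle-next X cyc t (≤-trans (s≤s (≤-reflexive e)) R<X))
          (trans (cong (at X) (trans e (sym (+-identityʳ (length R))))) (at-++ʳ R (reverse C) 0)))))
  ; col-next = λ {j} lt → trans (cong c (from-reverse lt))
      (trans (Cycle-next X cyc _ (in-X lt))
        (trans (cong (at X) (trans (sym (+-suc (length R) (length C ∸ suc (suc j)))) (cong (length R +_) (sym (+-∸-assoc 1 lt)))))
          (sym (from-reverse (<⇒≤ lt)))))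
  ; col-last = ≤-trans (≤-reflexive (trans (cong c (from-reverse C>0))
        (trans (Cycle-last X cyc _ end) (at-++ˡ R (reverse C) R>0)))) (R≤ (at-∈ R R>0)) }
  where
  X = R ++ reverse C
  |X| : length X ≡ length R + length C
  |X| = trans (length-++ R) (cong (length R +_) (length-reverse C))
  R≤X : length R ≤ length X
  R≤X = m≤m+n (length R) (length C) ≤≡ sym |X|
  R<X : length R < length X
  R<X = (+-comm 1 (length R) ≡≤ +-monoʳ-≤ (length R) C>0) ≤≡ sym |X|
  revC>0 : 0 < length (reverse C)
  revC>0 = C>0 ≤≡ sym (length-reverse C)
  from-reverse : ∀ {k} → k < length C → at C k ≡ at X (length R + (length C ∸ suc k))
  from-reverse {k} lt = trans (cong (λ D → at D k) (sym (reverse-involutive C)))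
    (trans (at-reverse (reverse C) (lt ≤≡ sym (length-reverse C)))
      (trans (cong (λ l → at (reverse C) (l ∸ suc k)) (length-reverse C)) (sym (at-++ʳ R (reverse C) _))))
  in-X : ∀ {j} → suc j < length C → suc (length R + (length C ∸ suc (suc j))) < length X
  in-X {j} lt = ≤-trans (s≤s (≤-reflexive (sym (+-suc (length R) _))))
    ((sym (+-suc (length R) _))
      ≡≤ ((+-monoʳ-≤ (length R) (≤-trans (s≤s (≤-reflexive (sym (+-∸-assoc 1 lt)))) (∸-monoʳ-< {o = 0} (s≤s z≤n) (<⇒≤ lt))))
        ≤≡ sym |X|))
  end : suc (length R + (length C ∸ 1)) ≡ length X
  end = trans (sym (+-suc (length R) _)) (trans (cong (length R +_) (m+[n∸m]≡n C>0)) (sym |X|))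

<ᵇ-true : ∀ {a b} → a < b → (a <ᵇ b) ≡ true
<ᵇ-true h = T⇒≡ (<⇒<ᵇ h)

∨-true : ∀ a {b} → a ∨ b ≡ true → a ≡ true ⊎ b ≡ true
∨-true true e = inj₁ refl
∨-true false e = inj₂ e

∨-introʳ : ∀ a {b} → b ≡ true → a ∨ b ≡ true
∨-introʳ true e = refl
∨-introʳ false e = e

∨-introˡ : ∀ {a} b → a ≡ true → a ∨ b ≡ true
∨-introˡ b refl = refl

∈-at : ∀ {x} xs → x ∈ xs → ∃ λ i → i < length xs × at xs i ≡ x
∈-at (x ∷ xs) (here refl) = 0 , s≤s z≤n , refl
∈-at (x ∷ xs) (there m) with ∈-at xs m
... | i , lt , e = suc i , s≤s lt , e

module _ {c m R C} (uR : Unique R) (uC : Unique C) (G : GridGraph c m R C) where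
  open GridGraph G
  private
    T = length R
    k = length C
    lab = label R C

  arrow-Next : ∀ {u v} → InGrid T k u → InGrid T k v → Next u v → arrowᵇ c (lab u) (lab v) ≡ true
  arrow-Next {t , j} {.(suc t) , .j} (lt , lt') (lt₂ , _) (inj₁ (refl , refl)) = ∨-introʳ
    ((at R (suc t) ≡ᵇ at R t) ∧ ((at C j ≡ᵇ c (at C j)) ∧ (at R t <ᵇ c (at C j))))
    (cong₂ _∧_ (≡ᵇ-≡ (sym (row-next lt₂))) (cong₂ _∧_ (≡ᵇ-refl (at C j))
      (<ᵇ-true (≤-<-trans (row-next lt₂ ≡≤ rows-≤ lt₂) (cols-> lt')))))
  arrow-Next {t , .(suc j)} {.t , j} (lt , lt') (_ , lt₂) (inj₂ (refl , refl)) = ∨-introˡ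
    ((at R t ≡ᵇ c (at R t)) ∧ ((at C j ≡ᵇ at C (suc j)) ∧ (c (at R t) <ᵇ at C (suc j))))
    (cong₂ _∧_ (≡ᵇ-refl (at R t)) (cong₂ _∧_ (≡ᵇ-≡ (sym (col-next lt')))
      (<ᵇ-true (≤-<-trans (rows-≤ lt) (cols-> lt₂ ≤≡ sym (col-next lt'))))))

  Next-arrow : ∀ {u v} → InGrid T k u → InGrid T k v → arrowᵇ c (lab u) (lab v) ≡ true → Next u v
  Next-arrow {t , j} {t' , j'} (lt , lt') (lt₂ , lt₂') e with ∨-true ((at R t' ≡ᵇ at R t) ∧ ((at C j' ≡ᵇ c (at C j)) ∧ (at R t <ᵇ c (at C j)))) e
  ... | inj₁ q = inj₂ (at-injective uR lt₂ lt (≡ᵇ-true _ _ (proj₁ (∧-true q))) ,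
                       column j lt' (≡ᵇ-true (at C j') (c (at C j)) (proj₁ (∧-true (proj₂ (∧-true {at R t' ≡ᵇ at R t} q))))))
    where
    column : ∀ j → j < k → at C j' ≡ c (at C j) → j ≡ suc j'
    column zero lt e = ⊥-elim (<⇒≱ (cols-> lt₂') (e ≡≤ col-last))
    column (suc j) lt e = cong suc (at-injective uC (<⇒≤ lt) lt₂' (trans (sym (col-next lt)) (sym e)))
  ... | inj₂ q = inj₁ (row≡ , at-injective uC lt₂' lt' (≡ᵇ-true _ _ (proj₁ (∧-true (proj₂ (∧-true {at R t' ≡ᵇ c (at R t)} q))))))
    where
    e' : at R t' ≡ c (at R t)
    e' = ≡ᵇ-true _ _ (proj₁ (∧-true q))
    row≡ : t' ≡ suc t
    row≡ with m≤n⇒m<n∨m≡n lt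
    ... | inj₁ lt₃ = at-injective uR lt₂ lt₃ (trans e' (row-next lt₃))
    ... | inj₂ last = ⊥-elim (<⇒≱ (row-last last) (sym e' ≡≤ rows-≤ lt₂))

  isPath-label : ∀ {P} → 0 < length P → GridPath T k P → isPathᵇ c (map lab P) ≡ true
  isPath-label {u ∷ []} _ _ = refl
  isPath-label {u ∷ v ∷ P} _ ((n Linked.∷ l) , (g All.∷ g' All.∷ gs)) =
    cong₂ _∧_ (arrow-Next g g' n) (isPath-label (s≤s z≤n) (l , (g' All.∷ gs)))

  label-isPath : ∀ p → isPathᵇ c p ≡ true → All (λ v → ∃ λ u → InGrid T k u × lab u ≡ v) p →
    ∃ λ P → GridPath T k P × map lab P ≡ p
  label-isPath (v ∷ []) e ((u , g , refl) All.∷ All.[]) = u ∷ [] , ([-] , (g All.∷ All.[])) , refl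
  label-isPath (v ∷ v' ∷ p) e ((u , g , lab-u) All.∷ a) with label-isPath (v' ∷ p) (proj₂ (∧-true {arrowᵇ c v v'} e)) a
  ... | u' ∷ P , (l , (g' All.∷ gs)) , q = u ∷ u' ∷ P ,
    ((Next-arrow g g' (subst₂ (λ y z → arrowᵇ c y z ≡ true) (sym lab-u) (sym (∷-injectiveˡ q))
        (proj₁ (∧-true {arrowᵇ c v v'} e))) Linked.∷ l) , (g All.∷ g' All.∷ gs)) ,
    cong₂ _∷_ lab-u q

-- The Greene-Kleitman invariant of AR_m(c)

∈-allLists⁺ : ∀ {A : Set} {V : List A} {xs} → All (_∈ V) xs → xs ∈ allLists (length xs) V
∈-allLists⁺ All.[] = here refl
∈-allLists⁺ {V = V} {x ∷ xs} (m All.∷ ms) = ∈-concatMap⁺ (λ v → map (v ∷_) (allLists (length xs) V))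
  (lose m (∈-map⁺ (x ∷_) (∈-allLists⁺ ms)))

∈-allLists⁻ : ∀ {A : Set} {V : List A} k {xs} → xs ∈ allLists k V → length xs ≡ k × All (_∈ V) xs
∈-allLists⁻ zero (here refl) = refl , All.[]
∈-allLists⁻ {V = V} (suc k) m with find (∈-concatMap⁻ (λ v → map (v ∷_) (allLists k V)) {xs = V} m)
... | v , m' , m'' with ∈-map⁻ (v ∷_) m''
...   | xs , m₃ , refl with ∈-allLists⁻ k m₃
...     | e , a = cong suc e , (m' All.∷ a)

∈-paths⁺ : ∀ {c V p} → 1 ≤ length p → length p ≤ length V → All (_∈ V) p → isPathᵇ c p ≡ true → p ∈ paths c V
∈-paths⁺ {c} {V} {p} h h' ms e = ∈-concatMap⁺ (λ k → filterᵇ (isPathᵇ c) (allLists k V))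
  (lose (subst (_∈ range 1 (length V)) (m+[n∸m]≡n h) (∈-applyUpTo⁺ (1 +_) (m+[n∸m]≡n h ≡≤ h')))
    (∈-filter⁺ (λ p → T? (isPathᵇ c p)) (∈-allLists⁺ ms) (≡⇒T e)))

∈-paths⁻ : ∀ {c V p} → p ∈ paths c V → All (_∈ V) p × isPathᵇ c p ≡ true
∈-paths⁻ {c} {V} m with find (∈-concatMap⁻ (λ k → filterᵇ (isPathᵇ c) (allLists k V)) {xs = range 1 (length V)} m)
... | k , _ , m' with ∈-filter⁻ (λ p → T? (isPathᵇ c p)) {xs = allLists k V} m'
...   | m'' , t = proj₂ (∈-allLists⁻ k m'') , T⇒≡ t

maximum-≤ : ∀ xs b → (∀ x → x ∈ xs → x ≤ b) → foldr _⊔_ 0 xs ≤ b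
maximum-≤ [] b h = z≤n
maximum-≤ (x ∷ xs) b h = ⊔-lub (h x (here refl)) (maximum-≤ xs b (λ y m → h y (there m)))

≤-maximum : ∀ {x xs} → x ∈ xs → x ≤ foldr _⊔_ 0 xs
≤-maximum (here refl) = m≤m⊔n _ _
≤-maximum {xs = y ∷ xs} (there m) = ≤-trans (≤-maximum m) (m≤n⊔m y _)

sum-map-+ : ∀ {A : Set} (f g : A → ℕ) xs → sum (map (λ x → f x + g x) xs) ≡ sum (map f xs) + sum (map g xs)
sum-map-+ f g [] = refl
sum-map-+ f g (x ∷ xs) = trans (cong (f x + g x +_) (sum-map-+ f g xs)) (interchange (f x) (g x) _ _)

sum-zeros : ∀ {A : Set} (xs : List A) → sum (map (λ _ → 0) xs) ≡ 0
sum-zeros [] = refl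
sum-zeros (x ∷ xs) = sum-zeros xs

sum-swap : ∀ {A B : Set} (φ : A → B → ℕ) xs ys →
  sum (map (λ x → sum (map (φ x) ys)) xs) ≡ sum (map (λ y → sum (map (λ x → φ x y) xs)) ys)
sum-swap φ [] ys = sym (sum-zeros ys)
sum-swap φ (x ∷ xs) ys = trans (cong (sum (map (φ x) ys) +_) (sum-swap φ xs ys))
  (sym (sum-map-+ (φ x) (λ y → sum (map (λ x → φ x y) xs)) ys))

pairs : List ℕ → List ℕ → List Vertex
pairs Is Js = concatMap (λ i → map (λ j → (i , j)) Js) Is

sum-pairs : ∀ (φ : Vertex → ℕ) Is Js → sum (map φ (pairs Is Js)) ≡ gridSum Is Js (λ i j → φ (i , j))
sum-pairs φ Is Js = trans (rows Is) (sum-swap (λ i j → φ (i , j)) Is Js)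
  where
  rows : ∀ Is → sum (map φ (pairs Is Js)) ≡ sum (map (λ i → sum (map (λ j → φ (i , j)) Js)) Is)
  rows [] = refl
  rows (i ∷ Is) = trans (cong sum (map-++ φ (map (i ,_) Js) (pairs Is Js)))
    (trans (sum-++ (map φ (map (i ,_) Js)) _) (cong₂ _+_ (cong sum (sym (map-∘ Js))) (rows Is)))

∈-pairs⁺ : ∀ {i j Is Js} → i ∈ Is → j ∈ Js → (i , j) ∈ pairs Is Js
∈-pairs⁺ {i} m m' = ∈-concatMap⁺ _ (lose m (∈-map⁺ (i ,_) m'))

∈-pairs⁻ : ∀ {v Is Js} → v ∈ pairs Is Js → proj₁ v ∈ Is × proj₂ v ∈ Js
∈-pairs⁻ {v} {Is} {Js} m with find (∈-concatMap⁻ (λ i → map (i ,_) Js) {xs = Is} m)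
... | i , m' , m'' with ∈-map⁻ (i ,_) m''
...   | j , m₃ , refl = m' , m₃

length-pairs : ∀ Is Js → length (pairs Is Js) ≡ length Is * length Js
length-pairs [] Js = refl
length-pairs (i ∷ Is) Js = trans (length-++ (map (i ,_) Js)) (cong₂ _+_ (length-map _ Js) (length-pairs Is Js))

-- The enumeration `paths` stops at the number of vertices; a walk has T + k - 1 boxes.
walk-fits : ∀ T k {P} → 0 < T → 0 < k → IsWalk T k P → 1 ≤ length P × length P ≤ T * k
walk-fits (suc T) (suc k) _ _ (right , refl) =
  s≤s z≤n ≤≡ sym (gridWalk-length T k right) ,
  gridWalk-length T k right ≡≤ s≤s (+-comm T k ≡≤ +-monoʳ-≤ k (m≤m*n T (suc k)))

module _ {c m n R C} (uR : Unique R) (uC : Unique C) (G : GridGraph c m R C) (R>0 : 0 < length R) (C>0 : 0 < length C)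
  (R↭ : R ↭ range 1 m) (C↭ : C ↭ range (suc m) n) (F : Vertex → ℕ) where
  private
    V = vertsAR n m
    F' = λ r e → F (r , e)
    lab = label R C
    s = gridShape F' R C

    weight : ∀ tup → tupleWeight F V tup ≡ gridSum R C (λ r e → choose (onSome tup r e) (F (r , e)))
    weight tup = trans (sum-pairs (λ v → if any (λ p → any (eqV v) p) tup then F v else 0) (range 1 m) (range (suc m) n))
      (sym (gridSum-↭ (λ r e → choose (onSome tup r e) (F (r , e))) R↭ C↭))

    position : ∀ {v} → v ∈ V → ∃ λ u → InGrid (length R) (length C) u × lab u ≡ v
    position v∈ with ∈-pairs⁻ v∈
    ... | r∈ , e∈ with ∈-at R (Perm.∈-resp-↭ (↭-sym R↭) r∈) | ∈-at C (Perm.∈-resp-↭ (↭-sym C↭) e∈)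
    ...   | t , lt , refl | j , lt' , refl = (t , j) , (lt , lt') , refl

    chains : ∀ {tup} → All (_∈ paths c V) tup → All (LabelChain R C) tup
    chains All.[] = All.[]
    chains (p∈ All.∷ ps) with ∈-paths⁻ {c} {V} p∈
    ... | in-V , e with label-isPath uR uC G _ e (All.map position in-V)
    ...   | P , g , refl = path-chain uR uC g All.∷ chains ps

    upper-bound : ∀ l x → x ∈ map (tupleWeight F V) (allLists l (paths c V)) → x ≤ cum s l
    upper-bound l x x∈ with ∈-map⁻ (tupleWeight F V) x∈
    ... | tup , tup∈ , refl with ∈-allLists⁻ l tup∈
    ...   | refl , ps with paths⇒columns F' R C tup (chains ps)
    ...     | a , w , K , h , h' = weight tup ≡≤ ≤-trans h' (≤-trans (shape-upper K) (cum-≤ s h))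

    walk-∈ : ∀ {P} → IsWalk (length R) (length C) P → map lab P ∈ paths c V
    walk-∈ {P} w = ∈-paths⁺ (proj₁ fits ≤≡ sym (length-map lab P))
      (length-map lab P ≡≤ (proj₂ fits ≤≡ sym |V|))
      (vertices (proj₂ (isWalk-path w))) (isPath-label uR uC G (proj₁ fits) (isWalk-path w))
      where
      fits = walk-fits (length R) (length C) R>0 C>0 w
      |V| : length V ≡ length R * length C
      |V| = trans (length-pairs (range 1 m) (range (suc m) n)) (cong₂ _*_ (sym (↭-length R↭)) (sym (↭-length C↭)))
      vertices : ∀ {P} → All (InGrid (length R) (length C)) P → All (_∈ V) (map lab P)
      vertices All.[] = All.[]
      vertices ((lt , lt') All.∷ g) = ∈-pairs⁺ (Perm.∈-resp-↭ R↭ (at-∈ R lt)) (Perm.∈-resp-↭ C↭ (at-∈ C lt')) All.∷ vertices g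

    lower-bound : ∀ l → cum s l ≤ Mℓ c V F l
    lower-bound l with shape-attained (length R) (gridLines F' R C) l
    ... | a , w , K , h , h' with columns⇒paths F' R C K l h
    ...   | Ps , len , walks , h'' = ≤-trans h' (≤-trans h'' ((sym (weight (map (map lab) Ps)))
            ≡≤ (≤-maximum (∈-map⁺ (tupleWeight F V) (subst (λ k → map (map lab) Ps ∈ allLists k (paths c V))
              (trans (length-map (map lab) Ps) len) (∈-allLists⁺ (all-paths walks)))))))
      where
      all-paths : ∀ {Ps} → All (IsWalk (length R) (length C)) Ps → All (_∈ paths c V) (map (map lab) Ps)
      all-paths All.[] = All.[]
      all-paths (w All.∷ ws) = walk-∈ w All.∷ all-paths ws

  Mℓ-shape : ∀ l → Mℓ c V F l ≡ cum s l
  Mℓ-shape l = ≤-antisym (maximum-≤ (map (tupleWeight F V) (allLists l (paths c V))) (cum s l) (upper-bound l)) (lower-bound l)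

  GK-shape : ∀ k → GK c V F (suc k) ≡ s k
  GK-shape k = trans (cong₂ _∸_ (Mℓ-shape (suc k)) (Mℓ-shape k)) (m+n∸m≡n (cum s k) (s k))

-- σ is chosen before `F` and `m`: all AR_m(c) and all fillings belong to the same kind of growth
-- diagram.
GK-shapeAt : ∀ {n w} → IsCoxeterWord (suc n) w → ∃ λ σ → ∀ F m → 1 ≤ m → m ≤ n → ∀ k →
  GK (cox w) (vertsAR (suc n) m) F (suc k) ≡ shapeAt σ (suc n) (λ r e → F (r , e)) m (suc m) k
GK-shapeAt {n} {w} p with cox-cycle n w p
... | σ , s = σ , λ F m h h' → GK-shape (rowsAt-unique σ m) (colsAt-unique σ (suc n) (suc m))
  (cycle-grid (cox w) m (rowsAt σ m) (colsAt σ (suc n) (suc m))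
    (cycle-at {cox w} {σ} {n} s (n ∸ m) m (m+[n∸m]≡n h'))
    (R>0 m h) (C>0 m h') (rowsAt-≤ σ m) (colsAt-≥ σ (suc n) (suc m)))
  (R>0 m h) (C>0 m h')
  (rowsAt-↭ σ m) (colsFrom-↭ σ (suc n ∸ m) (suc m) (suc m +_) (λ _ → refl)) F
  where
  R>0 : ∀ m → 1 ≤ m → 0 < length (rowsAt σ m)
  R>0 m h = h ≤≡ sym (rowsAt-length σ m)
  C>0 : ∀ m → m ≤ n → 0 < length (colsAt σ (suc n) (suc m))
  C>0 m h = m<n⇒0<n∸m (s≤s h) ≤≡ sym (colsAt-length σ (suc n) (suc m))

-- Counting in increasing lists

Increasing : List ℕ → Set
Increasing = AllPairs.AllPairs _<_

count : List ℕ → ℕ → ℕ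
count [] m = 0
count (x ∷ xs) m = indicator (x ≤ᵇ m) + count xs m

member : List ℕ → ℕ → Bool
member xs m = any (m ≡ᵇ_) xs

≤ᵇ-true : ∀ {a b} → a ≤ b → (a ≤ᵇ b) ≡ true
≤ᵇ-true h = T⇒≡ (≤⇒≤ᵇ h)

≤ᵇ-false : ∀ {a b} → b < a → (a ≤ᵇ b) ≡ false
≤ᵇ-false {a} {b} h with a ≤ᵇ b in e
... | false = refl
... | true = ⊥-elim (<⇒≱ h (≤ᵇ⇒≤ a b (≡⇒T e)))

member-true : ∀ {xs m} → m ∈ xs → member xs m ≡ true
member-true {xs} {m} h = any-true (m ≡ᵇ_) h (≡ᵇ-refl m)

member-∈ : ∀ xs {m} → member xs m ≡ true → m ∈ xs
member-∈ xs {m} e with any-witness (m ≡ᵇ_) xs e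
... | x , x∈ , q = subst (_∈ xs) (sym (≡ᵇ-true m x q)) x∈

member-false : ∀ xs {m} → ¬ (m ∈ xs) → member xs m ≡ false
member-false xs {m} h with member xs m in e
... | false = refl
... | true = ⊥-elim (h (member-∈ xs e))

count-≤ : ∀ xs m → count xs m ≤ length xs
count-≤ [] m = z≤n
count-≤ (x ∷ xs) m = +-mono-≤ (indicator≤1 (x ≤ᵇ m)) (count-≤ xs m)

count-mono : ∀ xs {m m'} → m ≤ m' → count xs m ≤ count xs m'
count-mono [] h = z≤n
count-mono (x ∷ xs) {m} {m'} h = +-mono-≤ head (count-mono xs h)
  where
  head : indicator (x ≤ᵇ m) ≤ indicator (x ≤ᵇ m')
  head with x ≤? m
  ... | yes q = indicator≤1 (x ≤ᵇ m) ≤≡ cong indicator (sym (≤ᵇ-true (≤-trans q h)))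
  ... | no q = cong indicator (≤ᵇ-false (≰⇒> q)) ≡≤ z≤n

count-zero : ∀ {xs m} → All (m <_) xs → count xs m ≡ 0
count-zero All.[] = refl
count-zero (h All.∷ hs) = cong₂ _+_ (cong indicator (≤ᵇ-false h)) (count-zero hs)

count-full : ∀ {xs m} → All (_≤ m) xs → count xs m ≡ length xs
count-full All.[] = refl
count-full (h All.∷ hs) = cong₂ _+_ (cong indicator (≤ᵇ-true h)) (count-full hs)

count-suc : ∀ {xs} → Increasing xs → ∀ m → count xs (suc m) ≡ (if member xs (suc m) then suc (count xs m) else count xs m)
count-suc AllPairs.[] m = refl
count-suc {x ∷ xs} (p AllPairs.∷ inc) m with <-cmp x (suc m)
... | tri< lt _ _ rewrite ≤ᵇ-true {x} {suc m} (<⇒≤ lt) | ≤ᵇ-true {x} {m} (s≤s⁻¹ lt)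
      | ≢⇒≡ᵇ {suc m} {x} (λ e → <⇒≢ lt (sym e)) | count-suc inc m = if-suc (member xs (suc m))
  where
  if-suc : ∀ b {k} → suc (if b then suc k else k) ≡ (if b then suc (suc k) else suc k)
  if-suc true = refl
  if-suc false = refl
... | tri≈ _ refl _ rewrite ≤ᵇ-true {suc m} ≤-refl | ≤ᵇ-false {suc m} {m} ≤-refl | ≡ᵇ-refl m =
  cong suc (trans (count-zero p) (sym (count-zero (All.map (<-trans (n<1+n m)) p))))
... | tri> _ _ gt rewrite ≤ᵇ-false {x} {suc m} gt | ≤ᵇ-false {x} {m} (<-trans (n<1+n m) gt)
      | member-false (x ∷ xs) {suc m} (λ where (here e) → <⇒≢ gt e
                                               (there h) → <⇒≢ (<-trans gt (All.lookup p h)) refl) =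
  trans (count-zero (All.map (<-trans gt) p)) (sym (count-zero (All.map (<-trans (<-trans (n<1+n m) gt)) p)))

at-≤-count : ∀ {xs} → Increasing xs → ∀ {i m} → i < count xs m → at xs i ≤ m
at-≤-count {x ∷ xs} (p AllPairs.∷ inc) {i} {m} h with x ≤? m
at-≤-count {x ∷ xs} (p AllPairs.∷ inc) {zero} h | yes q = q
at-≤-count {x ∷ xs} (p AllPairs.∷ inc) {suc i} {m} h | yes q =
  at-≤-count inc (s≤s⁻¹ (h ≤≡ cong (λ b → indicator b + count xs m) (≤ᵇ-true q)))
at-≤-count {x ∷ xs} (p AllPairs.∷ inc) {i} {m} h | no q = ⊥-elim (n≮0 (≤-trans h (≤-reflexive
  (count-zero (≰⇒> q All.∷ All.map (<-trans (≰⇒> q)) p)))))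

at->-count : ∀ {xs} → Increasing xs → ∀ {i m} → i < length xs → count xs m ≤ i → m < at xs i
at->-count {x ∷ xs} (p AllPairs.∷ inc) {i} {m} lt h with x ≤? m
at->-count {x ∷ xs} (p AllPairs.∷ inc) {zero} {m} lt h | yes q =
  ⊥-elim (n≮0 (cong (λ b → indicator b + count xs m) (sym (≤ᵇ-true q)) ≡≤ h))
at->-count {x ∷ xs} (p AllPairs.∷ inc) {suc i} {m} (s≤s lt) h | yes q =
  at->-count inc lt (s≤s⁻¹ (cong (λ b → indicator b + count xs m) (sym (≤ᵇ-true q)) ≡≤ h))
at->-count {x ∷ xs} (p AllPairs.∷ inc) {zero} lt h | no q = ≰⇒> q
at->-count {x ∷ xs} (p AllPairs.∷ inc) {suc i} (s≤s lt) h | no q = <-trans (≰⇒> q) (All.lookup p (at-∈ xs lt))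

count-at : ∀ {xs} → Increasing xs → ∀ {i} → i < length xs → count xs (at xs i) ≡ suc i
count-at {x ∷ xs} (p AllPairs.∷ inc) {zero} lt = cong₂ _+_ (cong indicator (≤ᵇ-true {x} ≤-refl)) (count-zero p)
count-at {x ∷ xs} (p AllPairs.∷ inc) {suc i} (s≤s lt) =
  cong₂ _+_ (cong indicator (≤ᵇ-true (<⇒≤ (All.lookup p (at-∈ xs lt))))) (count-at inc lt)

indexOf-nothing : ∀ a xs → member xs a ≡ false → indexOf a xs ≡ nothing
indexOf-nothing a [] e = refl
indexOf-nothing a (x ∷ xs) e with a ≡ᵇ x
... | false rewrite indexOf-nothing a xs e = refl

indexOf-at : ∀ {xs} → Increasing xs → ∀ {i} → i < length xs → indexOf (at xs i) xs ≡ just i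
indexOf-at {x ∷ xs} _ {zero} lt rewrite ≡ᵇ-refl x = refl
indexOf-at {x ∷ xs} (p AllPairs.∷ inc) {suc i} (s≤s lt)
  rewrite ≢⇒≡ᵇ {at xs i} {x} (λ e → <⇒≢ (All.lookup p (at-∈ xs lt)) (sym e)) | indexOf-at inc lt = refl

count-nonzero : ∀ L c → (∀ k → 1 ≤ at L k → k < c) → (∀ k → k < c → 1 ≤ at L k) →
  sum (map (λ x → if 1 ≤ᵇ x then 1 else 0) L) ≡ c
count-nonzero [] zero h h' = refl
count-nonzero [] (suc c) h h' with h' 0 (s≤s z≤n)
... | ()
count-nonzero (zero ∷ L) zero h h' = count-nonzero L zero (λ k q → ⊥-elim (n≮0 (h (suc k) q))) (λ k ())
count-nonzero (suc x ∷ L) zero h h' = ⊥-elim (n≮0 (h 0 (s≤s z≤n)))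
count-nonzero (zero ∷ L) (suc c) h h' with h' 0 (s≤s z≤n)
... | ()
count-nonzero (suc x ∷ L) (suc c) h h' = cong suc (count-nonzero L c (λ k q → s≤s⁻¹ (h (suc k) q)) (λ k q → h' (suc k) (s≤s q)))

at-drop : ∀ L k → at (drop 1 L) k ≡ at L (suc k)
at-drop [] k = refl
at-drop (x ∷ L) k = refl

at-nonzero : ∀ L {k} → 1 ≤ at L k → k < length L
at-nonzero (x ∷ L) {zero} h = s≤s z≤n
at-nonzero (x ∷ L) {suc k} h = s≤s (at-nonzero L h)

conditional-maximum : ∀ (g : ℕ → Bool) L u → (∀ i → i ∈ L → g i ≡ true → i ≤ u) → u ∈ L → g u ≡ true →
  foldr (λ i acc → if g i then i ⊔ acc else acc) 0 L ≡ u
conditional-maximum g L u h u∈ gu = ≤-antisym (upper-part L h) (lower-part L u∈)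
  where
  upper-part : ∀ L → (∀ i → i ∈ L → g i ≡ true → i ≤ u) → foldr (λ i acc → if g i then i ⊔ acc else acc) 0 L ≤ u
  upper-part [] h = z≤n
  upper-part (x ∷ L) h with g x in e
  ... | true = ⊔-lub (h x (here refl) e) (upper-part L (λ i m → h i (there m)))
  ... | false = upper-part L (λ i m → h i (there m))
  lower-part : ∀ L → u ∈ L → u ≤ foldr (λ i acc → if g i then i ⊔ acc else acc) 0 L
  lower-part (x ∷ L) (here refl) rewrite gu = m≤m⊔n u _
  lower-part (x ∷ L) (there m) with g x
  ... | true = ≤-trans (lower-part L m) (m≤n⊔m x _)
  ... | false = lower-part L m

fer-true : ∀ {la i j} → Fer la i j → ferᵇ la i j ≡ true
fer-true (h , h' , h'') = cong₂ _∧_ (≤ᵇ-true h) (cong₂ _∧_ (≤ᵇ-true h') (≤ᵇ-true h''))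

fer-Fer : ∀ {la i j} → ferᵇ la i j ≡ true → Fer la i j
fer-Fer {la} {i} {j} e with ∧-true {1 ≤ᵇ i} e
... | e₁ , e₂ with ∧-true {1 ≤ᵇ j} e₂
...   | e₃ , e₄ = ≤ᵇ⇒≤ 1 i (≡⇒T e₁) , ≤ᵇ⇒≤ 1 j (≡⇒T e₃) , ≤ᵇ⇒≤ j _ (≡⇒T e₄)

-- Boxes and diagonals of λ in terms of the bipartition

module Bipartition (la B E : List ℕ) (eb : ElementaryBip B E) (shapeIs : ShapeIs la B E) where
  open ElementaryBip eb hiding (covered)
  q p : ℕ
  q = length E
  p = length B

  β ε : ℕ → ℕ
  β = count B
  ε = count E

  lo≤1 : lo ≤ 1
  lo≤1 = proj₁ (cover 1 (inj₁ one∈B))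

  1≤hi : 1 ≤ hi
  1≤hi = proj₂ (cover 1 (inj₁ one∈B))

  positive : ∀ {k} → k ∈ B ⊎ k ∈ E → 1 ≤ k
  positive h = ≤-trans lo-pos (proj₁ (cover _ h))

  notE : ∀ k → member B k ≡ true → member E k ≡ false
  notE k e = member-false E {k} (disj k (member-∈ B {k} e))

  notB : ∀ k → member E k ≡ true → member B k ≡ false
  notB k e = member-false B {k} (λ h → disj k h (member-∈ E {k} e))

  β-suc : ∀ m → β (suc m) ≡ (if member B (suc m) then suc (β m) else β m)
  β-suc = count-suc B-inc

  ε-suc : ∀ m → ε (suc m) ≡ (if member E (suc m) then suc (ε m) else ε m)
  ε-suc = count-suc E-inc

  β-B : ∀ m → member B (suc m) ≡ true → β (suc m) ≡ suc (β m)
  β-B m e = trans (β-suc m) (cong (λ b → if b then suc (β m) else β m) e)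

  β-notB : ∀ m → member B (suc m) ≡ false → β (suc m) ≡ β m
  β-notB m e = trans (β-suc m) (cong (λ b → if b then suc (β m) else β m) e)

  ε-E : ∀ m → member E (suc m) ≡ true → ε (suc m) ≡ suc (ε m)
  ε-E m e = trans (ε-suc m) (cong (λ b → if b then suc (ε m) else ε m) e)

  ε-notE : ∀ m → member E (suc m) ≡ false → ε (suc m) ≡ ε m
  ε-notE m e = trans (ε-suc m) (cong (λ b → if b then suc (ε m) else ε m) e)

  β0 : β 0 ≡ 0
  β0 = count-zero (All.tabulate λ h → positive (inj₁ h))

  ε0 : ε 0 ≡ 0
  ε0 = count-zero (All.tabulate λ h → positive (inj₂ h))

  β+ε : ∀ m → m ≤ hi → β m + ε m ≡ m
  β+ε zero h = cong₂ _+_ β0 ε0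
  β+ε (suc m) h with ElementaryBip.covered eb (suc m) (≤-trans lo≤1 (s≤s z≤n)) h
  ... | inj₁ b = trans (cong₂ _+_ (β-B m (member-true b)) (ε-notE m (notE (suc m) (member-true b)))) (cong suc (β+ε m (<⇒≤ h)))
  ... | inj₂ e = trans (cong₂ _+_ (β-notB m (notB (suc m) (member-true e))) (ε-E m (member-true e)))
                   (trans (+-suc (β m) (ε m)) (cong suc (β+ε m (<⇒≤ h))))

  ε-hi : ∀ m → hi ≤ m → ε m ≡ q
  ε-hi m h = count-full (All.tabulate λ e → ≤-trans (proj₂ (cover _ (inj₂ e))) h)

  p+q≡hi : p + q ≡ hi
  p+q≡hi = trans (cong₂ _+_ (sym (count-full (All.tabulate λ b → proj₂ (cover _ (inj₁ b))))) (sym (ε-hi hi ≤-refl))) (β+ε hi ≤-refl)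

  β1 : β 1 ≡ 1
  β1 = trans (β-B 0 (member-true one∈B)) (cong suc β0)

  ε1 : ε 1 ≡ 0
  ε1 = suc-injective (trans (cong (_+ ε 1) (sym β1)) (β+ε 1 1≤hi))

  1≤p : 1 ≤ p
  1≤p = sym β1 ≡≤ count-≤ B 1

  last : ∀ {h} → suc h ≡ hi → β h ≡ p × suc (ε h) ≡ q
  last {h} refl = trans (sym (β-notB h (notB (suc h) (member-true max∈E)))) (count-full (All.tabulate λ b → proj₂ (cover _ (inj₁ b)))) ,
                  trans (sym (ε-E h (member-true max∈E))) (ε-hi _ ≤-refl)

  private
    pred-hi : suc (pred hi) ≡ hi
    pred-hi = m+[n∸m]≡n 1≤hi

  1≤q : 1 ≤ q
  1≤q = s≤s z≤n ≤≡ proj₂ (last pred-hi)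

  pred-< : ∀ {i} → 1 ≤ i → suc (i ∸ 1) ≡ i
  pred-< h = m+[n∸m]≡n h

  -- (β m , q ∸ ε m) is the maximal box (u_m , v_m) of the diagonal m.
  box : ∀ {m k} → k < β m → k < q ∸ ε m → Fer la (β m ∸ k) (q ∸ ε m ∸ k)
  box {m} {k} h h' = proj₂ (shapeIs _ _)
    (1≤i , ≤-trans (m∸n≤m (β m) k) (count-≤ B m) , 1≤j , j≤q ,
     ≤-<-trans (at-≤-count B-inc (pred-< 1≤i ≡≤ m∸n≤m (β m) k))
       (at->-count E-inc (∸-monoʳ-< {o = 0} 1≤j j≤q)
         (sym (m∸[m∸n]≡n (count-≤ E m)) ≡≤ ∸-monoʳ-≤ q (m∸n≤m (q ∸ ε m) k))))
    where
    1≤i = m<n⇒0<n∸m h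
    1≤j = m<n⇒0<n∸m h'
    j≤q = ≤-trans (m∸n≤m (q ∸ ε m) k) (m∸n≤m q (ε m))

  row1 : row la 1 ≡ q
  row1 = ≤-antisym (≮⇒≥ λ lt → <⇒≱ (n<1+n q) (proj₁ (proj₂ (proj₂ (proj₂ (proj₁ (shapeIs 1 (suc q)) (≤-refl , s≤s z≤n , lt)))))))
    (proj₂ (proj₂ (proj₂ (shapeIs 1 q) (≤-refl , 1≤p , 1≤q , ≤-refl ,
      ≤-<-trans (at-≤-count B-inc (≤-reflexive (sym β1)))
        (at->-count E-inc (≤-trans (s≤s (≤-reflexive (n∸n≡0 q))) 1≤q) (ε1 ≡≤ z≤n))))))

  row-nonzero : ∀ i → 1 ≤ i → i ≤ p → 1 ≤ row la i
  row-nonzero i h h' = proj₂ (proj₂ (proj₂ (shapeIs i 1) (h , h' , ≤-refl , 1≤q ,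
    ≤-<-trans (at-≤-count B-inc (pred-< h ≡≤ (h' ≤≡ sym (proj₁ (last pred-hi)))))
      (at->-count E-inc (∸-monoʳ-< {o = 0} ≤-refl 1≤q) (≤-reflexive (cong pred (proj₂ (last pred-hi))))))))

  -- The first row has q boxes and the first column p, with one box in common, and p + q is `hi`. So
  -- the n of the theorem is the end of the interval.
  hook : suc (hook11 la) ≡ hi
  hook = trans (cong suc (cong₂ _+_ row1 (count-nonzero (drop 1 la) (pred p) short long)))
    (trans (sym (+-suc q (pred p))) (trans (cong (q +_) (m+[n∸m]≡n 1≤p)) (trans (+-comm q p) p+q≡hi)))
    where
    short : ∀ k → 1 ≤ at (drop 1 la) k → k < pred p
    short k h = s≤s⁻¹ ((proj₁ (proj₂ (proj₁ (shapeIs (suc (suc k)) 1)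
      (s≤s z≤n , ≤-refl , h ≤≡ at-drop la k)))) ≤≡ sym (m+[n∸m]≡n 1≤p))
    long : ∀ k → k < pred p → 1 ≤ at (drop 1 la) k
    long k h = (row-nonzero (suc (suc k)) (s≤s z≤n) (s≤s h ≤≡ m+[n∸m]≡n 1≤p))
      ≤≡ sym (at-drop la k)

  diagonal : ℕ → ℕ → ℕ
  diagonal i j = i + (q ∸ j)

  module Box {i j} (fer : Fer la i j) where
    private
      m = diagonal i j
      fbe = proj₁ (shapeIs i j) fer
      b = at B (i ∸ 1)
      e = at E (q ∸ j)
    1≤i : 1 ≤ i
    1≤i = proj₁ fbe
    i≤p : i ≤ p
    i≤p = proj₁ (proj₂ fbe)
    1≤j : 1 ≤ j
    1≤j = proj₁ (proj₂ (proj₂ fbe))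
    j≤q : j ≤ q
    j≤q = proj₁ (proj₂ (proj₂ (proj₂ fbe)))
    b<e : b < e
    b<e = proj₂ (proj₂ (proj₂ (proj₂ fbe)))
    i-1< : i ∸ 1 < p
    i-1< = pred-< 1≤i ≡≤ i≤p
    q-j< : q ∸ j < q
    q-j< = ∸-monoʳ-< {o = 0} 1≤j j≤q
    1≤b : 1 ≤ b
    1≤b = positive (inj₁ (at-∈ B i-1<))
    e≤hi : e ≤ hi
    e≤hi = proj₂ (cover e (inj₂ (at-∈ E q-j<)))
    βb : β b ≡ i
    βb = trans (count-at B-inc i-1<) (pred-< 1≤i)
    -- With `m<e` this places the label of a box on the diagonal m inside AR_m(c). Up to b there are
    -- exactly i elements of B and at most q - j of E, and together they number b.
    b≤m : b ≤ m
    b≤m = (sym (β+ε b (≤-trans (<⇒≤ b<e) e≤hi)))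
      ≡≤ +-mono-≤ (≤-reflexive βb) (≮⇒≥ λ lt → <⇒≱ b<e (at-≤-count E-inc lt))
    m<e : m < e
    m<e = sym (+-suc i (q ∸ j)) ≡≤ ((+-mono-≤ (sym βb ≡≤ count-mono B (<⇒≤ b<e)) (≤-reflexive (sym (count-at E-inc q-j<))))
      ≤≡ β+ε e e≤hi)
    m<hi : m < hi
    m<hi = ≤-trans m<e e≤hi
    1≤m : 1 ≤ m
    1≤m = ≤-trans 1≤i (m≤m+n i _)
    i≤β : i ≤ β m
    i≤β = sym βb ≡≤ count-mono B b≤m
    ε≤ : ε m ≤ q ∸ j
    ε≤ = ≮⇒≥ λ lt → <⇒≱ m<e (at-≤-count E-inc lt)
    position-≡ : i + row la 1 ∸ j ≡ m
    position-≡ = trans (cong (λ z → i + z ∸ j) row1) (+-∸-assoc i j≤q)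

  ε<q : ∀ {m} → m < hi → ε m < q
  ε<q {m} h = s≤s (count-mono E (s≤s⁻¹ (h ≤≡ sym pred-hi))) ≤≡ proj₂ (last pred-hi)

  uDiag≡β : ∀ {m} → 1 ≤ m → m < hi → uDiag la m ≡ β m
  uDiag≡β {m} 1≤m m<hi = conditional-maximum
    (λ i → (m <ᵇ i + row la 1) ∧ ferᵇ la i (i + row la 1 ∸ m)) (range 1 (length la)) (β m) bound in-range on-diagonal
    where
    1≤β : 1 ≤ β m
    1≤β = sym β1 ≡≤ count-mono B 1≤m
    β+ε≡m = β+ε m (<⇒≤ m<hi)
    end : Fer la (β m) (q ∸ ε m)
    end = box {m} {0} 1≤β (m<n⇒0<n∸m (ε<q m<hi))
    column-≡ : β m + row la 1 ∸ m ≡ q ∸ ε m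
    column-≡ = trans (cong₂ (λ y z → β m + y ∸ z) row1 (sym β+ε≡m)) ([m+n]∸[m+o]≡n∸o (β m) q (ε m))
    in-range : β m ∈ range 1 (length la)
    in-range = subst (_∈ range 1 (length la)) (pred-< 1≤β) (∈-applyUpTo⁺ (1 +_)
      (at-nonzero la (≤-trans (proj₁ (proj₂ end)) (proj₂ (proj₂ end)))))
    on-diagonal : ((m <ᵇ β m + row la 1) ∧ ferᵇ la (β m) (β m + row la 1 ∸ m)) ≡ true
    on-diagonal = cong₂ _∧_
      (<ᵇ-true (≤-trans (s≤s (≤-reflexive (sym β+ε≡m))) ((sym (+-suc (β m) (ε m)))
        ≡≤ +-monoʳ-≤ (β m) (ε<q m<hi ≤≡ sym row1))))
      (trans (cong (ferᵇ la (β m)) column-≡) (fer-true {la} end))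
    bound : ∀ i → i ∈ range 1 (length la) → ((m <ᵇ i + row la 1) ∧ ferᵇ la i (i + row la 1 ∸ m)) ≡ true → i ≤ β m
    bound i _ g = Box.i≤β fer ≤≡ cong β diag≡
      where
      fer : Fer la i (i + row la 1 ∸ m)
      fer = fer-Fer {la} (proj₂ (∧-true {m <ᵇ i + row la 1} g))
      m<i+q : m < i + row la 1
      m<i+q = <ᵇ⇒< m _ (≡⇒T (proj₁ (∧-true g)))
      diag≡ : diagonal i (i + row la 1 ∸ m) ≡ m
      diag≡ = trans (sym (Box.position-≡ fer)) (m∸[m∸n]≡n (<⇒≤ m<i+q))

  fbar-at : ∀ f {i j} → Fer la i j → fbar la B E f (at B (i ∸ 1) , at E (q ∸ j)) ≡ f i j
  fbar-at f {i} {j} fer rewrite indexOf-at B-inc (Box.i-1< fer) | indexOf-at E-inc (Box.q-j< fer) =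
    trans (inside (subst₂ (Fer la) (sym i≡) (sym j≡) fer)) (cong₂ f i≡ j≡)
    where
    i≡ = pred-< (Box.1≤i fer)
    j≡ = m∸[m∸n]≡n (Box.j≤q fer)
    inside : ∀ {i j} → Fer la i j → (if ferᵇ la i j then f i j else 0) ≡ f i j
    inside {i} {j} fer = cong (λ b → if b then f i j else 0) (fer-true {la} fer)

  fbar-notB : ∀ f {b} e → member B b ≡ false → fbar la B E f (b , e) ≡ 0
  fbar-notB f {b} e h rewrite indexOf-nothing b B h = refl

  fbar-notE : ∀ f b {e} → member E e ≡ false → fbar la B E f (b , e) ≡ 0
  fbar-notE f b {e} h with indexOf b B
  ... | nothing = refl
  ... | just _ rewrite indexOf-nothing e E h = refl

  labelled : ∀ {b e} → member B b ≡ true → member E e ≡ true → b < e →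
    ∃ λ i → ∃ λ j → Fer la i j × at B (i ∸ 1) ≡ b × at E (q ∸ j) ≡ e
  labelled {b} {e} hb he lt with ∈-at B (member-∈ B {b} hb) | ∈-at E (member-∈ E {e} he)
  ... | i , i< , refl | k , k< , refl = suc i , q ∸ k ,
    proj₂ (shapeIs (suc i) (q ∸ k)) (s≤s z≤n , i< , m<n⇒0<n∸m k< , m∸n≤m q k ,
      subst (λ z → at B i < at E z) (sym (m∸[m∸n]≡n (<⇒≤ k<))) lt) ,
    refl , cong (at E) (m∸[m∸n]≡n (<⇒≤ k<))

  fbar-cong : ∀ {f f'} → SameOn la f f' → ∀ b e → b < e → fbar la B E f (b , e) ≡ fbar la B E f' (b , e)
  fbar-cong {f} {f'} h b e lt with member B b in hb | member E e in he
  ... | false | _ = trans (fbar-notB f e hb) (sym (fbar-notB f' e hb))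
  ... | true | false = trans (fbar-notE f b he) (sym (fbar-notE f' b he))
  ... | true | true with labelled {b} {e} hb he lt
  ...   | i , j , fer , refl , refl = trans (fbar-at f fer) (trans (h i j fer) (sym (fbar-at f' fer)))

choose-≤ : ∀ b b' {x y} → (b ≡ true → b' ≡ true × x ≤ y) → choose b x ≤ choose b' y
choose-≤ false b' h = z≤n
choose-≤ true b' h with h refl
... | refl , le = le

-- Fillings and reverse plane partitions

module Correspondence (la B E : List ℕ) (partition : IsPartition la) (eb : ElementaryBip B E) (shapeIs : ShapeIs la B E)
  (w : List ℕ) (coxeter : IsCoxeterWord (hook11 la + 1) w) where
  open ElementaryBip eb using (hi; B-inc; E-inc)
  open Bipartition la B E eb shapeIs

  -- The number of elements of E from e on, which bounds the parts of a shape with columns e, ...,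
  -- `hi`.
  ε′ : ℕ → ℕ
  ε′ zero = q
  ε′ (suc e) = q ∸ ε e

  ε′-suc : ∀ e → ε′ (suc e) ≡ (if member E (suc e) then suc (ε′ (suc (suc e))) else ε′ (suc (suc e)))
  ε′-suc e with member E (suc e) in eq
  ... | false = cong (q ∸_) (sym (ε-notE e eq))
  ... | true = sym (trans (sym (+-∸-assoc 1 ε<)) (cong (λ z → suc q ∸ z) (ε-E e eq)))
    where
    ε< : ε (suc e) ≤ q
    ε< = count-≤ E (suc e)

  coxeter′ : IsCoxeterWord (suc (hook11 la)) w
  coxeter′ = subst (λ n → IsCoxeterWord n w) (+-comm (hook11 la) 1) coxeter

  side : ℕ → Bool
  side = proj₁ (GK-shapeAt {hook11 la} {w} coxeter′)

  open Growth (λ b e → cornerRule (side b) (side e)) hi (member B) (member E) β ε′ β-suc ε′-suc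

  entries : Filling → ℕ → ℕ → ℕ
  entries f b e = fbar la B E f (b , e)

  diagram : (ℕ → ℕ → ℕ) → ℕ → ℕ → Seq
  diagram F = shapeAt side hi F

  growth : ∀ F → IsGrowth F (diagram F)
  growth F = shapeAt-growth side hi (member B) (member E) β ε′ β-suc ε′-suc F

  supported : ∀ f → Supported (entries f)
  supported f = record { row-zero = λ b e _ h → fbar-notB f {b} e h ; col-zero = λ b e _ h → fbar-notE f b {e} h }

  RSK-diagram : ∀ f {i j} → Fer la i j → let m = diagonal i j in
    RSK la B E w f i j ≡ diagram (entries f) m (suc m) (β m ∸ i)
  RSK-diagram f {i} {j} fer = trans (cong (λ b → if b then value else 0) (fer-true {la} fer))
    (trans (cong₂ (λ n m → GK (cox w) (vertsAR n m) (fbar la B E f) (uDiag la m ∸ i + 1)) (+-comm (hook11 la) 1) position-≡)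
      (trans (cong (GK (cox w) (vertsAR (suc (hook11 la)) m) (fbar la B E f))
          (trans (+-comm (uDiag la m ∸ i) 1) (cong (λ u → suc (u ∸ i)) (uDiag≡β 1≤m m<hi))))
        (trans (proj₂ (GK-shapeAt {hook11 la} {w} coxeter′) (fbar la B E f) m 1≤m
            (s≤s⁻¹ (m<hi ≤≡ sym hook)) (β m ∸ i))
          (cong (λ n → shapeAt side n (entries f) m (suc m) (β m ∸ i)) hook))))
    where
    open Box fer
    m = diagonal i j
    value = GK (cox w) (vertsAR (hook11 la + 1) (i + row la 1 ∸ j)) (fbar la B E f) (uDiag la (i + row la 1 ∸ j) ∸ i + 1)

  well-defined : ∀ f f' → SameOn la f f' → SameOn la (RSK la B E w f) (RSK la B E w f')
  well-defined f f' h i j fer = trans (RSK-diagram f fer) (trans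
    (growth-determined (λ b e lt _ → fbar-cong h b e lt) (growth (entries f)) (growth (entries f')) m (suc m)
      (n<1+n m) (s≤s (<⇒≤ (Box.m<hi fer))) (β m ∸ i))
    (sym (RSK-diagram f' fer)))
    where m = diagonal i j

  data Kind (m : ℕ) : Set where
    isRow    : member B (suc m) ≡ true → member E (suc m) ≡ false → Kind m
    isColumn : member B (suc m) ≡ false → member E (suc m) ≡ true → Kind m
    isNone   : member B (suc m) ≡ false → member E (suc m) ≡ false → Kind m

  kind : ∀ m → Kind m
  kind m with member B (suc m) in hb | member E (suc m) in he
  ... | true | false = isRow hb he
  ... | false | true = isColumn hb he
  ... | false | false = isNone hb he
  ... | true | true = true≢false he (notE (suc m) hb)

  row-decreasing : ∀ {i i'} → 1 ≤ i → i ≤ i' → row la i' ≤ row la i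
  row-decreasing {i} {i'} h le = subst (λ z → row la z ≤ row la i) (m+[n∸m]≡n le) (go (i' ∸ i))
    where
    go : ∀ d → row la (i + d) ≤ row la i
    go zero = ≤-reflexive (cong (row la) (+-identityʳ i))
    go (suc d) = ≤-trans (cong (row la) (+-suc i d) ≡≤ partition (i + d) (≤-trans h (m≤m+n i d))) (go d)

  monotone⇒RPP : ∀ g → (∀ i j → Fer la i j → Fer la (suc i) j → g i j ≤ g (suc i) j) →
    (∀ i j → Fer la i j → Fer la i (suc j) → g i j ≤ g i (suc j)) → IsRPP la g
  monotone⇒RPP g down right i j i' j' fer@(1≤i , 1≤j , j≤) fer'@(_ , _ , j'≤) le le' =
    ≤-trans (subst (λ z → g i j ≤ g z j) (m+[n∸m]≡n le) (rows (i' ∸ i) (subst (λ z → Fer la z j) (sym (m+[n∸m]≡n le)) corner)))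
      (subst (λ z → g i' j ≤ g i' z) (m+[n∸m]≡n le') (columns (j' ∸ j) (subst (Fer la i') (sym (m+[n∸m]≡n le')) fer')))
    where
    corner : Fer la i' j
    corner = ≤-trans 1≤i le , 1≤j , ≤-trans le' j'≤
    rows : ∀ d → Fer la (i + d) j → g i j ≤ g (i + d) j
    rows zero _ = ≤-reflexive (cong (λ z → g z j) (sym (+-identityʳ i)))
    rows (suc d) f@(_ , _ , h) = ≤-trans (rows d f₀) ((down (i + d) j f₀ (subst (λ z → Fer la z j) (+-suc i d) f))
        ≤≡ cong (λ z → g z j) (sym (+-suc i d)))
      where
      f₀ : Fer la (i + d) j
      f₀ = ≤-trans 1≤i (m≤m+n i d) , 1≤j , ≤-trans h (row-decreasing (≤-trans 1≤i (m≤m+n i d)) (+-monoʳ-≤ i (n≤1+n d)))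
    columns : ∀ d → Fer la i' (j + d) → g i' j ≤ g i' (j + d)
    columns zero _ = ≤-reflexive (cong (g i') (sym (+-identityʳ j)))
    columns (suc d) f@(h₁ , _ , h) = ≤-trans (columns d f₀) ((right i' (j + d) f₀ (subst (Fer la i') (+-suc j d) f))
        ≤≡ cong (g i') (sym (+-suc j d)))
      where
      f₀ : Fer la i' (j + d)
      f₀ = h₁ , ≤-trans 1≤j (m≤m+n j d) , ≤-trans (+-monoʳ-≤ j (n≤1+n d)) h

  into-RPP : ∀ f → IsRPP la (RSK la B E w f)
  into-RPP f = monotone⇒RPP (RSK la B E w f)
    (λ i j fer fer' → subst₂ _≤_ (sym (RSK-diagram f fer)) (sym (RSK-diagram f fer'))
      (down i (diagonal i j) (Box.m<hi fer) (Box.m<hi fer') (Box.i≤β fer) (Box.i≤β fer')))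
    (λ i j fer fer' → subst₂ _≤_ (sym (RSK-diagram f fer)) (sym (RSK-diagram f fer'))
      (right i j (Box.j≤q fer') (Box.m<hi fer) (Box.i≤β fer')))
    where
    v : ℕ → Seq
    v m = diagram (entries f) m (suc m)
    neither : ∀ {m} → suc m ≤ hi → member B (suc m) ≡ false → member E (suc m) ≡ false → ⊥
    neither {m} h hb he with ElementaryBip.covered eb (suc m) (≤-trans lo≤1 (s≤s z≤n)) h
    ... | inj₁ b = true≢false (member-true b) hb
    ... | inj₂ e = true≢false (member-true e) he
    -- One step down leads from the diagonal m to m + 1. If m + 1 is a row, the index of the part
    -- stays the same; if it is a column, the index drops by one. These are the two inequalities of
    -- interlacing.
    down : ∀ i m → m < hi → suc m < hi → i ≤ β m → suc i ≤ β (suc m) → v m (β m ∸ i) ≤ v (suc m) (β (suc m) ∸ suc i)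
    down i m m<hi m<hi' h h' with kind m
    ... | isNone hb he = ⊥-elim (neither m<hi hb he)
    ... | isRow hb he = (upper (adjacent-B (growth (entries f)) (supported f) m m<hi he) (β m ∸ i))
        ≤≡ cong (λ z → v (suc m) (z ∸ suc i)) (sym (β-B m hb))
    ... | isColumn hb he = (cong (v m) (+-∸-assoc 1 (h' ≤≡ β-notB m hb)))
        ≡≤ ((lower (adjacent-E (growth (entries f)) (supported f) m m<hi hb) (β m ∸ suc i))
          ≤≡ cong (λ z → v (suc m) (z ∸ suc i)) (sym (β-notB m hb)))
    -- One step to the right leads back from the diagonal m + 1 to m, so the roles of `upper` and
    -- `lower` are exchanged.
    right : ∀ i j → suc j ≤ q → diagonal i j < hi → i ≤ β (diagonal i (suc j)) →
      v (diagonal i j) (β (diagonal i j) ∸ i) ≤ v (diagonal i (suc j)) (β (diagonal i (suc j)) ∸ i)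
    right i j le m<hi h = subst (λ z → v z (β z ∸ i) ≤ v m (β m ∸ i))
        (trans (sym (+-suc i (q ∸ suc j))) (cong (i +_) (sym (+-∸-assoc 1 le)))) step
      where
      m = diagonal i (suc j)
      m< : suc m ≤ hi
      m< = <⇒≤ (subst (_< hi) (trans (cong (i +_) (+-∸-assoc 1 le)) (+-suc i (q ∸ suc j))) m<hi)
      step : v (suc m) (β (suc m) ∸ i) ≤ v m (β m ∸ i)
      step with kind m
      ... | isNone hb he = ⊥-elim (neither m< hb he)
      ... | isColumn hb he = (cong (λ z → v (suc m) (z ∸ i)) (β-notB m hb))
          ≡≤ upper (adjacent-E (growth (entries f)) (supported f) m m< hb) (β m ∸ i)
      ... | isRow hb he = (cong (v (suc m)) (trans (cong (_∸ i) (β-B m hb)) (+-∸-assoc 1 h)))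
          ≡≤ lower (adjacent-B (growth (entries f)) (supported f) m m< he) (β m ∸ i)

  box-diagonal : ∀ {m k} → m ≤ hi → k < β m → k < q ∸ ε m → diagonal (β m ∸ k) (q ∸ ε m ∸ k) ≡ m
  box-diagonal {m} {k} le h h' = trans (cong (β m ∸ k +_) complement) (trans
      (trans (cong (β m ∸ k +_) (+-comm (ε m) k)) (trans (sym (+-assoc (β m ∸ k) k (ε m))) (cong (_+ ε m) (m∸n+n≡m (<⇒≤ h)))))
      (β+ε m le))
    where
    complement : q ∸ (q ∸ ε m ∸ k) ≡ ε m + k
    complement = trans (cong (q ∸_) (∸-+-assoc q (ε m) k))
      (m∸[m∸n]≡n (+-monoʳ-≤ (ε m) (<⇒≤ h') ≤≡ m+[n∸m]≡n (count-≤ E m)))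

  injective : ∀ f f' → SameOn la (RSK la B E w f) (RSK la B E w f') → SameOn la f f'
  injective f f' h i j fer = trans (sym (fbar-at f fer)) (trans
      (subst (λ b → entries f b e ≡ entries f' b e) (pred-< (Box.1≤b fer))
        (growth-injective disjoint (growth (entries f)) (growth (entries f')) (supported f) (supported f') same
          (at B (i ∸ 1) ∸ 1) e (subst (_< e) (sym (pred-< (Box.1≤b fer))) (Box.b<e fer)) (Box.e≤hi fer)))
      (fbar-at f' fer))
    where
    e = at E (q ∸ j)
    disjoint : ∀ m → member B m ≡ true → member E m ≡ true → ⊥
    disjoint m hb he = true≢false he (notE m hb)
    -- The parts with index below both `β m` and `q ∸ ε m` are the values on the boxes of the
    -- diagonal m; all others vanish by `vanishB` or `vanishE`.
    same : ∀ m → m ≤ hi → diagram (entries f) m (suc m) ≗ diagram (entries f') m (suc m)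
    same m le k with k <? β m | k <? q ∸ ε m
    ... | no k≮ | _ = trans (vanishB (growth (entries f)) (supported f) m (suc m) k (n<1+n m) (s≤s le) (≮⇒≥ k≮))
        (sym (vanishB (growth (entries f')) (supported f') m (suc m) k (n<1+n m) (s≤s le) (≮⇒≥ k≮)))
    ... | yes _ | no k≮ = trans (vanishE (growth (entries f)) (supported f) m (suc m) k (n<1+n m) (s≤s le) (≮⇒≥ k≮))
        (sym (vanishE (growth (entries f')) (supported f') m (suc m) k (n<1+n m) (s≤s le) (≮⇒≥ k≮)))
    ... | yes lt | yes lt' = trans (sym (read f)) (trans (h _ _ (box lt lt')) (read f'))
      where
      read : ∀ f → RSK la B E w f (β m ∸ k) (q ∸ ε m ∸ k) ≡ diagram (entries f) m (suc m) k
      read f = trans (RSK-diagram f (box lt lt')) (trans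
        (cong (λ d → diagram (entries f) d (suc d) (β d ∸ (β m ∸ k))) (box-diagonal le lt lt'))
        (cong (diagram (entries f) m (suc m)) (m∸[m∸n]≡n (<⇒≤ lt))))

  module Surjective (g : Filling) (rpp : IsRPP la g) where
    -- g read along the diagonal m from its maximal box towards the border of λ, hence decreasing,
    -- and continued by 0. That g is a reverse plane partition becomes the interlacing of
    -- neighbouring sequences.
    G : ℕ → Seq
    G m k = choose ((k <ᵇ β m) ∧ (k <ᵇ q ∸ ε m)) (g (β m ∸ k) (q ∸ ε m ∸ k))

    G-box : ∀ {m k} → k < β m → k < q ∸ ε m → G m k ≡ g (β m ∸ k) (q ∸ ε m ∸ k)
    G-box {m} {k} h h' = cong (λ b → choose b (g (β m ∸ k) (q ∸ ε m ∸ k))) (cong₂ _∧_ (<ᵇ-true h) (<ᵇ-true h'))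

    G-≤ : ∀ {m m' k k'} → (k < β m → k < q ∸ ε m →
      k' < β m' × k' < q ∸ ε m' × β m ∸ k ≤ β m' ∸ k' × q ∸ ε m ∸ k ≤ q ∸ ε m' ∸ k') → G m k ≤ G m' k'
    G-≤ {m} {m'} {k} {k'} h = choose-≤ _ _ inside
      where
      inside : ((k <ᵇ β m) ∧ (k <ᵇ q ∸ ε m)) ≡ true → _
      inside e with <ᵇ⇒< k (β m) (≡⇒T (proj₁ (∧-true e))) | <ᵇ⇒< k (q ∸ ε m) (≡⇒T (proj₂ (∧-true {k <ᵇ β m} e)))
      ... | lt | lt' with h lt lt'
      ...   | p₁ , p₂ , p₃ , p₄ = cong₂ _∧_ (<ᵇ-true p₁) (<ᵇ-true p₂) , rpp _ _ _ _ (box lt lt') (box p₁ p₂) p₃ p₄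

    G-vanishB : ∀ m i → β m ≤ i → G m i ≡ 0
    G-vanishB m i h with i <ᵇ β m in e
    ... | false = refl
    ... | true = ⊥-elim (<⇒≱ (<ᵇ⇒< i (β m) (≡⇒T e)) h)

    G-vanishE : ∀ m i → ε′ (suc m) ≤ i → G m i ≡ 0
    G-vanishE m i h with i <ᵇ β m | i <ᵇ q ∸ ε m in e
    ... | false | _ = refl
    ... | true | false = refl
    ... | true | true = ⊥-elim (<⇒≱ (<ᵇ⇒< i (q ∸ ε m) (≡⇒T e)) h)

    G-none : ∀ m → member B (suc m) ≡ false → member E (suc m) ≡ false → G m ≗ G (suc m)
    G-none m hb he k rewrite β-notB m hb | ε-notE m he = refl

    G-dec : ∀ m → G m ≺ G m
    G-dec m = interlace (λ _ → ≤-refl)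
      (λ k → G-≤ {m} {m} {suc k} {k} λ h h' → <⇒≤ h , <⇒≤ h' , ∸-monoʳ-≤ (β m) (n≤1+n k) , ∸-monoʳ-≤ (q ∸ ε m) (n≤1+n k))

    G-B : ∀ m → member B (suc m) ≡ true → G m ≺ G (suc m)
    G-B m hb = interlace
      (λ k → G-≤ {m} {suc m} {k} {k} λ h h' → m<n⇒m<1+n h ≤≡ sym β≡ , h' ≤≡ v≡ ,
        ∸-monoˡ-≤ k (n≤1+n (β m) ≤≡ sym β≡) , ∸-monoˡ-≤ k (≤-reflexive v≡))
      (λ k → G-≤ {suc m} {m} {suc k} {k} λ h h' → s≤s⁻¹ (h ≤≡ β≡) , <⇒≤ h' ≤≡ sym v≡ ,
        ≤-reflexive (cong (_∸ suc k) β≡) , ≤-trans (∸-monoʳ-≤ (q ∸ ε (suc m)) (n≤1+n k)) (∸-monoˡ-≤ k (≤-reflexive (sym v≡))))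
      where
      β≡ : β (suc m) ≡ suc (β m)
      β≡ = β-B m hb
      v≡ : q ∸ ε m ≡ q ∸ ε (suc m)
      v≡ = cong (q ∸_) (sym (ε-notE m (notE (suc m) hb)))

    G-E : ∀ m → member E (suc m) ≡ true → G (suc m) ≺ G m
    G-E m he = interlace
      (λ k → G-≤ {suc m} {m} {k} {k} λ h h' → h ≤≡ β≡ , ≤-trans h' v≤ ,
        ∸-monoˡ-≤ k (≤-reflexive β≡) , ∸-monoˡ-≤ k v≤)
      (λ k → G-≤ {m} {suc m} {suc k} {k} λ h h' → <⇒≤ h ≤≡ sym β≡ ,
        s≤s⁻¹ (h' ≤≡ v≡) ,
        ≤-trans (∸-monoʳ-≤ (β m) (n≤1+n k)) (∸-monoˡ-≤ k (≤-reflexive (sym β≡))) ,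
        ≤-reflexive (cong (_∸ suc k) v≡))
      where
      β≡ : β (suc m) ≡ β m
      β≡ = β-notB m (notB (suc m) he)
      v≡ : q ∸ ε m ≡ suc (q ∸ ε (suc m))
      v≡ = trans (ε′-suc m) (cong (λ b → if b then suc (q ∸ ε (suc m)) else (q ∸ ε (suc m))) he)
      v≤ : q ∸ ε (suc m) ≤ q ∸ ε m
      v≤ = (n≤1+n _) ≤≡ sym v≡

    ε′-end : ε′ (suc hi) ≡ 0
    ε′-end = trans (cong (q ∸_) (ε-hi hi ≤-refl)) (n∸n≡0 q)

    F₀ : ℕ → ℕ → ℕ
    F₀ = rebuilt β0 ε′-end G G-B G-E G-none G-dec G-vanishB G-vanishE

    preimage : Filling
    preimage i j = F₀ (at B (i ∸ 1)) (at E (q ∸ j))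

    entries-preimage : ∀ b e → b < e → e ≤ hi → entries preimage b e ≡ F₀ b e
    entries-preimage b e lt _ with member B b in hb | member E e in he
    ... | false | _ = trans (fbar-notB preimage {b} e hb) (sym (Supported.row-zero sup b e lt hb))
      where sup = rebuilt-supported β0 ε′-end G G-B G-E G-none G-dec G-vanishB G-vanishE
    ... | true | false = trans (fbar-notE preimage b {e} he) (sym (Supported.col-zero sup b e lt he))
      where sup = rebuilt-supported β0 ε′-end G G-B G-E G-none G-dec G-vanishB G-vanishE
    ... | true | true with labelled {b} {e} hb he lt
    ...   | i , j , fer , refl , refl = fbar-at preimage fer

    -- The growth diagram of `preimage` has the entries `F₀` on the staircase, so its shapes are
    -- those of the growth diagram of `F₀`, whose diagonal is `G` by `rebuilt-growth`.
    RSK-preimage : SameOn la (RSK la B E w preimage) g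
    RSK-preimage i j fer = trans (RSK-diagram preimage fer) (trans
        (growth-determined entries-preimage (growth (entries preimage)) (growth F₀) m (suc m) (n<1+n m) (s≤s (<⇒≤ m<hi)) (β m ∸ i))
        (trans (rebuilt-growth β0 ε′-end G G-B G-E G-none G-dec G-vanishB G-vanishE (growth F₀) m (<⇒≤ m<hi) (β m ∸ i))
          (trans (G-box k<β (≤-trans (s≤s (≤-reflexive k≡)) k<v)) (cong₂ g (m∸[m∸n]≡n i≤β) j≡))))
      where
      open Box fer
      m = diagonal i j
      k<β : β m ∸ i < β m
      k<β = ∸-monoʳ-< {o = 0} 1≤i i≤β
      k≡ : β m ∸ i ≡ q ∸ j ∸ ε m
      k≡ = trans (sym ([m+n]∸[m+o]≡n∸o (ε m) (β m) i))
        (trans (cong (_∸ (ε m + i)) (trans (+-comm (ε m) (β m)) (β+ε m (<⇒≤ m<hi))))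
          (trans (cong (i + (q ∸ j) ∸_) (+-comm (ε m) i)) ([m+n]∸[m+o]≡n∸o i (q ∸ j) (ε m))))
      swap : q ∸ j ∸ ε m ≡ q ∸ ε m ∸ j
      swap = trans (∸-+-assoc q j (ε m)) (trans (cong (q ∸_) (+-comm j (ε m))) (sym (∸-+-assoc q (ε m) j)))
      j≤v : j ≤ q ∸ ε m
      j≤v = sym (m∸[m∸n]≡n j≤q) ≡≤ ∸-monoʳ-≤ q ε≤
      k<v : suc (q ∸ j ∸ ε m) ≤ q ∸ ε m
      k<v = ≤-trans (s≤s (≤-reflexive swap)) (∸-monoʳ-< {o = 0} 1≤j j≤v)
      j≡ : q ∸ ε m ∸ (β m ∸ i) ≡ j
      j≡ = trans (cong (q ∸ ε m ∸_) (trans k≡ swap)) (m∸[m∸n]≡n j≤v)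

theorem4p1 : (la : List ℕ) → IsPartition la → NonzeroPartition la →
    (B E : List ℕ) → ElementaryBip B E → ShapeIs la B E →
    (w : List ℕ) → IsCoxeterWord (hook11 la + 1) w →
    OneToOneFillingsToRPP la (RSK la B E w)
theorem4p1 la partition _ B E eb shapeIs w coxeter = record
  { well-defined = well-defined ; into-RPP = into-RPP ; injective = injective
  ; surjective = λ g rpp → let open Surjective g rpp in preimage , RSK-preimage }
  where open Correspondence la B E partition eb shapeIs w coxeter
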